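{- Fix two distinct primes $p$ and $q$. Then, with at most finitely many exceptions, no cyclic group $\mathbb{Z}_N$ with $\operatorname{rad}(N)=pq$ possesses a pair of primitive formally dual subsets. That is, the set of positive integers $N$ with $\operatorname{rad}(N)=pq$ for which there exist subsets $S,T\subseteq\mathbb{Z}_N$, both primitive and formally dual to each other, is finite.
   Context: $\mathbb{Z}_N$ is the cyclic group (ring of integers) modulo $N$, $\zeta_N=e^{2\pi i/N}$, and $\operatorname{rad}(N)$ is the product of the distinct primes dividing $N$. A subset $T\subseteq\mathbb{Z}_N$ is primitive if it is not contained in any coset of a proper subgroup of $\mathbb{Z}_N$. For $T\subseteq\mathbb{Z}_N$ let $\nu_T(y)=\#\{(t,t')\in T\times T: t-t'=y\}$. Two nonempty subsets $S,T\subseteq\mathbb{Z}_N$ are formally dual if for every $y\in\mathbb{Z}_N$, $\frac{1}{|S|^2}\left|\sum_{x\in S}\zeta_N^{xy}\right|^2=\frac{1}{|T|}\nu_T(y)$. -}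

module Defs where

open import Level using (0ℓ)
open import Data.Bool.Base using (true; false)
open import Data.Nat.Base using (ℕ; zero; suc; _+_; _*_; _∸_; _<_; NonZero)
open import Data.Nat.DivMod using (_mod_)
open import Data.Nat.Divisibility using (_∣?_)
open import Data.Nat.Primality using (prime?)
open import Data.Fin.Base using (Fin; toℕ)
open import Data.Fin.Subset using (Subset; _∈_; _∉_; ∣_∣; Nonempty)
open import Data.Vec.Base using (lookup)
open import Data.List.Base using (List; foldr; filter; upTo; allFin)
open import Data.Nat.ListAction using (product)
open import Data.Product.Base using (_×_; ∃-syntax)
open import Data.Sum.Base using (_⊎_)
open import Relation.Nullary.Negation.Core using (¬_)
open import Relation.Nullary.Decidable.Core using (_×-dec_)
open import Relation.Binary.PropositionalEquality using (_≡_)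
open import Algebra.Bundles using (CommutativeRing)
import Algebra.Bundles
import Algebra.Definitions.RawSemiring as RS

rad : ℕ → ℕ
rad N = product (filter (λ r → prime? r ×-dec (r ∣? N)) (upTo (suc N)))

module ZN (N : ℕ) .{{_ : NonZero N}} where

  0ᶻ : Fin N
  0ᶻ = 0 mod N

  _+ᶻ_ : Fin N → Fin N → Fin N
  a +ᶻ b = (toℕ a + toℕ b) mod N

  -ᶻ_ : Fin N → Fin N
  -ᶻ a = (N ∸ toℕ a) mod N

  _-ᶻ_ : Fin N → Fin N → Fin N
  a -ᶻ b = a +ᶻ (-ᶻ b)

  record IsSubgroup (H : Subset N) : Set where
    field
      has-0   : 0ᶻ ∈ H
      +-clos  : ∀ a b → a ∈ H → b ∈ H → (a +ᶻ b) ∈ H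
      neg-clos : ∀ a → a ∈ H → (-ᶻ a) ∈ H

  InCoset : Subset N → Fin N → Subset N → Set
  InCoset T a H = ∀ t → t ∈ T → ∃[ h ] (h ∈ H × t ≡ a +ᶻ h)

  Primitive : Subset N → Set
  Primitive T = ¬ (∃[ H ] (IsSubgroup H × (∃[ x ] x ∉ H) × ∃[ a ] InCoset T a H))

  sumℕ : (Fin N → ℕ) → ℕ
  sumℕ f = foldr (λ i acc → f i + acc) 0 (allFin N)

  indicator : Subset N → Fin N → ℕ
  indicator T i with lookup T i
  ... | true  = 1
  ... | false = 0

  eqInd : Fin N → Fin N → ℕ
  eqInd a b with toℕ a Data.Nat.Base.≡ᵇ toℕ b
  ... | true  = 1
  ... | false = 0

  ν : Subset N → Fin N → ℕ
  ν T y = sumℕ (λ t → sumℕ (λ t' → indicator T t * indicator T t' * eqInd (t -ᶻ t') y))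

-- An exact model of the complex numbers ℚ(ζ_N) in which the defining
-- identity lives: a commutative integral domain of characteristic 0
-- together with a primitive N-th root of unity ζ (playing e^{2πi/N}).
-- Complex conjugation of ζ^k is ζ^{-k} = (ζ^{N-1})^k.

record CyclotomicModel (N : ℕ) : Set₁ where
  field
    R : CommutativeRing 0ℓ 0ℓ
  open CommutativeRing R public renaming (_*_ to _*ᴿ_; _+_ to _+ᴿ_)
  open RS (Algebra.Bundles.Semiring.rawSemiring semiring) public using (_^_) renaming (_×_ to _·1_)
  field
    ζ : Carrier
    domain   : ∀ a b → a *ᴿ b ≈ 0# → a ≈ 0# ⊎ b ≈ 0#
    char0    : ∀ n → n ·1 1# ≈ 0# → n ≡ 0
    ζ^N≈1    : ζ ^ N ≈ 1#
    ζ-primitive : ∀ k → 0 < k → k < N → ¬ (ζ ^ k ≈ 1#)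

  ζ⁻¹ : Carrier
  ζ⁻¹ = ζ ^ (N ∸ 1)

module Dual {N : ℕ} .{{_ : NonZero N}} (M : CyclotomicModel N) where
  open CyclotomicModel M
  open ZN N

  sumR : (Fin N → Carrier) → Carrier
  sumR f = foldr (λ i acc → f i +ᴿ acc) 0# (allFin N)

  restrict : Subset N → (Fin N → Carrier) → Fin N → Carrier
  restrict S f i with lookup S i
  ... | true  = f i
  ... | false = 0#

  Ŝ : Subset N → Fin N → Carrier
  Ŝ S y = sumR (restrict S (λ x → ζ ^ (toℕ x * toℕ y)))

  -- its complex conjugate Σ_{x∈S} ζ^{-xy}
  Ŝ̄ : Subset N → Fin N → Carrier
  Ŝ̄ S y = sumR (restrict S (λ x → ζ⁻¹ ^ (toℕ x * toℕ y)))

  -- (1/|S|²)|Σ_{x∈S} ζ^{xy}|² = ν_T(y)/|T|, denominators cleared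
  FormallyDual : Subset N → Subset N → Set
  FormallyDual S T =
    Nonempty S × Nonempty T ×
    (∀ y → ∣ T ∣ ·1 (Ŝ S y *ᴿ Ŝ̄ S y) ≈ (∣ S ∣ * ∣ S ∣ * ν T y) ·1 1#)

{-# OPTIONS --safe #-}

-- Let S, T be formally dual with b = |T| ≤ a = |S|, so that a b = N = pᵐ qⁿ.  As T is primitive, it has a
-- difference y prime to N, and duality at y gives b A = a² ν_T(y), where A = |S(ζ)|² for some primitive N-th
-- root of unity ζ.  If Σ f(x) ζˣ = 0, then Δ f(x) := f(x) - f(x + N/p) - f(x + N/q) + f(x + N/p + N/q) vanishes
-- for all x.  Applied to the autocorrelation of S this shows that A is an integer below 2 a.  Hence ν_T(y) = 1
-- and a ≤ A, and A has no prime factors besides p and q.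
--
-- Choose v congruent to a power of q modulo pᵐ and to a power of p modulo qⁿ.  The automorphism ζ ↦ ζᵛ acts
-- as a power of Frobenius locally at q and at p, so A divides S(ζᵛ) S(ζ⁻¹).  The quotient has absolute value
-- one, and an element of ℤ[ζ] of absolute value one is ± ζʲ.  Hence S(ζᵂ) = ζᴶ S(ζ) for W = v².  Iterating,
-- and averaging over l < N, leaves only the terms of S(ζ) whose exponents x satisfy (W - 1) x ≡ J modulo N.
-- For a suitable v there are at most G of them, where G depends only on p and q.  The bound A ≤ 2 |S| applied
-- to these terms yields a ≤ A ≤ 2 G, and N = a b ≤ 4 G².
--
-- That a relation at ζ persists at ζᵘ for u prime to N follows from e(ζ)ʳ ≡ e(ζʳ) modulo r, since u is
-- congruent modulo N to a product of primes r outside any given finite set.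
module Submission where

open import Level using (0ℓ)
open import Algebra.Bundles using (CommutativeRing)
open import Data.Nat.Base as ℕ using (ℕ; zero; suc; z≤n; s≤s; NonZero)
import Data.Nat.Properties as ℕ
open import Data.Nat.Primality using (Prime; prime⇒nonZero; prime⇒nonTrivial)
open import Data.Nat.Coprimality using (Coprime)
open import Data.Integer.Base as ℤ using (ℤ; 0ℤ; 1ℤ)
import Data.Integer.Properties as ℤ
open import Data.Product.Base using (_,_; ∃-syntax; proj₁; proj₂)
open import Data.Sum.Base using (_⊎_; inj₁; inj₂; [_,_]′)
open import Function.Base using (_∘_; id)
open import Relation.Nullary using (Dec; yes; no; ¬_; contradiction)
open import Relation.Binary.PropositionalEquality as ≡ using (_≡_; _≢_)

-- The model is a bare integral domain: it has no absolute value, no Galois group and no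
-- factorisation of ideals, and each of these gets a substitute. Conjugation is evaluation at
-- ζ^(N-1). Automorphisms are substitutions in polynomial expressions, and that they respect
-- equality of values is a theorem about relations between roots of unity. Instead of the primes
-- above q the proof uses the single element ζ^L - 1, where L is the part of N prime to q; a power
-- of it is associated to q. All inequalities are between integers, because Δ turns an identity at
-- one root into an identity between values of autocorrelations. The difficulty is uniformity in N.
-- The exponent v has to depend on N, but v² - 1 is arranged to agree, modulo the two prime powers
-- in N, with q^(2d) - 1 and p^(2d) - 1 for an exponent d chosen before N; this is where G comes
-- from. Squaring v removes the sign of the root of unity. The further demand that v² be 1 modulo p²
-- and q² makes l ↦ 1 + V + ... + V^(l-1), with V = v², a permutation modulo N, which is what the
-- averaging requires.

module RingExpressions where

  open import Data.Bool.Base using (Bool; true; false; if_then_else_)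
  open import Data.Integer.Base using (-1ℤ)
  open import Data.List.Base using (List; []; _∷_)
  open import Data.List.Properties using (≡-dec)
  open import Data.Product.Base using (_×_)

  -- Normal forms of commutative ring expressions

  infixl 6 _:+_ _:-_
  infixl 7 _:*_
  infix 4 _:=_
  infix 8 :-_

  data RingExpr : Set where
    var  : ℕ → RingExpr
    con  : ℤ → RingExpr
    _:+_ _:*_ : RingExpr → RingExpr → RingExpr
    :-_  : RingExpr → RingExpr

  _:-_ : RingExpr → RingExpr → RingExpr
  a :- b = a :+ :- b

  _:=_ : RingExpr → RingExpr → RingExpr × RingExpr
  _:=_ = _,_

  Monomial NormalForm : Set
  Monomial = List ℕ
  NormalForm = List (ℤ × Monomial)

  insertVar : ℕ → Monomial → Monomial
  insertVar i [] = i ∷ []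
  insertVar i (j ∷ m) = if i ℕ.≤ᵇ j then i ∷ j ∷ m else j ∷ insertVar i m

  mulMonomial : Monomial → Monomial → Monomial
  mulMonomial [] m = m
  mulMonomial (i ∷ l) m = insertVar i (mulMonomial l m)

  precedes : Monomial → Monomial → Bool
  precedes [] _ = true
  precedes (_ ∷ _) [] = false
  precedes (i ∷ l) (j ∷ m) = if i ℕ.≡ᵇ j then precedes l m else i ℕ.<ᵇ j

  -- Zero coefficients are discarded here, so that cancellation leaves no trace and identities can
  -- be checked by `refl` on normal forms.
  consTerm : ℤ → Monomial → NormalForm → NormalForm
  consTerm c m p with c ℤ.≟ 0ℤ
  ... | yes _ = p
  ... | no _ = (c , m) ∷ p

  addTerm : ℤ → Monomial → NormalForm → NormalForm
  addTerm c m [] = consTerm c m []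
  addTerm c m ((d , l) ∷ p) with ≡-dec ℕ._≟_ m l
  ... | yes _ = consTerm (c ℤ.+ d) l p
  ... | no _ = if precedes m l then consTerm c m ((d , l) ∷ p) else (d , l) ∷ addTerm c m p

  addNF : NormalForm → NormalForm → NormalForm
  addNF [] q = q
  addNF ((c , m) ∷ p) q = addTerm c m (addNF p q)

  mulTerm : ℤ → Monomial → NormalForm → NormalForm
  mulTerm c m [] = []
  mulTerm c m ((d , l) ∷ p) = addTerm (c ℤ.* d) (mulMonomial m l) (mulTerm c m p)

  mulNF : NormalForm → NormalForm → NormalForm
  mulNF [] q = []
  mulNF ((c , m) ∷ p) q = addNF (mulTerm c m q) (mulNF p q)

  normalise : RingExpr → NormalForm
  normalise (var i) = (1ℤ , i ∷ []) ∷ []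
  normalise (con c) = consTerm c [] []
  normalise (a :+ b) = addNF (normalise a) (normalise b)
  normalise (a :* b) = mulNF (normalise a) (normalise b)
  normalise (:- a) = mulTerm -1ℤ [] (normalise a)

-- Integer polynomials as expressions

module IntegerPolynomials where

  open import Data.Nat.DivMod using (_%_)
  open import Data.Integer.Base using (+_; -[1+_])

  infixl 6 _⊕_
  infixl 7 _⊗_
  infix 8 ⊖_

  -- An element of ℤ[z] is kept as an expression and not as a value, because the same expression has
  -- to be evaluated at other roots of unity. Substitution for `X` is then plain recursion; what has
  -- to be proved later is that it respects equality of values.
  data Poly : Set where
    𝟘 𝟙 X : Poly
    _⊕_ _⊗_ : Poly → Poly → Poly
    ⊖_ : Poly → Poly

  infix 9 _[_]
  _[_] : Poly → Poly → Poly
  𝟘 [ d ] = 𝟘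
  𝟙 [ d ] = 𝟙
  X [ d ] = d
  (a ⊕ b) [ d ] = a [ d ] ⊕ b [ d ]
  (a ⊗ b) [ d ] = a [ d ] ⊗ b [ d ]
  (⊖ a) [ d ] = ⊖ (a [ d ])

  power : Poly → ℕ → Poly
  power e zero = 𝟙
  power e (suc n) = e ⊗ power e n

  natural : ℕ → Poly
  natural zero = 𝟘
  natural (suc n) = 𝟙 ⊕ natural n

  constant : ℤ → Poly
  constant (+ n) = natural n
  constant -[1+ n ] = ⊖ natural (suc n)

  fromCoeffs : ℕ → (ℕ → ℤ) → Poly
  fromCoeffs zero a = 𝟘
  fromCoeffs (suc n) a = fromCoeffs n a ⊕ constant (a n) ⊗ power X n

  χℤ : ∀ {p} {P : Set p} → Dec P → ℤ
  χℤ (yes _) = 1ℤ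
  χℤ (no _) = 0ℤ

  sumℤ : ℕ → (ℕ → ℤ) → ℤ
  sumℤ zero f = 0ℤ
  sumℤ (suc n) f = sumℤ n f ℤ.+ f n

  -- The coefficients of the remainder modulo X^N - 1: exponents add modulo N, so multiplication is
  -- cyclic convolution. They determine the value at every N-th root of unity.
  coeffs : (N : ℕ) .{{_ : NonZero N}} → Poly → ℕ → ℤ
  coeffs N 𝟘 k = 0ℤ
  coeffs N 𝟙 k = χℤ (k ℕ.≟ 0)
  coeffs N X k = χℤ (k ℕ.≟ 1 % N)
  coeffs N (a ⊕ b) k = coeffs N a k ℤ.+ coeffs N b k
  coeffs N (a ⊗ b) k = sumℤ N (λ i → sumℤ N (λ j → χℤ (k ℕ.≟ (i ℕ.+ j) % N) ℤ.* (coeffs N a i ℤ.* coeffs N b j)))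
  coeffs N (⊖ a) k = ℤ.- coeffs N a k

-- Elementary number theory

module Arithmetic where

  open import Data.Nat.Base
  open import Data.Nat.Properties
  open import Data.Nat.Divisibility
  open import Data.Nat.DivMod
  open import Data.Nat.Primality
  open import Data.Nat.Combinatorics using (_C_; nC1≡n; nCk+nC[k+1]≡[n+1]C[k+1])
  open import Data.Nat.Induction using (<-rec)
  open import Data.Nat.GCD using (gcd; gcd[m,n]∣m; gcd[m,n]∣n; gcd[m,n]≡0⇒m≡0)
  import Data.Nat.Tactic.RingSolver as ℕ-Solver
  open import Data.List.Base using ([]; _∷_)
  open import Data.List.Relation.Unary.All using ([]; _∷_)
  open import Data.Nat.ListAction using (product)
  open import Data.Nat.Primality.Factorisation using (factorise)
  open import Data.Product.Base using (_×_)
  open import Data.Empty using (⊥; ⊥-elim)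
  open import Relation.Binary.PropositionalEquality
  open import Data.Fin.Base using (toℕ; fromℕ<)
  open import Data.Fin.Properties using (pigeonhole; toℕ-fromℕ<)
  open import Data.Empty using (⊥)
  open import Data.Nat.Coprimality as Coprimality using (Coprime; coprime-divisor)

  absorption : ∀ n k → suc k * (suc n C suc k) ≡ suc n * (n C k)
  absorption zero zero = refl
  absorption zero (suc k) = trans (*-zeroʳ k) refl
  absorption (suc n) zero = trans (*-identityˡ _) (trans (nC1≡n (2 + n)) (sym (*-identityʳ _)))
  absorption (suc n) (suc k) = begin
    (2 + k) * ((2 + n) C (2 + k))
      ≡⟨ cong ((2 + k) *_) (nCk+nC[k+1]≡[n+1]C[k+1] (suc n) (suc k)) ⟨
    (2 + k) * ((suc n C suc k) + (suc n C (2 + k)))                 ≡⟨ dist k (suc n C suc k) (suc n C (2 + k)) ⟩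
    (suc n C suc k) + (suc k * (suc n C suc k) + (2 + k) * (suc n C (2 + k)))
      ≡⟨ cong ((suc n C suc k) +_) (cong₂ _+_ (absorption n k) (absorption n (suc k))) ⟩
    (suc n C suc k) + (suc n * (n C k) + suc n * (n C suc k))
      ≡⟨ cong ((suc n C suc k) +_) (*-distribˡ-+ (suc n) (n C k) (n C suc k)) ⟨
    (suc n C suc k) + suc n * ((n C k) + (n C suc k))
      ≡⟨ cong (λ x → (suc n C suc k) + suc n * x) (nCk+nC[k+1]≡[n+1]C[k+1] n k) ⟩
    (suc n C suc k) + suc n * (suc n C suc k)                       ∎
    where
    open ≡-Reasoning
    dist : ∀ k a b → (2 + k) * (a + b) ≡ a + (suc k * a + (2 + k) * b)
    dist = ℕ-Solver.solve-∀

  prime∣C : ∀ {q} → Prime q → ∀ k → 0 < k → k < q → q ∣ q C k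
  prime∣C {suc n} pq (suc k) _ k<q with euclidsLemma (suc k) (suc n C suc k) pq
    (subst (suc n ∣_) (sym (absorption n k)) (m∣m*n (n C k)))
  ... | inj₁ q∣k = contradiction q∣k (>⇒∤ k<q)
  ... | inj₂ h = h

  private
    -- The witness is c with the primes of u removed: as long as gcd(c, u) is not 1, divide c by it.
    -- A prime lost on the way divides the gcd and hence u.
    coprime-part : ∀ u c → c ≢ 0 → ∃[ b ] (b ≢ 0 × Coprime b u × (∀ {r} → Prime r → r ∣ c → r ∣ u ⊎ r ∣ b))
    coprime-part u = <-rec _ step
      where
      step : ∀ c → (∀ {c′} → c′ < c → c′ ≢ 0 →
        ∃[ b ] (b ≢ 0 × Coprime b u × (∀ {r} → Prime r → r ∣ c′ → r ∣ u ⊎ r ∣ b))) →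
             c ≢ 0 → ∃[ b ] (b ≢ 0 × Coprime b u × (∀ {r} → Prime r → r ∣ c → r ∣ u ⊎ r ∣ b))
      step c rec c≢0 with gcd c u ≟ 1
      ... | yes eq = c , c≢0 , Coprimality.gcd≡1⇒coprime eq , λ _ → inj₂
      ... | no neq with gcd[m,n]∣m c u
      ... | divides k c≡k*g with rec k<c k≢0
        where
        k≢0 : k ≢ 0
        k≢0 refl = c≢0 c≡k*g
        g = gcd c u
        1<g : 1 < g
        1<g = ≤∧≢⇒< (n≢0⇒n>0 (λ g≡0 → c≢0 (gcd[m,n]≡0⇒m≡0 g≡0))) (neq ∘ sym)
        k<c : k < c
        k<c = subst (k <_) (sym c≡k*g) (m<m*n k g {{≢-nonZero k≢0}} 1<g)
      ... | b , b≢0 , cop , h = b , b≢0 , cop , split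
        where
        split : ∀ {r} → Prime r → r ∣ c → r ∣ u ⊎ r ∣ b
        split pr r∣c with euclidsLemma k (gcd c u) pr (subst (_ ∣_) c≡k*g r∣c)
        ... | inj₁ r∣k = h pr r∣k
        ... | inj₂ r∣g = inj₁ (∣-trans r∣g (gcd[m,n]∣n c u))

  prime∤1 : ∀ {r} → Prime r → ¬ (r ∣ 1)
  prime∤1 {r} pr = >⇒∤ (nonTrivial⇒n>1 r {{prime⇒nonTrivial pr}})

  coprime⇒no-common-prime : ∀ {m n r} → Coprime m n → Prime r → r ∣ m → r ∣ n → ⊥
  coprime⇒no-common-prime cop pr r∣m r∣n = prime∤1 pr (∣-reflexive (cop (r∣m , r∣n)))

  -- The multiplier b is coprime to u and divisible by the primes of c that do not divide u. So a
  -- prime of c divides exactly one of u and b N, and never their sum. This takes the place of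
  -- Dirichlet's theorem on primes in progressions.
  avoid-primes : ∀ u N c .{{_ : NonZero N}} → Coprime u N → c ≢ 0 →
                 ∃[ b ] (NonZero (u + b * N) × (∀ {r} → Prime r → r ∣ u + b * N → ¬ (r ∣ c)))
  avoid-primes u N c cop c≢0 with coprime-part u c c≢0
  ... | b , b≢0 , b⊥u , split = b
    , >-nonZero (≤-trans (>-nonZero⁻¹ (b * N) {{m*n≢0 b N {{≢-nonZero b≢0}}}}) (m≤n+m _ u))
    , λ {r} pr r∣u′ r∣c → [ (λ r∣u → both pr (∣m+n∣m⇒∣n r∣u′ r∣u) r∣u)
                          , (λ r∣b → coprime⇒no-common-prime b⊥u pr r∣b
                            (∣m+n∣m⇒∣n (subst (r ∣_) (+-comm u _) r∣u′) (∣m⇒∣m*n N r∣b)))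
                          ]′ (split pr r∣c)
    where
    both : ∀ {r} → Prime r → r ∣ b * N → r ∣ u → ⊥
    both pr r∣bN r∣u with euclidsLemma b N pr r∣bN
    ... | inj₁ r∣b = coprime⇒no-common-prime b⊥u pr r∣b r∣u
    ... | inj₂ r∣N = coprime⇒no-common-prime cop pr r∣u r∣N

  prime-divisor : ∀ d .{{_ : NonZero d}} → d ≢ 1 → ∃[ r ] (Prime r × r ∣ d)
  prime-divisor d d≢1 with factorise d
  ... | record { factors = [] ; isFactorisation = eq } = contradiction eq d≢1
  ... | record { factors = r ∷ rs ; isFactorisation = eq ; factorsPrime = pr ∷ _ } =
    r , pr , subst (r ∣_) (sym eq) (m∣m*n (product rs))

  no-common-prime⇒coprime : ∀ m n .{{_ : NonZero n}} → (∀ {r} → Prime r → r ∣ m → r ∣ n → ⊥) → Coprime m n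
  no-common-prime⇒coprime m n h {d} (d∣m , d∣n) with d ≟ 1
  ... | yes d≡1 = d≡1
  ... | no d≢1 with prime-divisor d {{≢-nonZero (λ { refl → ≢-nonZero⁻¹ n (0∣⇒≡0 d∣n) })}} d≢1
  ... | r , pr , r∣d = ⊥-elim (h pr (∣-trans r∣d d∣m) (∣-trans r∣d d∣n))

  -- Bookkeeping for the points i N/p + j N/q used below; `P` and `Q` stand for N/p and N/q.
  gather-identity : ∀ i j i′ j′ P Q x n → ((i * P + j * Q) + x) + (n * x + (i′ * P + j′ * Q)) ≡ x * suc n +
    ((i + i′) * P + (j + j′) * Q)
  gather-identity = ℕ-Solver.solve-∀

  move-p : ∀ k P Q x → k * P + ((1 * P + 1 * Q) + x) ≡ (suc k * P + 1 * Q) + x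
  move-p = ℕ-Solver.solve-∀

  move-q : ∀ k P Q x → k * Q + ((1 * P + 1 * Q) + x) ≡ (1 * P + suc k * Q) + x
  move-q = ℕ-Solver.solve-∀

  %≡⇒∣∸ : ∀ m n N .{{_ : NonZero N}} → n ≤ m → m % N ≡ n % N → N ∣ m ∸ n
  %≡⇒∣∸ m n N n≤m eq = divides (m / N ∸ n / N) (begin
    m ∸ n                                                  ≡⟨ cong₂ _∸_ (m≡m%n+[m/n]*n m N) (m≡m%n+[m/n]*n n N) ⟩
    (m % N + m / N * N) ∸ (n % N + n / N * N)
      ≡⟨ cong (λ r → (m % N + m / N * N) ∸ (r + n / N * N)) (sym eq) ⟩
    (m % N + m / N * N) ∸ (m % N + n / N * N)              ≡⟨ [m+n]∸[m+o]≡n∸o (m % N) _ _ ⟩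
    m / N * N ∸ n / N * N                                  ≡⟨ *-distribʳ-∸ N (m / N) (n / N) ⟨
    (m / N ∸ n / N) * N                                    ∎)
    where open ≡-Reasoning

  -- The sum 1 + V + ... + V^(l-1). Iterating S(ζ^V) = ζ^J S(ζ) l times accumulates J times this sum
  -- in the exponent.
  geometric : ℕ → ℕ → ℕ
  geometric V zero = 0
  geometric V (suc l) = V ^ l + geometric V l

  geometric-+ : ∀ V l d → geometric V (l + d) ≡ geometric V l + V ^ l * geometric V d
  geometric-+ V l zero = trans (cong (geometric V) (+-identityʳ l))
    (sym (trans (cong (geometric V l +_) (*-zeroʳ (V ^ l))) (+-identityʳ _)))
  geometric-+ V l (suc d) = begin
    geometric V (l + suc d)                               ≡⟨ cong (geometric V) (+-suc l d) ⟩
    V ^ (l + d) + geometric V (l + d)                     ≡⟨ cong₂ _+_ (^-distribˡ-+-* V l d) (geometric-+ V l d) ⟩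
    V ^ l * V ^ d + (geometric V l + V ^ l * geometric V d)
      ≡⟨ identity (V ^ l) (V ^ d) (geometric V l) (geometric V d) ⟩
    geometric V l + V ^ l * (V ^ d + geometric V d)       ∎
    where
    open ≡-Reasoning
    identity : ∀ a b c d → a * b + (c + a * d) ≡ c + a * (b + d)
    identity = ℕ-Solver.solve-∀

  -- The a b powers form b blocks of length a, each of which is a power of V^a times the first
  -- block.
  geometric-* : ∀ V a b → geometric V (a * b) ≡ geometric V a * geometric (V ^ a) b
  geometric-* V a zero = trans (cong (geometric V) (*-zeroʳ a)) (sym (*-zeroʳ (geometric V a)))
  geometric-* V a (suc b) = begin
    geometric V (a * suc b)
      ≡⟨ cong (geometric V) (trans (*-suc a b) (+-comm a (a * b))) ⟩
    geometric V (a * b + a)                                     ≡⟨ geometric-+ V (a * b) a ⟩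
    geometric V (a * b) + V ^ (a * b) * geometric V a
      ≡⟨ cong₂ _+_ (geometric-* V a b) (cong (_* geometric V a) (sym (^-*-assoc V a b))) ⟩
    geometric V a * geometric (V ^ a) b + (V ^ a) ^ b * geometric V a
      ≡⟨ identity (geometric V a) (geometric (V ^ a) b) ((V ^ a) ^ b) ⟩
    geometric V a * ((V ^ a) ^ b + geometric (V ^ a) b)         ∎
    where
    open ≡-Reasoning
    identity : ∀ a b c → a * b + c * a ≡ a * (c + b)
    identity = ℕ-Solver.solve-∀

  ^-geometric : ∀ W l → suc W ^ l ≡ suc (W * geometric (suc W) l)
  ^-geometric W zero = cong suc (sym (*-zeroʳ W))
  ^-geometric W (suc l) = trans (cong (_+ W * suc W ^ l) (^-geometric W l))
    (cong suc (identity W (suc W ^ l) (geometric (suc W) l)))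
    where
    identity : ∀ a b c → a * c + a * b ≡ a * (b + c)
    identity = ℕ-Solver.solve-∀

  -- All powers of 1 + W are 1 modulo W, so the l summands add up to l.
  geometric≡ : ∀ W l → ∃[ t ] geometric (suc W) l ≡ l + W * t
  geometric≡ W zero = 0 , sym (*-zeroʳ W)
  geometric≡ W (suc l) with geometric≡ W l
  ... | t , eq = geometric (suc W) l + t , trans (cong₂ _+_ (^-geometric W l) eq)
    (cong suc (identity l W (geometric (suc W) l) t))
    where
    identity : ∀ l W g t → W * g + (l + W * t) ≡ l + W * (g + t)
    identity = ℕ-Solver.solve-∀

  ∤⇒coprime-^ : ∀ {p} → Prime p → ∀ m {n} .{{_ : NonZero n}} → ¬ (p ∣ n) → Coprime (p ^ m) n
  ∤⇒coprime-^ {p} pp m {n} p∤n = no-common-prime⇒coprime (p ^ m) n go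
    where
    go : ∀ {r} → Prime r → r ∣ p ^ m → r ∣ n → ⊥
    go {r} pr r∣pm r∣n = p∤n (subst (_∣ n) (prime∣^ m r∣pm) r∣n)
      where
      prime∣^ : ∀ m → r ∣ p ^ m → r ≡ p
      prime∣^ zero r∣1 = contradiction r∣1 (prime∤1 pr)
      prime∣^ (suc m) h with euclidsLemma p (p ^ m) pr h
      ... | inj₂ h′ = prime∣^ m h′
      ... | inj₁ r∣p with prime⇒irreducible pp r∣p
      ...   | inj₁ refl = contradiction ∣-refl (prime∤1 pr)
      ...   | inj₂ r≡p = r≡p

  -- Lifting the exponent, in the case V ≡ 1 mod p² where p = 2 needs no special treatment.
  geometric-∣ : ∀ {p} → Prime p → ∀ m V d → ∃[ k ] V ≡ suc (p * p * k) → p ^ m ∣ geometric V d → p ^ m ∣ d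
  geometric-∣ pp zero V d _ _ = 1∣ d
  geometric-∣ {p} pp (suc m) V d (k , refl) h with geometric≡ (p * p * k) d
  -- Modulo p the geometric sum is d itself, so p divides d, which is written as d′ p.
  ... | t , eq with ∣m+n∣m⇒∣n (subst (p ∣_) (trans eq (+-comm d _)) (∣-trans (m∣m*n (p ^ m)) h))
    (∣m⇒∣m*n t (∣m⇒∣m*n k (m∣m*n p)))
  ... | divides d′ refl = subst (_∣ d′ * p) (*-comm (p ^ m) p)
    (*-monoˡ-∣ p (geometric-∣ pp m V d′ (k , refl) (coprime-divisor cop p^m∣)))
    where
    instance _ = prime⇒nonZero pp
    g = geometric V d′
    -- All powers of V^d′ are 1 modulo p², so p of them add up to p modulo p²: passing from d′ to d′
    -- p gains exactly one factor p.
    inner : ∃[ u ] geometric (V ^ d′) p ≡ p * suc (p * u)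
    inner with geometric≡ (p * p * k * g) p
    ... | u , e = k * g * u , trans (cong (λ w → geometric w p) (^-geometric (p * p * k) d′))
      (trans e (identity p k g u))
      where
      identity : ∀ p k g u → p + p * p * k * g * u ≡ p * suc (p * (k * g * u))
      identity = ℕ-Solver.solve-∀
    u = proj₁ inner
    p^m∣ : p ^ m ∣ suc (p * u) * g
    p^m∣ = *-cancelˡ-∣ p (subst (p * p ^ m ∣_)
      (trans (geometric-* V d′ p) (trans (cong (g *_) (proj₂ inner)) (identity g p (suc (p * u))))) h)
      where
      identity : ∀ g p s → g * (p * s) ≡ p * (s * g)
      identity = ℕ-Solver.solve-∀
    cop : Coprime (p ^ m) (suc (p * u))
    cop = ∤⇒coprime-^ pp m (λ h → prime∤1 pp (∣m+n∣m⇒∣n (subst (p ∣_) (+-comm 1 (p * u)) h) (m∣m*n u)))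

  coprime-^ : ∀ {M g} → Coprime M g → ∀ a {x} → M ∣ g ^ a * x → M ∣ x
  coprime-^ cop zero {x} h = subst (_ ∣_) (*-identityˡ x) h
  coprime-^ {M} {g} cop (suc a) {x} h = coprime-^ cop a (coprime-divisor cop (subst (M ∣_) (*-assoc g (g ^ a) x) h))

  abstract
    -- Two of the powers g^0, ..., g^M agree modulo M; cancelling the smaller one leaves a positive
    -- exponent.
    power≡1 : ∀ g M .{{_ : NonZero g}} .{{_ : NonZero M}} → Coprime M g → ∃[ e ] ∃[ k ] g ^ suc e ≡ 1 + k * M
    power≡1 g M cop with pigeonhole (n<1+n M) (λ i → fromℕ< (m%n<n (g ^ toℕ i) M))
    ... | i , j , i<j , eq = toℕ j ∸ suc a , quotient M∣ , (begin
        g ^ suc (toℕ j ∸ suc a)             ≡⟨ cong (g ^_) (+-∸-assoc 1 i<j) ⟨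
        g ^ e                               ≡⟨ m+[n∸m]≡n (m^n>0 g e) ⟨
        1 + (g ^ e ∸ 1)                     ≡⟨ cong suc (_∣_.equality M∣) ⟩
        1 + quotient M∣ * M                 ∎)
      where
      open ≡-Reasoning
      a e : ℕ
      a = toℕ i
      e = toℕ j ∸ a
      %eq : g ^ toℕ j % M ≡ g ^ a % M
      %eq = trans (sym (toℕ-fromℕ< (m%n<n (g ^ toℕ j) M))) (trans (cong toℕ (sym eq)) (toℕ-fromℕ< (m%n<n (g ^ a) M)))
      split : g ^ toℕ j ≡ g ^ a * g ^ e
      split = trans (cong (g ^_) (sym (m+[n∸m]≡n (<⇒≤ i<j)))) (^-distribˡ-+-* g a e)
      M∣ : M ∣ g ^ e ∸ 1
      M∣ = coprime-^ cop a (subst (M ∣_)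
        (trans (cong₂ _∸_ split (sym (*-identityʳ (g ^ a)))) (sym (*-distribˡ-∸ (g ^ a) (g ^ e) 1)))
        (%≡⇒∣∸ (g ^ toℕ j) (g ^ a) M (^-monoʳ-≤ g (<⇒≤ i<j)) %eq))

  1+multiple-^ : ∀ M k t → ∃[ k′ ] (1 + k * M) ^ t ≡ 1 + k′ * M
  1+multiple-^ M k zero = 0 , refl
  1+multiple-^ M k (suc t) with 1+multiple-^ M k t
  ... | k′ , eq = k + k′ + k * M * k′ , trans (cong ((1 + k * M) *_) eq) (identity M k k′)
    where
    identity : ∀ M k k′ → (1 + k * M) * (1 + k′ * M) ≡ 1 + (k + k′ + k * M * k′) * M
    identity = ℕ-Solver.solve-∀

  n<b^n : ∀ b n → 1 < b → n < b ^ n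
  n<b^n b zero _ = s≤s z≤n
  n<b^n b (suc n) 1<b = ≤-trans (s≤s (n<b^n b n 1<b)) (m<m*n′ (m^n>0 b {{>-nonZero (<⇒≤ 1<b)}} n))
    where
    m<m*n′ : 0 < b ^ n → b ^ n < b * b ^ n
    m<m*n′ pos = subst (b ^ n <_) (*-comm (b ^ n) b) (m<m*n (b ^ n) b {{>-nonZero pos}} 1<b)

  abstract
    -- A positive exponent that gives 1 is multiplied by B. Large exponents are wanted twice: to
    -- make one summand of v vanish modulo a prime power of N, and to write a residue class as a
    -- high power of itself.
    large-power≡1 : ∀ g M .{{_ : NonZero M}} → 1 < g → Coprime M g → ∀ B →
      ∃[ d ] ∃[ k ] (B ≤ d × B < g ^ d × g ^ d ≡ 1 + k * M)
    large-power≡1 g M 1<g cop B with power≡1 g M {{>-nonZero (<⇒≤ 1<g)}} cop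
    ... | e , k , eq with 1+multiple-^ M k B
    ... | k′ , eq′ = suc e * B , k′ , B≤ , <-≤-trans (n<b^n g B 1<g) (^-monoʳ-≤ g {{>-nonZero (<⇒≤ 1<g)}} B≤) , trans
      (sym (^-*-assoc g (suc e) B)) (trans (cong (_^ B) eq) eq′)
      where
      B≤ : B ≤ suc e * B
      B≤ = m≤m+n B (e * B)

  coprime-∣* : ∀ {m n k} → Coprime m n → m ∣ k → n ∣ k → m * n ∣ k
  coprime-∣* {m} {n} cop (divides a refl) n∣ with coprime-divisor (Coprimality.sym cop) (subst (n ∣_) (*-comm a m) n∣)
  ... | divides b refl = divides b (trans (*-assoc b n m) (cong (b *_) (*-comm n m)))

  prime-∤-^ : ∀ {p q} → Prime p → Prime q → p ≢ q → ∀ n → ¬ (p ∣ q ^ n)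
  prime-∤-^ pp pq p≢q zero h = prime∤1 pp h
  prime-∤-^ {p} {q} pp pq p≢q (suc n) h with euclidsLemma q (q ^ n) pp h
  ... | inj₂ h′ = prime-∤-^ pp pq p≢q n h′
  ... | inj₁ p∣q with prime⇒irreducible pq p∣q
  ...   | inj₁ refl = prime∤1 pp ∣-refl
  ...   | inj₂ p≡q = p≢q p≡q

  coprime-prime-powers : ∀ {p q} → Prime p → Prime q → p ≢ q → ∀ m n → Coprime (p ^ m) (q ^ n)
  coprime-prime-powers pp pq p≢q m n = ∤⇒coprime-^ pp m {{m^n≢0 _ n {{prime⇒nonZero pq}}}} (prime-∤-^ pp pq p≢q n)

  ^-∣-^ : ∀ p {m n} → m ≤ n → p ^ m ∣ p ^ n
  ^-∣-^ p {m} {n} m≤n = divides (p ^ (n ∸ m)) (trans (cong (p ^_) (sym (m∸n+n≡m m≤n))) (^-distribˡ-+-* p (n ∸ m) m))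

  lift-residue : ∀ {a r M e l w} d → a ^ e ≡ 1 + l * r ^ M → r ^ M ∣ w → ∃[ t ] a ^ (d + e) + w ≡ a ^ d + t * r ^ M
  lift-residue {a} {r} {M} {e} {l} d eq (divides u refl) = a ^ d * l + u , trans
    (cong (_+ u * r ^ M) (trans (^-distribˡ-+-* a d e) (cong (a ^ d *_) eq))) (identity (a ^ d) l (r ^ M) u)
    where
    identity : ∀ a l R u → a * (1 + l * R) + u * R ≡ a + (a * l + u) * R
    identity = ℕ-Solver.solve-∀

  square≡1 : ∀ {v A R r k t u} → A ≡ 1 + k * (r * r) → v ≡ A + t * R → R ≡ u * (r * r) → ∃[ κ ] v * v ≡ suc (r * r * κ)
  square≡1 {v} {r = r} {k} {t} {u} refl eq refl = c + c + r * r * (c * c) , trans (cong₂ _*_ v≡ v≡) (identity r c)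
    where
    c = k + t * u
    regroup : ∀ r k t u → 1 + k * (r * r) + t * (u * (r * r)) ≡ 1 + r * r * (k + t * u)
    regroup = ℕ-Solver.solve-∀
    v≡ : v ≡ 1 + r * r * c
    v≡ = trans eq (regroup r k t u)
    identity : ∀ r c → (1 + r * r * c) * (1 + r * r * c) ≡ suc (r * r * (c + c + r * r * (c * c)))
    identity = ℕ-Solver.solve-∀

  -- The factors v² - 1 and A² - 1 differ by a multiple of R.
  square-residue : ∀ {v A t R} .{{_ : NonZero A}} → v ≡ A + t * R → ∀ y → R ∣ pred (v * v) * y → R ∣ (A * A ∸ 1) * y
  square-residue {v} {A} {t} {R} eq y h = ∣m+n∣m⇒∣n (subst (R ∣_) V′y≡ h) (∣m⇒∣m*n y (n∣m*n u))
    where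
    u = A * t + A * t + t * t * R
    identity : ∀ A t R → (A + t * R) * (A + t * R) ≡ (A * t + A * t + t * t * R) * R + A * A
    identity = ℕ-Solver.solve-∀
    V′≡ : pred (v * v) ≡ u * R + (A * A ∸ 1)
    V′≡ = trans (cong pred (trans (cong₂ _*_ eq eq) (identity A t R)))
      (+-∸-assoc (u * R) (*-mono-≤ (>-nonZero⁻¹ A) (>-nonZero⁻¹ A)))
    V′y≡ : pred (v * v) * y ≡ u * R * y + (A * A ∸ 1) * y
    V′y≡ = trans (cong (_* y) V′≡) (*-distribʳ-+ y (u * R) (A * A ∸ 1))

  power-of-one : ∀ g M e k t → g ^ suc e ≡ 1 + k * M → ∃[ l ] g ^ (suc e * t) ≡ 1 + l * M
  power-of-one g M e k t eq = proj₁ h , trans (sym (^-*-assoc g (suc e) t)) (trans (cong (_^ t) eq) (proj₂ h))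
    where h = 1+multiple-^ M k t

  -- The exponent v and the constant G

  module Twisting {p q : ℕ} (pp : Prime p) (pq : Prime q) (p≢q : p ≢ q) where

    private
      instance
        nonZero-p : NonZero p
        nonZero-p = prime⇒nonZero pp
        nonZero-q : NonZero q
        nonZero-q = prime⇒nonZero pq

      1<p : 1 < p
      1<p = nonTrivial⇒n>1 p {{prime⇒nonTrivial pp}}
      1<q : 1 < q
      1<q = nonTrivial⇒n>1 q {{prime⇒nonTrivial pq}}

      p²⊥q : Coprime (p ^ 2) q
      p²⊥q = subst (Coprime (p ^ 2)) (^-identityʳ q) (coprime-prime-powers pp pq p≢q 2 1)
      q²⊥p : Coprime (q ^ 2) p
      q²⊥p = subst (Coprime (q ^ 2)) (^-identityʳ p) (coprime-prime-powers pq pp (p≢q ∘ sym) 2 1)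

      instance
        nonZero-p² : NonZero (p ^ 2)
        nonZero-p² = m^n≢0 p 2
        nonZero-q² : NonZero (q ^ 2)
        nonZero-q² = m^n≢0 q 2

      o₁ : ∃[ e ] ∃[ k ] q ^ suc e ≡ 1 + k * p ^ 2
      o₁ = power≡1 q (p ^ 2) p²⊥q
      o₂ : ∃[ e ] ∃[ k ] p ^ suc e ≡ 1 + k * q ^ 2
      o₂ = power≡1 p (q ^ 2) q²⊥p

    -- A common exponent for q modulo p² and for p modulo q², fixed before the exponents of N are
    -- known. Squares of the primes are used so that the lifting of exponents covers p = 2 as well.
    d₀ : ℕ
    d₀ = suc (proj₁ o₁) * suc (proj₁ o₂)

    q^d₀≡1 : ∃[ k ] q ^ d₀ ≡ 1 + k * p ^ 2
    q^d₀≡1 = power-of-one q (p ^ 2) (proj₁ o₁) (proj₁ (proj₂ o₁)) (suc (proj₁ o₂)) (proj₂ (proj₂ o₁))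

    p^d₀≡1 : ∃[ k ] p ^ d₀ ≡ 1 + k * q ^ 2
    p^d₀≡1 = subst (λ d → ∃[ k ] p ^ d ≡ 1 + k * q ^ 2) (*-comm (suc (proj₁ o₂)) (suc (proj₁ o₁)))
      (power-of-one p (q ^ 2) (proj₁ o₂) (proj₁ (proj₂ o₂)) (suc (proj₁ o₁)) (proj₂ (proj₂ o₂)))

    -- For the v below, v² - 1 agrees with `Cq` modulo the p-part of N and with `Cp` modulo the
    -- q-part; the product serves both parts and is the same for all N.
    Cq Cp bound : ℕ
    Cq = q ^ d₀ * q ^ d₀ ∸ 1
    Cp = p ^ d₀ * p ^ d₀ ∸ 1
    bound = Cq * Cp

    -- `v≡₁` and `v≡₂` make ζ ↦ ζ^v a power of Frobenius modulo the primes above q and above p.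
    -- `V≡₁` and `V≡₂` feed the lifting of exponents for V = v². `fixed` limits how many exponents x
    -- can satisfy (V - 1) x ≡ J.
    record Twist (m n : ℕ) : Set where
      field
        v d₁ k₁ d₂ k₂ V′ κ₁ κ₂ : ℕ
        v≡₁ : v ≡ q ^ d₁ + k₁ * p ^ suc m
        v≡₂ : v ≡ p ^ d₂ + k₂ * q ^ suc n
        p∤v : ¬ (p ∣ v)
        q∤v : ¬ (q ∣ v)
        v²≡ : v * v ≡ suc V′
        V≡₁ : suc V′ ≡ suc (p * p * κ₁)
        V≡₂ : suc V′ ≡ suc (q * q * κ₂)
        fixed : ∀ y → p ^ suc m * q ^ suc n ∣ V′ * y → p ^ suc m * q ^ suc n ∣ bound * y

    twist : ∀ m n → Twist m n
    twist m n = record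
      { v = v ; d₁ = d₀ + e₁ ; k₁ = quotient pm∣ ; d₂ = d₀ + e₂ ; k₂ = quotient qn∣ ; V′ = V′ ; κ₁ = proj₁ κ-p ; κ₂ =
        proj₁ κ-q
      ; v≡₁ = cong (q ^ (d₀ + e₁) +_) (_∣_.equality pm∣)
      ; v≡₂ = trans (+-comm (q ^ (d₀ + e₁)) _) (cong (p ^ (d₀ + e₂) +_) (_∣_.equality qn∣))
      ; p∤v = λ h → prime-∤-^ pp pq p≢q (d₀ + e₁) (∣m+n∣m⇒∣n (subst (p ∣_) (+-comm _ (p ^ (d₀ + e₂))) h) p∣pow)
      ; q∤v = λ h → prime-∤-^ pq pp (p≢q ∘ sym) (d₀ + e₂) (∣m+n∣m⇒∣n h q∣pow)
      ; v²≡ = sym (suc-pred (v * v) {{m*n≢0 v v {{v≢0}} {{v≢0}}}})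
      ; V≡₁ = trans (suc-pred (v * v) {{m*n≢0 v v {{v≢0}} {{v≢0}}}}) (proj₂ κ-p)
      ; V≡₂ = trans (suc-pred (v * v) {{m*n≢0 v v {{v≢0}} {{v≢0}}}}) (proj₂ κ-q)
      ; fixed = fixed
      }
      where
      -- One factor more than the p-part p^(m+1) of N, so that p² divides the modulus even for m = 0
      -- and v² ≡ 1 modulo p² can be read off.
      Mp = 2 + m
      Mq = 2 + n
      B = Mp + Mq
      big₁ = large-power≡1 q (p ^ Mp) {{m^n≢0 p Mp}} 1<q
        (subst (Coprime (p ^ Mp)) (^-identityʳ q) (coprime-prime-powers pp pq p≢q Mp 1)) B
      big₂ = large-power≡1 p (q ^ Mq) {{m^n≢0 q Mq}} 1<p
        (subst (Coprime (q ^ Mq)) (^-identityʳ p) (coprime-prime-powers pq pp (p≢q ∘ sym) Mq 1)) B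
      e₁ = proj₁ big₁
      e₂ = proj₁ big₂
      l₁ = proj₁ (proj₂ big₁)
      l₂ = proj₁ (proj₂ big₂)
      q^e₁ : q ^ e₁ ≡ 1 + l₁ * p ^ Mp
      q^e₁ = proj₂ (proj₂ (proj₂ (proj₂ big₁)))
      p^e₂ : p ^ e₂ ≡ 1 + l₂ * q ^ Mq
      p^e₂ = proj₂ (proj₂ (proj₂ (proj₂ big₂)))
      Mp≤ : Mp ≤ d₀ + e₂
      Mp≤ = ≤-trans (m≤m+n Mp Mq) (≤-trans (proj₁ (proj₂ (proj₂ big₂))) (m≤n+m e₂ d₀))
      Mq≤ : Mq ≤ d₀ + e₁
      Mq≤ = ≤-trans (m≤n+m Mq Mp) (≤-trans (proj₁ (proj₂ (proj₂ big₁))) (m≤n+m e₁ d₀))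
      -- Modulo p^Mp the second summand vanishes, since e₂ is at least Mp, and the first is q^d₀,
      -- since q^e₁ is 1. Modulo q^Mq the summands change roles.
      v = q ^ (d₀ + e₁) + p ^ (d₀ + e₂)
      V′ = pred (v * v)
      v≢0 : NonZero v
      v≢0 = >-nonZero (≤-trans (m^n>0 q (d₀ + e₁)) (m≤m+n _ _))
      pm∣ : p ^ suc m ∣ p ^ (d₀ + e₂)
      pm∣ = ^-∣-^ p (≤-trans (n≤1+n (suc m)) Mp≤)
      qn∣ : q ^ suc n ∣ q ^ (d₀ + e₁)
      qn∣ = ^-∣-^ q (≤-trans (n≤1+n (suc n)) Mq≤)
      p∣pow : p ∣ p ^ (d₀ + e₂)
      p∣pow = subst (_∣ p ^ (d₀ + e₂)) (^-identityʳ p) (^-∣-^ p (≤-trans (s≤s z≤n) Mp≤))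
      q∣pow : q ∣ q ^ (d₀ + e₁)
      q∣pow = subst (_∣ q ^ (d₀ + e₁)) (^-identityʳ q) (^-∣-^ q (≤-trans (s≤s z≤n) Mq≤))

      res-p : ∃[ t ] v ≡ q ^ d₀ + t * p ^ Mp
      res-p = lift-residue {q} {p} {Mp} {e₁} {l₁} d₀ q^e₁ (^-∣-^ p Mp≤)
      res-q : ∃[ t ] v ≡ p ^ d₀ + t * q ^ Mq
      res-q = proj₁ res , trans (+-comm (q ^ (d₀ + e₁)) (p ^ (d₀ + e₂))) (proj₂ res)
        where res = lift-residue {p} {q} {Mq} {e₂} {l₂} d₀ p^e₂ (^-∣-^ q Mq≤)

      square : ∀ r {a} k → a ≡ 1 + k * r ^ 2 → a ≡ 1 + k * (r * r)
      square r k eq = trans eq (cong (λ s → 1 + k * (r * s)) (*-identityʳ r))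

      two : ∀ r M → r ^ (2 + M) ≡ r ^ M * (r * r)
      two r M = trans (sym (*-assoc r r (r ^ M))) (*-comm (r * r) (r ^ M))

      κ-p : ∃[ κ ] v * v ≡ suc (p * p * κ)
      κ-p = square≡1 {v} {q ^ d₀} {p ^ Mp} {p} {proj₁ q^d₀≡1} {proj₁ res-p} {p ^ m}
        (square p (proj₁ q^d₀≡1) (proj₂ q^d₀≡1)) (proj₂ res-p) (two p m)
      κ-q : ∃[ κ ] v * v ≡ suc (q * q * κ)
      κ-q = square≡1 {v} {p ^ d₀} {q ^ Mq} {q} {proj₁ p^d₀≡1} {proj₁ res-q} {q ^ n}
        (square q (proj₁ p^d₀≡1) (proj₂ p^d₀≡1)) (proj₂ res-q) (two q n)

      fixed-p : ∀ y → p ^ suc m ∣ V′ * y → p ^ suc m ∣ Cq * y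
      fixed-p = square-residue {v} {q ^ d₀} {proj₁ res-p * p} {p ^ suc m} {{m^n≢0 q d₀}}
        (trans (proj₂ res-p) (cong (q ^ d₀ +_) (sym (*-assoc (proj₁ res-p) p (p ^ suc m)))))

      fixed-q : ∀ y → q ^ suc n ∣ V′ * y → q ^ suc n ∣ Cp * y
      fixed-q = square-residue {v} {p ^ d₀} {proj₁ res-q * q} {q ^ suc n} {{m^n≢0 p d₀}}
        (trans (proj₂ res-q) (cong (p ^ d₀ +_) (sym (*-assoc (proj₁ res-q) q (q ^ suc n)))))

      fixed : ∀ y → p ^ suc m * q ^ suc n ∣ V′ * y → p ^ suc m * q ^ suc n ∣ bound * y
      fixed y h = coprime-∣* (coprime-prime-powers pp pq p≢q (suc m) (suc n))
        (subst (p ^ suc m ∣_) (swap Cp Cq y) (∣n⇒∣m*n Cp (fixed-p y (∣-trans (m∣m*n (q ^ suc n)) h))))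
        (subst (q ^ suc n ∣_) (sym (*-assoc Cq Cp y)) (∣n⇒∣m*n Cq (fixed-q y (∣-trans (n∣m*n (p ^ suc m)) h))))
        where
        swap : ∀ a b c → a * (b * c) ≡ b * a * c
        swap = ℕ-Solver.solve-∀

  regroup : ∀ p q a b → p * a * (q * b) ≡ a * b * (p * q)
  regroup = ℕ-Solver.solve-∀

  exponent-identity : ∀ x W c n J → x * suc (W * c) + n * (J * c) ≡ x + (W * x + n * J) * c
  exponent-identity = ℕ-Solver.solve-∀

  D-identity : ∀ W l d j → W * (l + d) + j ≡ (W * l + j) + W * d
  D-identity = ℕ-Solver.solve-∀

  smooth : ∀ {p q} → Prime p → Prime q → ∀ N → N ≢ 0 → (∀ {r} → Prime r → r ∣ N → r ≡ p ⊎ r ≡ q) →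
    ∃[ a ] ∃[ b ] N ≡ p ^ a * q ^ b
  smooth {p} {q} pp pq = <-rec _ step
    where
    Smooth : ℕ → Set
    Smooth N = N ≢ 0 → (∀ {r} → Prime r → r ∣ N → r ≡ p ⊎ r ≡ q) → ∃[ a ] ∃[ b ] N ≡ p ^ a * q ^ b
    step : ∀ N → (∀ {k} → k < N → Smooth k) → Smooth N
    step N rec N≢0 primes with N ≟ 1
    ... | yes refl = 0 , 0 , refl
    ... | no N≢1 with prime-divisor N {{≢-nonZero N≢0}} N≢1
    ... | r , pr , divides k refl = extend (rec k<N k≢0 (λ pr′ r′∣k → primes pr′ (∣m⇒∣m*n r r′∣k)))
      (primes pr (n∣m*n k))
      where
      k≢0 : k ≢ 0
      k≢0 refl = N≢0 refl
      k<N : k < k * r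
      k<N = m<m*n k r {{≢-nonZero k≢0}} (nonTrivial⇒n>1 r {{prime⇒nonTrivial pr}})
      extend : ∃[ a ] ∃[ b ] k ≡ p ^ a * q ^ b → r ≡ p ⊎ r ≡ q → ∃[ a ] ∃[ b ] k * r ≡ p ^ a * q ^ b
      extend (a , b , eq) (inj₁ refl) = suc a , b , trans (cong (_* p) eq)
        (trans (*-comm _ p) (sym (*-assoc p (p ^ a) (q ^ b))))
      extend (a , b , eq) (inj₂ refl) = a , suc b , trans (cong (_* q) eq)
        (trans (*-assoc (p ^ a) (q ^ b) q) (cong (p ^ a *_) (*-comm (q ^ b) q)))

  double : ∀ a → a * (a + a) ≡ a * a * 2
  double = ℕ-Solver.solve-∀

  square-product : ∀ s t → t * s * (s * t) ≡ s * s * (t * t)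
  square-product = ℕ-Solver.solve-∀

-- Integers and finite sums in a commutative ring

module RingSums (R : CommutativeRing 0ℓ 0ℓ) where

  open import Data.Integer.Base using (+_; -[1+_]; -1ℤ; _⊖_)
  open import Data.Vec.Base as Vec using (Vec; []; _∷_)
  open import Data.List.Base using (List; []; _∷_)
  open import Data.List.Properties using (≡-dec)
  open import Data.List.Relation.Unary.All using (All; []; _∷_)
  open import Data.List.Relation.Unary.AllPairs using ([]; _∷_)
  open import Data.List.Relation.Unary.Unique.Propositional using (Unique)
  open import Data.Bool.Base using (true; false)
  open import Data.Fin.Base using (toℕ)
  open RingExpressions public
  open IntegerPolynomials using (χℤ; sumℤ)
  open import Data.Vec.N-ary using (N-ary; Eq; curryⁿ; _$ⁿ_; curryⁿ-cong)
  open import Data.Product.Base using () renaming (_×_ to _∧_)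
  import Algebra.Properties.Ring

  open CommutativeRing R
  open Algebra.Properties.Ring ring using (-‿involutive; -0#≈0#; -‿+-comm; -‿distribˡ-*; -‿distribʳ-*)
  open import Algebra.Properties.Semiring.Exp semiring using (_^_)
  open import Algebra.Properties.Semiring.Mult semiring using (_×_; ×-homo-+; ×1-homo-*)
  open import Relation.Binary.Reasoning.Setoid setoid

  ι : ℤ → Carrier
  ι (+ n)    = n × 1#
  ι -[1+ n ] = - (suc n × 1#)

  ι-⊖ : ∀ m n → ι (m ⊖ n) ≈ m × 1# - n × 1#
  ι-⊖ m zero = sym (trans (+-congˡ -0#≈0#) (+-identityʳ _))
  ι-⊖ zero (suc n) = sym (+-identityˡ _)
  ι-⊖ (suc m) (suc n) = begin
    ι (suc m ⊖ suc n)                         ≡⟨ ≡.cong ι (ℤ.[1+m]⊖[1+n]≡m⊖n m n) ⟩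
    ι (m ⊖ n)                                 ≈⟨ ι-⊖ m n ⟩
    m × 1# - n × 1#                           ≈⟨ +-congʳ (+-identityʳ _) ⟨
    (m × 1# + 0#) - n × 1#                    ≈⟨ +-congʳ (+-congˡ (-‿inverseʳ 1#)) ⟨
    (m × 1# + (1# - 1#)) - n × 1#             ≈⟨ +-congʳ (+-assoc _ _ _) ⟨
    ((m × 1# + 1#) - 1#) - n × 1#             ≈⟨ +-assoc _ _ _ ⟩
    (m × 1# + 1#) + (- 1# - n × 1#)           ≈⟨ +-cong (+-comm _ _) (-‿+-comm _ _) ⟩
    (1# + m × 1#) - (1# + n × 1#)             ∎

  ι-neg : ∀ i → ι (ℤ.- i) ≈ - ι i
  ι-neg (+ zero)  = sym -0#≈0#
  ι-neg (+ suc n) = refl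
  ι-neg -[1+ n ]  = sym (-‿involutive _)

  ι-+ : ∀ i j → ι (i ℤ.+ j) ≈ ι i + ι j
  ι-+ (+ m)    (+ n)    = ×-homo-+ 1# m n
  ι-+ (+ m)    -[1+ n ] = ι-⊖ m (suc n)
  ι-+ -[1+ m ] (+ n)    = trans (ι-⊖ n (suc m)) (+-comm _ _)
  ι-+ -[1+ m ] -[1+ n ] = begin
    - (suc (suc (m ℕ.+ n)) × 1#)       ≡⟨ ≡.cong (λ k → - (suc k × 1#)) (≡.sym (ℕ.+-suc m n)) ⟩
    - ((suc m ℕ.+ suc n) × 1#)         ≈⟨ -‿cong (×-homo-+ 1# (suc m) (suc n)) ⟩
    - (suc m × 1# + suc n × 1#)        ≈⟨ -‿+-comm _ _ ⟨
    - (suc m × 1#) - (suc n × 1#)      ∎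

  ι-*-nat : ∀ m j → ι (+ m ℤ.* j) ≈ m × 1# * ι j
  ι-*-nat m (+ n) = trans (reflexive (≡.cong ι (≡.sym (ℤ.pos-* m n)))) (×1-homo-* m n)
  ι-*-nat m -[1+ n ] = begin
    ι (+ m ℤ.* -[1+ n ])              ≡⟨ ≡.cong ι (ℤ.neg-distribʳ-* (+ m) (+ suc n)) ⟨
    ι (ℤ.- (+ m ℤ.* + suc n))          ≈⟨ ι-neg (+ m ℤ.* + suc n) ⟩
    - ι (+ m ℤ.* + suc n)              ≈⟨ -‿cong (ι-*-nat m (+ suc n)) ⟩
    - (m × 1# * ι (+ suc n))           ≈⟨ -‿distribʳ-* _ _ ⟩
    m × 1# * ι -[1+ n ]                ∎

  ι-* : ∀ i j → ι (i ℤ.* j) ≈ ι i * ι j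
  ι-* (+ m) j = ι-*-nat m j
  ι-* -[1+ m ] j = begin
    ι (-[1+ m ] ℤ.* j)                ≡⟨ ≡.cong ι (ℤ.neg-distribˡ-* (+ suc m) j) ⟨
    ι (ℤ.- (+ suc m ℤ.* j))            ≈⟨ ι-neg (+ suc m ℤ.* j) ⟩
    - ι (+ suc m ℤ.* j)                ≈⟨ -‿cong (ι-*-nat (suc m) j) ⟩
    - (suc m × 1# * ι j)               ≈⟨ -‿distribˡ-* _ _ ⟩
    ι -[1+ m ] * ι j                   ∎

  ι-1 : ι 1ℤ ≈ 1#
  ι-1 = +-identityʳ 1#

  private
    lookupOr0 : ∀ {n} → Vec Carrier n → ℕ → Carrier
    lookupOr0 [] _ = 0#
    lookupOr0 (x ∷ ρ) zero = x
    lookupOr0 (x ∷ ρ) (suc i) = lookupOr0 ρ i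

  ⟦_⟧ : ∀ {n} → RingExpr → Vec Carrier n → Carrier
  ⟦ var i ⟧ ρ = lookupOr0 ρ i
  ⟦ con c ⟧ ρ = ι c
  ⟦ a :+ b ⟧ ρ = ⟦ a ⟧ ρ + ⟦ b ⟧ ρ
  ⟦ a :* b ⟧ ρ = ⟦ a ⟧ ρ * ⟦ b ⟧ ρ
  ⟦ :- a ⟧ ρ = - ⟦ a ⟧ ρ

  private
    module _ {n} (ρ : Vec Carrier n) where
      monomial : Monomial → Carrier
      monomial [] = 1#
      monomial (i ∷ m) = lookupOr0 ρ i * monomial m

      value : NormalForm → Carrier
      value [] = 0#
      value ((c , m) ∷ p) = ι c * monomial m + value p

      x[yz]≈y[xz] : ∀ x y z → x * (y * z) ≈ y * (x * z)
      x[yz]≈y[xz] x y z = trans (sym (*-assoc x y z)) (trans (*-congʳ (*-comm x y)) (*-assoc y x z))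

      x+[y+z]≈y+[x+z] : ∀ x y z → x + (y + z) ≈ y + (x + z)
      x+[y+z]≈y+[x+z] x y z = trans (sym (+-assoc x y z)) (trans (+-congʳ (+-comm x y)) (+-assoc y x z))

      insertVar-correct : ∀ i m → monomial (insertVar i m) ≈ lookupOr0 ρ i * monomial m
      insertVar-correct i [] = refl
      insertVar-correct i (j ∷ m) with i ℕ.≤ᵇ j
      ... | true = refl
      ... | false = trans (*-congˡ (insertVar-correct i m)) (x[yz]≈y[xz] _ _ _)

      mulMonomial-correct : ∀ l m → monomial (mulMonomial l m) ≈ monomial l * monomial m
      mulMonomial-correct [] m = sym (*-identityˡ _)
      mulMonomial-correct (i ∷ l) m = trans (insertVar-correct i (mulMonomial l m))
        (trans (*-congˡ (mulMonomial-correct l m)) (sym (*-assoc _ _ _)))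

      consTerm-correct : ∀ c m p → value (consTerm c m p) ≈ ι c * monomial m + value p
      consTerm-correct c m p with c ℤ.≟ 0ℤ
      ... | yes ≡.refl = sym (trans (+-congʳ (zeroˡ _)) (+-identityˡ _))
      ... | no _ = refl

      addTerm-correct : ∀ c m p → value (addTerm c m p) ≈ ι c * monomial m + value p
      addTerm-correct c m [] = consTerm-correct c m []
      addTerm-correct c m ((d , l) ∷ p) with ≡-dec ℕ._≟_ m l
      ... | yes ≡.refl = trans (consTerm-correct (c ℤ.+ d) l p)
          (trans (+-congʳ (trans (*-congʳ (ι-+ c d)) (distribʳ _ _ _))) (+-assoc _ _ _))
      ... | no _ with precedes m l
      ...   | true = consTerm-correct c m ((d , l) ∷ p)
      ...   | false = trans (+-congˡ (addTerm-correct c m p)) (x+[y+z]≈y+[x+z] _ _ _)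

      addNF-correct : ∀ p q → value (addNF p q) ≈ value p + value q
      addNF-correct [] q = sym (+-identityˡ _)
      addNF-correct ((c , m) ∷ p) q = trans (addTerm-correct c m (addNF p q))
        (trans (+-congˡ (addNF-correct p q)) (sym (+-assoc _ _ _)))

      mulTerm-correct : ∀ c m p → value (mulTerm c m p) ≈ (ι c * monomial m) * value p
      mulTerm-correct c m [] = sym (zeroʳ _)
      mulTerm-correct c m ((d , l) ∷ p) = begin
        value (addTerm (c ℤ.* d) (mulMonomial m l) (mulTerm c m p))
          ≈⟨ addTerm-correct (c ℤ.* d) (mulMonomial m l) (mulTerm c m p) ⟩
        ι (c ℤ.* d) * monomial (mulMonomial m l) + value (mulTerm c m p)
          ≈⟨ +-cong (*-cong (ι-* c d) (mulMonomial-correct m l)) (mulTerm-correct c m p) ⟩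
        (ι c * ι d) * (monomial m * monomial l) + (ι c * monomial m) * value p
          ≈⟨ +-congʳ (trans (*-assoc _ _ _) (trans (*-congˡ (x[yz]≈y[xz] _ _ _)) (sym (*-assoc _ _ _)))) ⟩
        (ι c * monomial m) * (ι d * monomial l) + (ι c * monomial m) * value p ≈⟨ distribˡ _ _ _ ⟨
        (ι c * monomial m) * (ι d * monomial l + value p)                     ∎

      mulNF-correct : ∀ p q → value (mulNF p q) ≈ value p * value q
      mulNF-correct [] q = sym (zeroˡ _)
      mulNF-correct ((c , m) ∷ p) q = trans (addNF-correct (mulTerm c m q) (mulNF p q))
        (trans (+-cong (mulTerm-correct c m q) (mulNF-correct p q)) (sym (distribʳ _ _ _)))

      normalise-correct : ∀ e → value (normalise e) ≈ ⟦ e ⟧ ρ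
      normalise-correct (var i) = trans (+-identityʳ _) (trans (*-cong ι-1 (*-identityʳ _)) (*-identityˡ _))
      normalise-correct (con c) = trans (consTerm-correct c [] []) (trans (+-identityʳ _) (*-identityʳ _))
      normalise-correct (a :+ b) = trans (addNF-correct (normalise a) (normalise b))
        (+-cong (normalise-correct a) (normalise-correct b))
      normalise-correct (a :* b) = trans (mulNF-correct (normalise a) (normalise b))
        (*-cong (normalise-correct a) (normalise-correct b))
      normalise-correct (:- a) = trans (mulTerm-correct -1ℤ [] (normalise a))
        (trans (*-congʳ (trans (*-identityʳ _) (-‿cong (+-identityʳ _))))
          (trans (sym (-‿distribˡ-* _ _)) (-‿cong (trans (*-identityˡ _) (normalise-correct a)))))

  -- The library's ring solver compares evaluated normal forms, which is slow in an abstract ring;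
  -- here the normal forms are closed terms that do not mention the ring.
  solve : ∀ n (f : N-ary n RingExpr (RingExpr ∧ RingExpr)) → let e = f $ⁿ Vec.tabulate (λ i → var (toℕ i)) in
          normalise (proj₁ e) ≡ normalise (proj₂ e) → Eq n _≈_ (curryⁿ ⟦ proj₁ e ⟧) (curryⁿ ⟦ proj₂ e ⟧)
  solve n f eq = curryⁿ-cong _≈_ {n = n} ⟦ proj₁ e ⟧ ⟦ proj₂ e ⟧
      (λ ρ → trans (sym (normalise-correct ρ (proj₁ e)))
        (trans (reflexive (≡.cong (value ρ) eq)) (normalise-correct ρ (proj₂ e))))
    where e = f $ⁿ Vec.tabulate (λ i → var (toℕ i))

  ∑ : ℕ → (ℕ → Carrier) → Carrier
  ∑ zero f = 0#
  ∑ (suc n) f = ∑ n f + f n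

  ∑-cong : ∀ n {f g : ℕ → Carrier} → (∀ i → i ℕ.< n → f i ≈ g i) → ∑ n f ≈ ∑ n g
  ∑-cong zero h = refl
  ∑-cong (suc n) h = +-cong (∑-cong n (λ i i<n → h i (ℕ.m<n⇒m<1+n i<n))) (h n (ℕ.n<1+n n))

  ∑-zero : ∀ n {f : ℕ → Carrier} → (∀ i → i ℕ.< n → f i ≈ 0#) → ∑ n f ≈ 0#
  ∑-zero zero h = refl
  ∑-zero (suc n) h = trans (+-cong (∑-zero n (λ i i<n → h i (ℕ.m<n⇒m<1+n i<n))) (h n (ℕ.n<1+n n))) (+-identityʳ _)

  ∑-+ : ∀ n (f g : ℕ → Carrier) → ∑ n (λ i → f i + g i) ≈ ∑ n f + ∑ n g
  ∑-+ zero f g = sym (+-identityʳ _)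
  ∑-+ (suc n) f g = trans (+-congʳ (∑-+ n f g))
    (solve 4 (λ a b c d → (a :+ b) :+ (c :+ d) := (a :+ c) :+ (b :+ d)) ≡.refl (∑ n f) (∑ n g) (f n) (g n))

  ∑-*ˡ : ∀ n c (f : ℕ → Carrier) → c * ∑ n f ≈ ∑ n (λ i → c * f i)
  ∑-*ˡ zero c f = zeroʳ c
  ∑-*ˡ (suc n) c f = trans (distribˡ c _ _) (+-congʳ (∑-*ˡ n c f))

  ∑-*ʳ : ∀ n c (f : ℕ → Carrier) → ∑ n f * c ≈ ∑ n (λ i → f i * c)
  ∑-*ʳ n c f = trans (*-comm _ _) (trans (∑-*ˡ n c f) (∑-cong n (λ i _ → *-comm c (f i))))

  ∑-swap : ∀ m n (f : ℕ → ℕ → Carrier) → ∑ m (λ i → ∑ n (f i)) ≈ ∑ n (λ j → ∑ m (λ i → f i j))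
  ∑-swap zero n f = sym (∑-zero n (λ _ _ → refl))
  ∑-swap (suc m) n f = trans (+-congʳ (∑-swap m n f)) (sym (∑-+ n _ _))

  ∑-*-∑ : ∀ m n (f g : ℕ → Carrier) → ∑ m f * ∑ n g ≈ ∑ m (λ i → ∑ n (λ j → f i * g j))
  ∑-*-∑ m n f g = trans (∑-*ʳ m _ f) (∑-cong m (λ i _ → ∑-*ˡ n (f i) g))

  ∑-const : ∀ n c → ∑ n (λ _ → c) ≈ ι (+ n) * c
  ∑-const zero c = sym (zeroˡ c)
  ∑-const (suc n) c = trans (+-congʳ (∑-const n c))
    (solve 2 (λ a c → a :* c :+ c := (con 1ℤ :+ a) :* c) ≡.refl (ι (+ n)) c
     ⟨≈⟩ *-congʳ (+-congʳ ι-1))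
    where _⟨≈⟩_ = trans

  ∑-head : ∀ n (f : ℕ → Carrier) → ∑ (suc n) f ≈ f 0 + ∑ n (f ∘ suc)
  ∑-head zero f = trans (+-identityˡ _) (sym (+-identityʳ _))
  ∑-head (suc n) f = trans (+-congʳ (∑-head n f)) (+-assoc _ _ _)

  ∑-rot : ∀ n (f : ℕ → Carrier) → f n ≈ f 0 → ∑ n (f ∘ suc) ≈ ∑ n f
  ∑-rot n f h = begin
    ∑ n (f ∘ suc)                    ≈⟨ solve 2 (λ a b → b := (a :+ b) :- a) ≡.refl (f 0) _ ⟩
    (f 0 + ∑ n (f ∘ suc)) - f 0      ≈⟨ +-congʳ (∑-head n f) ⟨
    (∑ n f + f n) - f 0              ≈⟨ +-congʳ (+-congˡ h) ⟩
    (∑ n f + f 0) - f 0              ≈⟨ solve 2 (λ a b → (b :+ a) :- a := b) ≡.refl (f 0) _ ⟩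
    ∑ n f                            ∎

  ∑-shift : ∀ n (f : ℕ → Carrier) → (∀ i → f (n ℕ.+ i) ≈ f i) → ∀ a → ∑ n (λ i → f (a ℕ.+ i)) ≈ ∑ n f
  ∑-shift n f h zero = refl
  ∑-shift n f h (suc a) = trans (∑-shift n (f ∘ suc)
    (λ i → trans (reflexive (≡.cong f (≡.sym (ℕ.+-suc n i)))) (h (suc i))) a)
                                (∑-rot n f (trans (reflexive (≡.cong f (≡.sym (ℕ.+-identityʳ n)))) (h 0)))

  χ : ∀ {p} {P : Set p} → Dec P → Carrier
  χ (yes _) = 1#
  χ (no _) = 0#

  χ-yes : ∀ {p} {P : Set p} (d : Dec P) → P → χ d ≈ 1#
  χ-yes (yes _) _ = refl
  χ-yes (no ¬p) p = contradiction p ¬p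

  χ-no : ∀ {p} {P : Set p} (d : Dec P) → ¬ P → χ d ≈ 0#
  χ-no (yes p) ¬p = contradiction p ¬p
  χ-no (no _) _ = refl

  ∑-single : ∀ n k (f : ℕ → Carrier) → k ℕ.< n → (∀ i → i ℕ.< n → i ≢ k → f i ≈ 0#) → ∑ n f ≈ f k
  ∑-single (suc n) k f k<n h with k ℕ.≟ n
  ... | yes ≡.refl = trans (+-congʳ (∑-zero n (λ i i<n → h i (ℕ.m<n⇒m<1+n i<n) (ℕ.<⇒≢ i<n)))) (+-identityˡ _)
  ... | no k≢n = trans (+-cong (∑-single n k f (ℕ.≤∧≢⇒< (ℕ.≤-pred k<n) k≢n) (λ i i<n → h i (ℕ.m<n⇒m<1+n i<n)))
                               (h n (ℕ.n<1+n n) (k≢n ∘ ≡.sym)))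
                       (+-identityʳ _)

  ≈⇒-≈0 : ∀ {x y} → x ≈ y → x - y ≈ 0#
  ≈⇒-≈0 {x} {y} h = trans (+-congʳ h) (-‿inverseʳ y)

  -≈0⇒≈ : ∀ {x y} → x - y ≈ 0# → x ≈ y
  -≈0⇒≈ {x} {y} h = trans (solve 2 (λ x y → x := (x :- y) :+ y) ≡.refl x y) (trans (+-congʳ h) (+-identityˡ y))

  ×≈ι* : ∀ n x → n × x ≈ ι (+ n) * x
  ×≈ι* zero x = sym (zeroˡ x)
  ×≈ι* (suc n) x = begin
    x + n × x              ≈⟨ +-cong (sym (*-identityˡ x)) (×≈ι* n x) ⟩
    1# * x + ι (+ n) * x   ≈⟨ distribʳ x 1# (ι (+ n)) ⟨
    (1# + ι (+ n)) * x     ∎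

  ι-∑ : ∀ n f → ι (sumℤ n f) ≈ ∑ n (λ i → ι (f i))
  ι-∑ zero f = refl
  ι-∑ (suc n) f = trans (ι-+ (sumℤ n f) (f n)) (+-congʳ (ι-∑ n f))

  1^ : ∀ n → 1# ^ n ≈ 1#
  1^ zero = refl
  1^ (suc n) = trans (*-identityˡ _) (1^ n)

  0^suc : ∀ n → 0# ^ suc n ≈ 0#
  0^suc n = zeroˡ _

  *-^ : ∀ x y n → (x * y) ^ n ≈ x ^ n * y ^ n
  *-^ x y zero = sym (*-identityˡ 1#)
  *-^ x y (suc n) = trans (*-congˡ (*-^ x y n))
    (solve 4 (λ x y a b → (x :* y) :* (a :* b) := (x :* a) :* (y :* b)) ≡.refl x y (x ^ n) (y ^ n))

  ι-χℤ : ∀ {p} {P : Set p} (d : Dec P) → ι (χℤ d) ≈ χ d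
  ι-χℤ (yes _) = ι-1
  ι-χℤ (no _) = refl

  ∑-χ : ∀ n k (f : ℕ → Carrier) → k ℕ.< n → ∑ n (λ i → χ (i ℕ.≟ k) * f i) ≈ f k
  ∑-χ n k f k<n = trans
    (∑-single n k _ k<n (λ i _ i≢k → trans (*-congʳ (χ-no (i ℕ.≟ k) i≢k)) (zeroˡ _)))
    (trans (*-congʳ (χ-yes (k ℕ.≟ k) ≡.refl)) (*-identityˡ _))

  drop : ℕ → (ℕ → Carrier) → ℕ → Carrier
  drop k f i with i ℕ.≟ k
  ... | yes _ = 0#
  ... | no _ = f i

  drop-≡ : ∀ k f → drop k f k ≈ 0#
  drop-≡ k f with k ℕ.≟ k
  ... | yes _ = refl
  ... | no k≢k = contradiction ≡.refl k≢k

  drop-≢ : ∀ {k i} f → i ≢ k → drop k f i ≈ f i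
  drop-≢ {k} {i} f i≢k with i ℕ.≟ k
  ... | yes i≡k = contradiction i≡k i≢k
  ... | no _ = refl

  ∑-drop : ∀ n k f → k ℕ.< n → ∑ n f ≈ f k + ∑ n (drop k f)
  ∑-drop (suc n) k f k<1+n with k ℕ.≟ n
  ... | yes ≡.refl = trans (+-comm _ _)
    (+-congˡ (trans (∑-cong n (λ i i<n → sym (drop-≢ f (ℕ.<⇒≢ i<n))))
    (sym (trans (+-congˡ (drop-≡ n f)) (+-identityʳ _)))))
  ... | no k≢n = trans (+-cong (∑-drop n k f (ℕ.≤∧≢⇒< (ℕ.≤-pred k<1+n) k≢n)) (sym (drop-≢ f (k≢n ∘ ≡.sym))))
    (+-assoc _ _ _)

  ∑-points : List ℕ → (ℕ → Carrier) → Carrier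
  ∑-points [] f = 0#
  ∑-points (k ∷ ks) f = f k + ∑-points ks f

  ∑-points-drop : ∀ k ks f → All (k ≢_) ks → ∑-points ks (drop k f) ≈ ∑-points ks f
  ∑-points-drop k [] f [] = refl
  ∑-points-drop k (l ∷ ks) f (k≢l ∷ k∉) = +-cong (drop-≢ f (k≢l ∘ ≡.sym)) (∑-points-drop k ks f k∉)

  -- The points of the list are split off one at a time; uniqueness ensures that dropping one leaves
  -- the values at the others intact.
  ∑-support : ∀ n ks f → Unique ks → All (ℕ._< n) ks → (∀ i → i ℕ.< n → All (i ≢_) ks → f i ≈ 0#) →
    ∑ n f ≈ ∑-points ks f
  ∑-support n [] f _ _ h = ∑-zero n (λ i i<n → h i i<n [])
  ∑-support n (k ∷ ks) f (k∉ ∷ u) (k<n ∷ ks<n) h = trans (∑-drop n k f k<n)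
    (+-congˡ (trans (∑-support n ks (drop k f) u ks<n rest) (∑-points-drop k ks f k∉)))
    where
    rest : ∀ i → i ℕ.< n → All (i ≢_) ks → drop k f i ≈ 0#
    rest i i<n i∉ with i ℕ.≟ k
    ... | yes _ = refl
    ... | no i≢k = h i i<n (i≢k ∷ i∉)

-- The binomial theorem for prime exponents

module FreshmansDream (R : CommutativeRing 0ℓ 0ℓ) where

  open RingSums R
  open Arithmetic
  import Data.Nat.Divisibility as ℕ
  open import Data.Nat.DivMod using (_/_; m/n*n≡m)
  open import Data.Nat.Combinatorics using (_C_; nC1≡n; nCn≡1)
  open import Data.Fin.Base using (toℕ)
  open import Data.Integer.Base using (+_)
  import Algebra.Properties.CommutativeSemiring.Binomial
  import Algebra.Properties.Monoid.Sum

  open CommutativeRing R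
  open import Algebra.Properties.Semiring.Exp semiring using (_^_)
  open import Algebra.Properties.Semiring.Mult semiring using (_×_; ×1-homo-*)
  open Algebra.Properties.Monoid.Sum +-monoid using (sum)
  open import Relation.Binary.Reasoning.Setoid setoid

  sum≈∑ : ∀ n (g : ℕ → Carrier) → sum {n} (g ∘ toℕ) ≈ ∑ n g
  sum≈∑ zero g = refl
  sum≈∑ (suc n) g = trans (+-congˡ (sum≈∑ n (g ∘ suc))) (sym (∑-head n g))

  binomial-∑ : ∀ n x y → (x + y) ^ n ≈ ∑ (suc n) (λ k → (n C k) × (x ^ k * y ^ (n ℕ.∸ k)))
  binomial-∑ n x y = trans (Algebra.Properties.CommutativeSemiring.Binomial.theorem commutativeSemiring n x y)
                           (sum≈∑ (suc n) (λ k → (n C k) × (x ^ k * y ^ (n ℕ.∸ k))))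

  -- The factor q x is pulled out of all middle terms, and its cofactor is shown to be y^(q-1)
  -- modulo x. This form serves the lifting of congruences, where x is divisible by a power of π,
  -- and the study of x = θ - 1, where y = 1 and the cofactor is 1 modulo x.
  freshman : ∀ {q} → Prime q → ∀ x y → ∃[ s ] (x + y) ^ q ≈ y ^ q + (ι (+ q) * x * (y ^ (q ℕ.∸ 1) + x * s) + x ^ q)
  freshman {suc (suc n)} pq x y = s , (begin
    (x + y) ^ q                                       ≈⟨ binomial-∑ q x y ⟩
    ∑ (suc (suc n)) T + T q
      ≈⟨ +-cong (trans (∑-head (suc n) T) (+-congˡ (∑-head n (T ∘ suc)))) T-last ⟩
    (T 0 + (T 1 + ∑ n (λ i → T (2 ℕ.+ i)))) + x ^ q   ≈⟨ +-congʳ (+-cong T-0 (+-cong T-1 T-mid)) ⟩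
    (y ^ q + (ι (+ q) * (x * y ^ suc n) + ι (+ q) * (x * x) * s)) + x ^ q
      ≈⟨ solve 6 (λ a k x b s c → (a :+ (k :* (x :* b) :+ k :* (x :* x) :* s)) :+ c := a :+
        (k :* x :* (b :+ x :* s) :+ c)) ≡.refl _ _ _ _ _ _ ⟩
    y ^ q + (ι (+ q) * x * (y ^ suc n + x * s) + x ^ q) ∎)
    where
    q = suc (suc n)
    T : ℕ → Carrier
    T k = (q C k) × (x ^ k * y ^ (q ℕ.∸ k))
    c : ℕ → ℕ
    c i = (q C (2 ℕ.+ i)) / q
    s = ∑ n (λ i → c i × (x ^ i * y ^ (q ℕ.∸ (2 ℕ.+ i))))
    T-0 : T 0 ≈ y ^ q
    T-0 = trans (+-identityʳ _) (*-identityˡ _)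
    T-1 : T 1 ≈ ι (+ q) * (x * y ^ suc n)
    T-1 = trans (reflexive (≡.cong (_× (x ^ 1 * y ^ suc n)) (nC1≡n q)))
                (trans (×≈ι* q _) (*-congˡ (*-congʳ (*-identityʳ x))))
    T-last : T q ≈ x ^ q
    T-last = trans (reflexive (≡.cong₂ (λ a b → a × (x ^ q * y ^ b)) (nCn≡1 q) (ℕ.n∸n≡0 q)))
                   (trans (+-identityʳ _) (*-identityʳ _))
    T-mid : ∑ n (λ i → T (2 ℕ.+ i)) ≈ ι (+ q) * (x * x) * s
    T-mid = trans (∑-cong n term) (sym (∑-*ˡ n _ _))
      where
      term : ∀ i → i ℕ.< n → T (2 ℕ.+ i) ≈ ι (+ q) * (x * x) * (c i × (x ^ i * y ^ (q ℕ.∸ (2 ℕ.+ i))))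
      term i i<n = begin
        (q C (2 ℕ.+ i)) × (x ^ (2 ℕ.+ i) * Y)   ≈⟨ ×≈ι* (q C (2 ℕ.+ i)) _ ⟩
        ι (+ (q C (2 ℕ.+ i))) * (x ^ (2 ℕ.+ i) * Y)
          ≡⟨ ≡.cong (λ m → ι (+ m) * (x ^ (2 ℕ.+ i) * Y))
          (≡.sym (m/n*n≡m (prime∣C pq (2 ℕ.+ i) (s≤s z≤n) (s≤s (s≤s i<n))))) ⟩
        ι (+ (c i ℕ.* q)) * (x ^ (2 ℕ.+ i) * Y) ≈⟨ *-congʳ (×1-homo-* (c i) q) ⟩
        ι (+ c i) * ι (+ q) * (x ^ (2 ℕ.+ i) * Y)
          ≈⟨ solve 5 (λ a k x b y → a :* k :* ((x :* (x :* b)) :* y) := k :* (x :* x) :* (a :* (b :* y))) ≡.refl _ _ _ _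
          _ ⟩
        ι (+ q) * (x * x) * (ι (+ c i) * (x ^ i * Y)) ≈⟨ *-congˡ (×≈ι* (c i) _) ⟨
        ι (+ q) * (x * x) * (c i × (x ^ i * Y)) ∎
        where Y = y ^ (q ℕ.∸ (2 ℕ.+ i))

-- Divisibility and congruences in a commutative ring

module RingCongruences (R : CommutativeRing 0ℓ 0ℓ) where

  open RingSums R
  open FreshmansDream R
  open Arithmetic
  open import Data.Integer.Base using (+_)
  open import Data.Product.Base using () renaming (_×_ to _∧_)

  open CommutativeRing R
  open import Algebra.Properties.Semiring.Exp semiring using (_^_; ^-congˡ; ^-congʳ; ^-homo-*; ^-assocʳ)
  open import Relation.Binary.Reasoning.Setoid setoid

  infix 4 _∣_ _≋_[_]

  _∣_ : Carrier → Carrier → Set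
  x ∣ y = ∃[ k ] y ≈ x * k

  _≋_[_] : Carrier → Carrier → Carrier → Set
  a ≋ b [ m ] = ∃[ k ] a ≈ b + m * k

  ∣-refl : ∀ {x} → x ∣ x
  ∣-refl = 1# , sym (*-identityʳ _)

  ∣-trans : ∀ {x y z} → x ∣ y → y ∣ z → x ∣ z
  ∣-trans (k , y≈) (l , z≈) = k * l , trans z≈ (trans (*-congʳ y≈) (*-assoc _ _ _))

  ∣-cong : ∀ {x y z} → y ≈ z → x ∣ y → x ∣ z
  ∣-cong y≈z (k , y≈) = k , trans (sym y≈z) y≈

  ∣-congˡ : ∀ {x y z} → x ≈ y → x ∣ z → y ∣ z
  ∣-congˡ x≈y (k , z≈) = k , trans z≈ (*-congʳ x≈y)

  ∣-^ : ∀ {x y} n → x ∣ y → x ^ n ∣ y ^ n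
  ∣-^ {x} n (k , y≈) = k ^ n , trans (^-congˡ n y≈) (*-^ x k n)

  x∣x^suc : ∀ {x} n → x ∣ x ^ suc n
  x∣x^suc n = _ , refl

  ≋-trans : ∀ {a b c m} → a ≋ b [ m ] → b ≋ c [ m ] → a ≋ c [ m ]
  ≋-trans {a} {b} {c} {m} (k , a≈) (l , b≈) = l + k , trans a≈ (trans (+-congʳ b≈)
    (solve 4 (λ c m l k → (c :+ m :* l) :+ m :* k := c :+ m :* (l :+ k)) ≡.refl c m l k))

  ≋-cong : ∀ {a b c d m} → a ≈ c → b ≈ d → a ≋ b [ m ] → c ≋ d [ m ]
  ≋-cong a≈c b≈d (k , a≈) = k , trans (sym a≈c) (trans a≈ (+-congʳ b≈d))

  ≋-sym : ∀ {a b m} → a ≋ b [ m ] → b ≋ a [ m ]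
  ≋-sym {a} {b} {m} (k , a≈) = - k , sym
    (trans (+-congʳ a≈) (solve 3 (λ b m k → (b :+ m :* k) :+ m :* (:- k) := b) ≡.refl b m k))

  ≋-weaken : ∀ {a b m n} → n ∣ m → a ≋ b [ m ] → a ≋ b [ n ]
  ≋-weaken (l , m≈) (k , a≈) = l * k , trans a≈ (+-congˡ (trans (*-congʳ m≈) (*-assoc _ _ _)))

  ≋-* : ∀ {a b c d m} → a ≋ b [ m ] → c ≋ d [ m ] → a * c ≋ b * d [ m ]
  ≋-* {a} {b} {c} {d} {m} (k , a≈) (l , c≈) = _ , trans (*-cong a≈ c≈)
    (solve 5 (λ b d m k l → (b :+ m :* k) :* (d :+ m :* l) := b :* d :+ m :* (k :* (d :+ m :* l) :+ b :* l)) ≡.refl b d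
      m k l)

  ≋-+ : ∀ {a b c d m} → a ≋ b [ m ] → c ≋ d [ m ] → a + c ≋ b + d [ m ]
  ≋-+ {a} {b} {c} {d} {m} (k , a≈) (l , c≈) = k + l , trans (+-cong a≈ c≈)
    (solve 5 (λ b d m k l → (b :+ m :* k) :+ (d :+ m :* l) := (b :+ d) :+ m :* (k :+ l)) ≡.refl b d m k l)

  ≋-refl : ∀ {a m} → a ≋ a [ m ]
  ≋-refl {a} {m} = 0# , sym (trans (+-congˡ (zeroʳ m)) (+-identityʳ a))

  ≋-^ : ∀ {a b m} n → a ≋ b [ m ] → a ^ n ≋ b ^ n [ m ]
  ≋-^ zero h = ≋-refl
  ≋-^ (suc n) h = ≋-* h (≋-^ n h)

  -- Morally b (1 - a z) = a^m u, and 1 - a z is a unit locally at a. Instead of inverting it, a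
  -- divisor a^i of b with i < m is inserted on the right-hand side, which yields the divisor
  -- a^(i+1).
  ∣-iterate : ∀ {a b u z} m → b ≈ a ^ m * u + b * (a * z) → a ^ m ∣ b
  ∣-iterate {a} {b} {u} {z} m eq = go m ℕ.≤-refl
    where
    go : ∀ i → i ℕ.≤ m → a ^ i ∣ b
    go zero _ = b , sym (*-identityˡ b)
    go (suc i) i<m with go i (ℕ.<⇒≤ i<m)
    ... | k , b≈ = a ^ (m ℕ.∸ suc i) * u + k * z , (begin
      b                                                      ≈⟨ eq ⟩
      a ^ m * u + b * (a * z)
        ≡⟨ ≡.cong (λ n → a ^ n * u + b * (a * z)) (≡.sym (ℕ.m+[n∸m]≡n i<m)) ⟩
      a ^ (suc i ℕ.+ (m ℕ.∸ suc i)) * u + b * (a * z)        ≈⟨ +-cong (*-congʳ (^-homo-* a (suc i) _)) (*-congʳ b≈) ⟩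
      (a * a ^ i) * a ^ (m ℕ.∸ suc i) * u + (a ^ i * k) * (a * z)
        ≈⟨ solve 6 (λ a p r u k z → a :* p :* r :* u :+ (p :* k) :* (a :* z) := (a :* p) :* (r :* u :+ k :* z)) ≡.refl a
          _ _ u k z ⟩
      (a * a ^ i) * (a ^ (m ℕ.∸ suc i) * u + k * z) ∎)

  private
    lift-identity : ∀ B π v p z E W → B + (π * v * (π * p * z) * E + (π * p * z) * ((π * p * z) * W))
                                    ≈ B + (π * (π * p)) * (v * z * E + z * (p * z) * W)
    lift-identity = solve 7 (λ B π v p z E W →
      B :+ (π :* v :* (π :* p :* z) :* E :+ (π :* p :* z) :* ((π :* p :* z) :* W))
                                              := B :+ (π :* (π :* p)) :* (v :* z :* E :+ z :* (p :* z) :* W)) ≡.refl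

  -- With w = a - b divisible by π^(k+1), the terms of (b + w)^q other than b^q contain q w or w^q.
  -- The former gain a factor π from q, the latter because q ≥ 2.
  ≋-lift : ∀ {q} → Prime q → ∀ {π} → π ∣ ι (+ q) → ∀ {a b} k → a ≋ b [ π ^ suc k ] → a ^ q ≋ b ^ q [ π ^ suc (suc k) ]
  ≋-lift {q@(suc (suc n))} pq {π} (v , q≈) {a} {b} k (z , a≈) = v * z * E + z * (π ^ k * z) * w ^ n , trans
    (^-congˡ q (trans a≈ (+-comm b w)))
    (trans (proj₂ (freshman pq w b))
    (trans (+-congˡ (+-congʳ (*-congʳ (*-congʳ q≈))))
           (lift-identity (b ^ q) π v (π ^ k) z E (w ^ n))))
    where
    w = π ^ suc k * z
    E = b ^ suc n + w * proj₁ (freshman pq w b)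

  ≋-lift* : ∀ {q} → Prime q → ∀ {π} → π ∣ ι (+ q) → ∀ {a b} c → a ≋ b [ π ] →
    a ^ (q ℕ.^ c) ≋ b ^ (q ℕ.^ c) [ π ^ suc c ]
  ≋-lift* pq π∣q zero (k , a≈) = k , trans (*-identityʳ _)
    (trans a≈ (+-cong (sym (*-identityʳ _)) (*-congʳ (sym (*-identityʳ _)))))
  ≋-lift* {q} pq {π} π∣q {a} {b} (suc c) h =
    ≋-cong (step a) (step b) (≋-lift pq π∣q c (≋-lift* pq π∣q c h))
    where
    step : ∀ x → (x ^ (q ℕ.^ c)) ^ q ≈ x ^ (q ℕ.^ suc c)
    step x = trans (^-assocʳ x (q ℕ.^ c) q) (^-congʳ x (ℕ.*-comm (q ℕ.^ c) q))

  x-1∣xⁿ-1 : ∀ x n → x - 1# ∣ x ^ n - 1#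
  x-1∣xⁿ-1 x zero = 0# , trans (-‿inverseʳ 1#) (sym (zeroʳ _))
  x-1∣xⁿ-1 x (suc n) = x * k + 1# , (begin
    x * x ^ n - 1#
      ≈⟨ solve 3 (λ x p o → x :* p :- o := x :* (p :- o) :+ (x :* o :- o)) ≡.refl x (x ^ n) 1# ⟩
    x * (x ^ n - 1#) + (x * 1# - 1#) ≈⟨ +-cong (*-congˡ (proj₂ (x-1∣xⁿ-1 x n))) (+-congʳ (*-identityʳ x)) ⟩
    x * ((x - 1#) * k) + (x - 1#)
      ≈⟨ +-cong (solve 3 (λ x y k → x :* (y :* k) := y :* (x :* k)) ≡.refl x (x - 1#) k) (sym (*-identityʳ _)) ⟩
    (x - 1#) * (x * k) + (x - 1#) * 1# ≈⟨ distribˡ _ _ _ ⟨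
    (x - 1#) * (x * k + 1#)       ∎)
    where k = proj₁ (x-1∣xⁿ-1 x n)

  -‿≋ : ∀ {a b m} → a ≋ b [ m ] → - a ≋ - b [ m ]
  -‿≋ {a} {b} {m} (k , a≈) = - k , trans (-‿cong a≈)
    (solve 3 (λ b m k → :- (b :+ m :* k) := :- b :+ m :* (:- k)) ≡.refl b m k)

  ^-+-mod : ∀ {q} → Prime q → ∀ x y → (x + y) ^ q ≋ x ^ q + y ^ q [ ι (+ q) ]
  ^-+-mod {q} pq x y = x * (y ^ (q ℕ.∸ 1) + x * s) , trans (proj₂ (freshman pq x y))
    (solve 5 (λ X Y k x t → Y :+ (k :* x :* t :+ X) := (X :+ Y) :+ k :* (x :* t)) ≡.refl (x ^ q) (y ^ q) (ι (+ q)) x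
      (y ^ (q ℕ.∸ 1) + x * s))
    where s = proj₁ (freshman pq x y)

  0^prime : ∀ {q} → Prime q → 0# ^ q ≈ 0#
  0^prime {q} pq = trans (^-congʳ 0# (≡.sym (ℕ.suc-pred q {{prime⇒nonZero pq}}))) (0^suc (ℕ.pred q))

  -- Additivity of the q-th power is applied to x + (- x) = 0, which treats q = 2 and odd q alike.
  ^-neg-mod : ∀ {q} → Prime q → ∀ x → (- x) ^ q ≋ - (x ^ q) [ ι (+ q) ]
  ^-neg-mod {q} pq x = - k , (begin
    (- x) ^ q
      ≈⟨ solve 3 (λ a b c → a := :- b :+ ((b :+ a) :+ c) :- c) ≡.refl ((- x) ^ q) (x ^ q) (ι (+ q) * k) ⟩
    (- (x ^ q) + ((x ^ q + (- x) ^ q) + ι (+ q) * k)) - ι (+ q) * k ≈⟨ +-congʳ (+-congˡ (proj₂ (^-+-mod pq x (- x)))) ⟨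
    (- (x ^ q) + (x + - x) ^ q) - ι (+ q) * k
      ≈⟨ +-congʳ (+-congˡ (trans (^-congˡ q (-‿inverseʳ x)) (0^prime pq))) ⟩
    (- (x ^ q) + 0#) - ι (+ q) * k
      ≈⟨ +-cong (+-identityʳ _) (solve 2 (λ q k → :- (q :* k) := q :* (:- k)) ≡.refl (ι (+ q)) k) ⟩
    - (x ^ q) + ι (+ q) * (- k)                    ∎)
    where k = proj₁ (^-+-mod pq x (- x))

  -- Every x is congruent mod π to arbitrarily high powers of itself, so x = x^(1+L) + π x₁; the
  -- first summand contributes a multiple of x y (σ x is congruent mod π^c to a power of x after
  -- raising to the power q^c), the second one is handled by induction on c.
  module FrobeniusInvariance
    {q : ℕ} (pq : Prime q) (π : Carrier) (π∣q : π ∣ ι (+ q))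
    (cancel : ∀ a b → π * a ≈ π * b → a ≈ b)
    (σ : Carrier → Carrier)
    (σ-cong : ∀ {a b} → a ≈ b → σ a ≈ σ b)
    (σ-+ : ∀ a b → σ (a + b) ≈ σ a + σ b)
    (σ-* : ∀ a b → σ (a * b) ≈ σ a * σ b)
    (σ-1 : σ 1# ≈ 1#)
    (π∣σπ : π ∣ σ π)
    (Q : ℕ) (σ-frobenius : ∀ x → σ x ≋ x ^ suc Q [ π ])
    (reduced : ∀ B x → ∃[ L ] (B ℕ.≤ L ∧ x ≋ x ^ suc L [ π ]))
    where

    σ-^ : ∀ x n → σ (x ^ n) ≈ σ x ^ n
    σ-^ x zero = σ-1
    σ-^ x (suc n) = trans (σ-* x (x ^ n)) (*-congˡ (σ-^ x n))

    ^∣σ : ∀ c x y → π ^ c ∣ x * y → π ^ c ∣ σ x * y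
    ^∣σ zero x y _ = σ x * y , sym (*-identityˡ _)
    ^∣σ (suc c) x y (k , xy≈) = (σ x ^ r * (xy′ * k) + σ x ^ r * (k″ * y)) + u * k' , (begin
      σ x * y
        ≈⟨ *-congʳ (trans (σ-cong x≈) (trans (σ-+ _ _) (+-cong (σ-^ x (suc L)) (σ-* π x₁)))) ⟩
      (σ x ^ suc L + σ π * σ x₁) * y                              ≈⟨ *-congʳ (+-cong σ^≈ (*-congʳ (proj₂ π∣σπ))) ⟩
      (((x * xy′) + P * k″) * σ x ^ r + (π * u) * σ x₁) * y       ≈⟨ identity₁ x xy′ P k″ (σ x ^ r) π u (σ x₁) y ⟩
      (σ x ^ r * (xy′ * (x * y)) + P * (σ x ^ r * (k″ * y))) + π * u * (σ x₁ * y)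
        ≈⟨ +-cong (+-congʳ (*-congˡ (*-congˡ xy≈))) (*-congˡ (proj₂ ih)) ⟩
      (σ x ^ r * (xy′ * (π * π ^ c * k)) + π * π ^ c * (σ x ^ r * (k″ * y))) + π * u * (π ^ c * k')
        ≈⟨ identity₂ (σ x ^ r) xy′ π (π ^ c) k (σ x ^ r * (k″ * y)) u k' ⟩
      P * ((σ x ^ r * (xy′ * k) + σ x ^ r * (k″ * y)) + u * k') ∎)
      where
      P = π ^ suc c
      u = proj₁ π∣σπ
      -- L is at least q^c, so that (σ x)^(1+L) contains (σ x)^(q^c), the power for which σ x ≡
      -- x^(1+Q) lifts to a congruence modulo π^(c+1).
      red = reduced (q ℕ.^ c) x
      L = proj₁ red
      q^c≤L = proj₁ (proj₂ red)
      x₁ = proj₁ (proj₂ (proj₂ red))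
      x≈ : x ≈ x ^ suc L + π * x₁
      x≈ = proj₂ (proj₂ (proj₂ red))
      -- Multiplying x = x^(1+L) + π x₁ by y shows that π x₁ y is a multiple of x y and so of
      -- π^(c+1); one factor π is cancelled to reach the induction hypothesis for x₁.
      eq₁ : π * (x₁ * y) ≈ π * (π ^ c * (k * (1# - x ^ L)))
      eq₁ = begin
        π * (x₁ * y)
          ≈⟨ solve 4 (λ π a y e → π :* (a :* y) := (e :+ π :* a) :* y :- e :* y) ≡.refl π x₁ y (x * x ^ L) ⟩
        (x * x ^ L + π * x₁) * y - x * x ^ L * y  ≈⟨ +-congʳ (*-congʳ x≈) ⟨
        x * y - x * x ^ L * y
          ≈⟨ solve 3 (λ x y e → x :* y :- x :* e :* y := (x :* y) :* (con 1ℤ :- e)) ≡.refl x y (x ^ L) ⟩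
        (x * y) * (ι 1ℤ - x ^ L)                  ≈⟨ *-cong xy≈ (+-congʳ ι-1) ⟩
        (π * π ^ c * k) * (1# - x ^ L)
          ≈⟨ solve 4 (λ π p k e → (π :* p :* k) :* e := π :* (p :* (k :* e))) ≡.refl π (π ^ c) k (1# - x ^ L) ⟩
        π * (π ^ c * (k * (1# - x ^ L)))          ∎
      ih : π ^ c ∣ σ x₁ * y
      ih = ^∣σ c x₁ y (k * (1# - x ^ L) , cancel _ _ eq₁)
      k' = proj₁ ih
      lift = ≋-lift* pq π∣q c (σ-frobenius x)
      k″ = proj₁ lift
      r = suc L ℕ.∸ q ℕ.^ c
      xy′ = x ^ (suc Q ℕ.* q ℕ.^ c ℕ.∸ 1)
      q^c>0 : 0 ℕ.< q ℕ.^ c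
      q^c>0 = ℕ.m^n>0 q {{prime⇒nonZero pq}} c
      x-pow : (x ^ suc Q) ^ (q ℕ.^ c) ≈ x * xy′
      x-pow = trans (^-assocʳ x (suc Q) (q ℕ.^ c)) (^-congʳ x (≡.sym (ℕ.m+[n∸m]≡n {1} (ℕ.≤-trans q^c>0 (ℕ.m≤m+n _ _)))))
      σ^≈ : σ x ^ suc L ≈ (x * xy′ + P * k″) * σ x ^ r
      σ^≈ = trans (^-congʳ (σ x) (≡.sym (ℕ.m+[n∸m]≡n (ℕ.m≤n⇒m≤1+n q^c≤L))))
        (trans (^-homo-* (σ x) (q ℕ.^ c) r) (*-congʳ (trans (proj₂ lift) (+-congʳ x-pow))))
      identity₁ : ∀ x e p k s π u z y → (((x * e) + p * k) * s + (π * u) * z) * y ≈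
        (s * (e * (x * y)) + p * (s * (k * y))) + π * u * (z * y)
      identity₁ = solve 9 (λ x e p k s π u z y → (((x :* e) :+ p :* k) :* s :+ (π :* u) :* z) :* y
             := (s :* (e :* (x :* y)) :+ p :* (s :* (k :* y))) :+ π :* u :* (z :* y)) ≡.refl
      identity₂ : ∀ s e π c k t u l → (s * (e * ((π * c) * k)) + (π * c) * t) + π * u * (c * l) ≈ (π * c) *
        ((s * (e * k) + t) + u * l)
      identity₂ = solve 8 (λ s e π c k t u l → (s :* (e :* ((π :* c) :* k)) :+ (π :* c) :* t) :+ π :* u :* (c :* l)
             := (π :* c) :* ((s :* (e :* k) :+ t) :+ u :* l)) ≡.refl

  module Ramification (domain : ∀ a b → a * b ≈ 0# → a ≈ 0# ⊎ b ≈ 0#) {q : ℕ} (pq : Prime q) where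

    private
      k = ι (+ q)

    expand : ∀ θ → ∃[ s ] θ ^ q ≈ 1# + (k * (θ - 1#) * (1# + (θ - 1#) * s) + (θ - 1#) ^ q)
    expand θ = s , trans (^-congˡ q (solve 2 (λ θ o → θ := (θ :- o) :+ o) ≡.refl θ 1#))
                       (trans (proj₂ (freshman pq (θ - 1#) 1#))
                         (+-cong (1^ q) (+-congʳ (*-congˡ (+-congʳ (1^ (q ℕ.∸ 1)))))))
      where s = proj₁ (freshman pq (θ - 1#) 1#)

    Associated : Carrier → Carrier → Set
    Associated a b = a ∣ b ∧ b ∣ a

    -- Expanding θ^q = 1 around 1 and cancelling x = θ - 1 gives q f = - x^(q-1) with f = 1 + x s.
    -- One divisibility is immediate; for the other, q = - x^(q-1) - q x s has the shape treated by
    -- `∣-iterate`.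
    ramified-base : ∀ θ → θ ^ q ≈ 1# → ¬ (θ ≈ 1#) → ∃[ e ] Associated ((θ - 1#) ^ suc e) k
    ramified-base θ θ^q≈1 θ≉1 = result (domain x (k * f + x ^ n) prod≈0)
      where
      n = q ℕ.∸ 1
      1<q = ℕ.nonTrivial⇒n>1 q {{prime⇒nonTrivial pq}}
      x = θ - 1#
      s = proj₁ (expand θ)
      f = 1# + x * s
      x^q≈ : x ^ q ≈ x * x ^ n
      x^q≈ = ^-congʳ x (≡.sym (ℕ.m+[n∸m]≡n {1} (ℕ.<⇒≤ 1<q)))
      x^n≈ : x ^ n ≈ x ^ suc (q ℕ.∸ 2)
      x^n≈ = ^-congʳ x (ℕ.+-∸-assoc 1 1<q)
      prod≈0 : x * (k * f + x ^ n) ≈ 0#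
      prod≈0 = trans (solve 5 (λ x k f p o → x :* (k :* f :+ p) := (o :+ (k :* x :* f :+ x :* p)) :- o) ≡.refl x k f
        (x ^ n) 1#)
        (≈⇒-≈0 (trans (+-congˡ (+-congˡ (sym x^q≈))) (trans (sym (proj₂ (expand θ))) θ^q≈1)))
      result : x ≈ 0# ⊎ k * f + x ^ n ≈ 0# → _
      result (inj₁ x≈0) = contradiction (-≈0⇒≈ x≈0) θ≉1
      result (inj₂ h) = q ℕ.∸ 2
        , ∣-congˡ x^n≈ (∣-iterate {u = - 1#} {z = - s} n (trans
            (solve 5 (λ k o x s p → k := (p :* (:- o) :+ k :* (x :* (:- s))) :+
              ((k :* (o :+ x :* s) :+ p) :+ ((con 1ℤ :- o) :* k :- (con 1ℤ :- o) :* p))) ≡.refl k 1# x s (x ^ n))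
            (trans (+-congˡ (trans (+-cong h (trans (+-cong (vanish k) (-‿cong (vanish (x ^ n)))) (-‿inverseʳ 0#)))
              (+-identityʳ 0#))) (+-identityʳ _))))
        , ∣-cong x^n≈ (- f , trans (solve 3 (λ k f p → p := k :* (:- f) :+ (k :* f :+ p)) ≡.refl k f (x ^ n))
            (trans (+-congˡ h) (+-identityʳ _)))
        where
        -- To the solver `1#` is a variable, while `con 1ℤ` denotes `ι 1ℤ`; the difference of the
        -- two is removed here.
        vanish : ∀ y → (ι 1ℤ - 1#) * y ≈ 0#
        vanish y = trans (*-congʳ (≈⇒-≈0 ι-1)) (zeroˡ y)

    -- θ^q - 1 and (θ - 1)^q differ by a multiple of q (θ - 1), and θ^q - 1 divides q by induction,
    -- so the two are associates. Each step multiplies the exponent by q.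
    ramified : ∀ j θ → θ ^ (q ℕ.^ suc j) ≈ 1# → ¬ (θ ^ (q ℕ.^ j) ≈ 1#) → ∃[ e ] Associated ((θ - 1#) ^ suc e) k
    ramified zero θ θ^q≈1 θ≉1 = ramified-base θ (trans (^-congʳ θ (≡.sym (ℕ.*-identityʳ q))) θ^q≈1)
      (λ h → θ≉1 (trans (*-identityʳ θ) h))
    ramified (suc j) θ θ^≈1 θ^≉1 = pred-e
        , ∣-congˡ powers (∣-trans (∣-^ (suc e) x^q∣π′) (proj₁ (proj₂ ih)))
        , ∣-trans (proj₂ (proj₂ ih)) (∣-cong powers (∣-^ (suc e) π′∣x^q))
      where
      ih : ∃[ e ] Associated ((θ ^ q - 1#) ^ suc e) k
      ih = ramified j (θ ^ q) (trans (^-assocʳ θ q _) θ^≈1) (λ h → θ^≉1 (trans (sym (^-assocʳ θ q _)) h))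
      e = proj₁ ih
      pred-e = q ℕ.* suc e ℕ.∸ 1
      x = θ - 1#
      s = proj₁ (expand θ)
      f = 1# + x * s
      π′ = θ ^ q - 1#
      powers : (x ^ q) ^ suc e ≈ x ^ suc pred-e
      powers = trans (^-assocʳ x q (suc e))
        (^-congʳ x (≡.sym (ℕ.m+[n∸m]≡n {1}
        (ℕ.*-mono-≤ (ℕ.<⇒≤ (ℕ.nonTrivial⇒n>1 q {{prime⇒nonTrivial pq}})) (s≤s z≤n)))))
      π′∣q : π′ ∣ k
      π′∣q = ∣-trans (x∣x^suc e) (proj₁ (proj₂ ih))
      w = proj₁ π′∣q
      π′≈ : π′ ≈ k * x * f + x ^ q
      π′≈ = trans (+-congʳ (proj₂ (expand θ))) (solve 2 (λ o t → (o :+ t) :- o := t) ≡.refl 1# (k * x * f + x ^ q))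
      x^q∣π′ : x ^ q ∣ π′
      x^q∣π′ = ∣-iterate {u = 1#} {z = w * f} q (trans π′≈ (trans (+-congʳ (*-congʳ (*-congʳ (proj₂ π′∣q))))
        (trans (+-comm _ _) (+-cong (sym (*-identityʳ _))
          (solve 4 (λ a w x f → a :* w :* x :* f := a :* (x :* (w :* f))) ≡.refl π′ w x f)))))
      π′∣x^q : π′ ∣ x ^ q
      π′∣x^q = 1# - w * x * f , trans (solve 2 (λ a b → b := (a :+ b) :- a) ≡.refl (k * x * f) (x ^ q))
        (trans (+-cong (sym π′≈) (-‿cong (*-congʳ (*-congʳ (proj₂ π′∣q)))))
        (trans (+-congʳ (sym (*-identityʳ π′)))
          (solve 5 (λ a o w x f → a :* o :- a :* w :* x :* f := a :* (o :- w :* x :* f)) ≡.refl π′ 1# w x f)))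

-- Integer sums and linear dependence

module ℤSums where

  open IntegerPolynomials
  open import Data.Integer.Base using (_+_; _*_; -_)
  open import Data.Product.Base using (Σ; _×_)
  open import Relation.Nullary using (¬?)
  open import Relation.Binary.PropositionalEquality
  open RingSums ℤ.+-*-commutativeRing public

  sumℤ≡∑ : ∀ n f → sumℤ n f ≡ ∑ n f
  sumℤ≡∑ zero f = refl
  sumℤ≡∑ (suc n) f = cong (_+ f n) (sumℤ≡∑ n f)

  -- The increasing enumeration of the numbers other than k, and its left inverse.
  skip unskip : ℕ → ℕ → ℕ
  skip k i with i ℕ.<? k
  ... | yes _ = i
  ... | no _ = suc i
  unskip k i with i ℕ.<? k
  ... | yes _ = i
  ... | no _ = ℕ.pred i

  unskip-skip : ∀ k i → unskip k (skip k i) ≡ i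
  unskip-skip k i with i ℕ.<? k
  ... | yes i<k with i ℕ.<? k
  ...   | yes _ = refl
  ...   | no i≮k = contradiction i<k i≮k
  unskip-skip k i | no i≮k with suc i ℕ.<? k
  ...   | yes 1+i<k = contradiction (ℕ.<-trans (ℕ.n<1+n i) 1+i<k) i≮k
  ...   | no _ = refl

  skip≢ : ∀ k i → skip k i ≢ k
  skip≢ k i eq with i ℕ.<? k
  ... | yes i<k = ℕ.<⇒≢ i<k eq
  ... | no i≮k = i≮k (subst (suc i ℕ.≤_) eq ℕ.≤-refl)

  skip< : ∀ k i n → i ℕ.< n → skip k i ℕ.< suc n
  skip< k i n i<n with i ℕ.<? k
  ... | yes _ = ℕ.m<n⇒m<1+n i<n
  ... | no _ = s≤s i<n

  skip-below : ∀ k i → i ℕ.< k → skip k i ≡ i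
  skip-below k i i<k with i ℕ.<? k
  ... | yes _ = refl
  ... | no i≮k = contradiction i<k i≮k

  skip-above : ∀ k i → k ℕ.≤ i → skip k i ≡ suc i
  skip-above k i k≤i with i ℕ.<? k
  ... | yes i<k = contradiction k≤i (ℕ.<⇒≱ i<k)
  ... | no _ = refl

  ∑-remove : ∀ n k f → k ℕ.< suc n → ∑ (suc n) f ≡ f k + ∑ n (f ∘ skip k)
  ∑-remove n k f k<1+n with k ℕ.≟ n
  ... | yes refl = trans (ℤ.+-comm (∑ n f) (f n))
    (cong (f n +_) (∑-cong n (λ i i<n → cong f (sym (skip-below n i i<n)))))
  ∑-remove zero k f k<1+n | no k≢n = contradiction (ℕ.n<1⇒n≡0 k<1+n) k≢n
  ∑-remove (suc n) k f k<1+n | no k≢n = begin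
    ∑ (suc n) f + f (suc n)                        ≡⟨ cong (_+ f (suc n)) (∑-remove n k f k<n) ⟩
    (f k + ∑ n (f ∘ skip k)) + f (suc n)           ≡⟨ ℤ.+-assoc (f k) _ _ ⟩
    f k + (∑ n (f ∘ skip k) + f (suc n))
      ≡⟨ cong (λ m → f k + (∑ n (f ∘ skip k) + f m)) (skip-above k n (ℕ.≤-pred k<n)) ⟨
    f k + ∑ (suc n) (f ∘ skip k)                   ∎
    where
    open ≡-Reasoning
    k<n : k ℕ.< suc n
    k<n = ℕ.≤∧≢⇒< (ℕ.≤-pred k<1+n) k≢n

  -- Gaussian elimination of the last coordinate. The other vectors are multiplied by the pivot
  -- before a multiple of the pivot vector is subtracted, so that all coefficients stay in ℤ.
  dependence : ∀ n (v : ℕ → ℕ → ℤ) → Σ (ℕ → ℤ) λ c →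
    ((∃[ i ] (i ℕ.< suc n × c i ≢ 0ℤ)) × (∀ j → j ℕ.< n → ∑ (suc n) (λ i → c i * v i j) ≡ 0ℤ))
  dependence zero v = (λ _ → 1ℤ) , (0 , s≤s z≤n , λ ()) , λ j ()
  dependence (suc m) v with ℕ.anyUpTo? (λ i → ¬? (v i m ℤ.≟ 0ℤ)) (suc (suc m))
  -- Without a pivot the last coordinate vanishes throughout, and the last vector gets coefficient
  -- 0.
  ... | no ¬∃ = c , (i₀ , ℕ.m<n⇒m<1+n i₀< , subst (_≢ 0ℤ) (sym (c-below i₀ i₀<)) d≢0) , vanish
    where
    ih = dependence m v
    d = proj₁ ih
    i₀ = proj₁ (proj₁ (proj₂ ih))
    i₀< = proj₁ (proj₂ (proj₁ (proj₂ ih)))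
    d≢0 = proj₂ (proj₂ (proj₁ (proj₂ ih)))
    v≡0 : ∀ i → i ℕ.< suc (suc m) → v i m ≡ 0ℤ
    v≡0 i i< with v i m ℤ.≟ 0ℤ
    ... | yes eq = eq
    ... | no neq = contradiction (i , i< , neq) ¬∃
    c : ℕ → ℤ
    c i with i ℕ.<? suc m
    ... | yes _ = d i
    ... | no _ = 0ℤ
    c-below : ∀ i → i ℕ.< suc m → c i ≡ d i
    c-below i i< with i ℕ.<? suc m
    ... | yes _ = refl
    ... | no i≮ = contradiction i< i≮
    c-top : c (suc m) ≡ 0ℤ
    c-top with suc m ℕ.<? suc m
    ... | yes lt = contradiction lt (ℕ.n≮n (suc m))
    ... | no _ = refl
    vanish : ∀ j → j ℕ.< suc m → ∑ (suc (suc m)) (λ i → c i * v i j) ≡ 0ℤ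
    vanish j j< with j ℕ.≟ m
    ... | yes refl = ∑-zero (suc (suc m)) (λ i i< → trans (cong (c i *_) (v≡0 i i<)) (ℤ.*-zeroʳ (c i)))
    ... | no j≢m = cong₂ _+_
      (trans (∑-cong (suc m) (λ i i< → cong (_* v i j) (c-below i i<)))
        (proj₂ (proj₂ ih) j (ℕ.≤∧≢⇒< (ℕ.≤-pred j<) j≢m)))
      (trans (cong (_* v (suc m) j) c-top) (ℤ.*-zeroˡ (v (suc m) j)))
  ... | yes (k , k< , a≢0) = c , (skip k i₀ , skip< k i₀ (suc m) i₀< , nonzero) , vanish
    where
    a = v k m
    w : ℕ → ℕ → ℤ
    w i j = a * v (skip k i) j + - (v (skip k i) m * v k j)
    ih = dependence m w
    d = proj₁ ih
    i₀ = proj₁ (proj₁ (proj₂ ih))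
    i₀< = proj₁ (proj₂ (proj₁ (proj₂ ih)))
    d≢0 = proj₂ (proj₂ (proj₁ (proj₂ ih)))
    -- The coefficient of the pivot vector collects the multiples of it that `w` subtracts.
    b = - ∑ (suc m) (λ i → d i * v (skip k i) m)
    c : ℕ → ℤ
    c x with x ℕ.≟ k
    ... | yes _ = b
    ... | no _ = a * d (unskip k x)
    c-k : c k ≡ b
    c-k with k ℕ.≟ k
    ... | yes _ = refl
    ... | no k≢k = contradiction refl k≢k
    c-skip : ∀ i → c (skip k i) ≡ a * d i
    c-skip i with skip k i ℕ.≟ k
    ... | yes eq = contradiction eq (skip≢ k i)
    ... | no _ = cong (λ x → a * d x) (unskip-skip k i)
    nonzero : c (skip k i₀) ≢ 0ℤ
    nonzero eq with ℤ.i*j≡0⇒i≡0∨j≡0 a (trans (sym (c-skip i₀)) eq)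
    ... | inj₁ a≡0 = a≢0 a≡0

    ... | inj₂ d≡0 = d≢0 d≡0

    open ≡-Reasoning
    combine : ∀ j → ∑ (suc (suc m)) (λ i → c i * v i j) ≡ ∑ (suc m) (λ i → d i * w i j)
    combine j = begin
      ∑ (suc (suc m)) (λ i → c i * v i j)
        ≡⟨ ∑-remove (suc m) k (λ i → c i * v i j) k< ⟩
      c k * v k j + ∑ (suc m) (λ i → c (skip k i) * v (skip k i) j)
        ≡⟨ cong₂ _+_ (cong (_* v k j) c-k) (∑-cong (suc m) (λ i _ → cong (_* v (skip k i) j) (c-skip i))) ⟩
      b * v k j + ∑ (suc m) (λ i → a * d i * v (skip k i) j)
        ≡⟨ cong (_+ ∑ (suc m) (λ i → a * d i * v (skip k i) j))
        (trans (solve 2 (λ s x → :- s :* x := (:- x) :* s) refl _ (v k j))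
        (∑-*ˡ (suc m) (- v k j) (λ i → d i * v (skip k i) m))) ⟩
      ∑ (suc m) (λ i → - v k j * (d i * v (skip k i) m)) + ∑ (suc m) (λ i → a * d i * v (skip k i) j)
        ≡⟨ ∑-+ (suc m) _ _ ⟨
      ∑ (suc m) (λ i → - v k j * (d i * v (skip k i) m) + a * d i * v (skip k i) j)
        ≡⟨ ∑-cong (suc m) (λ i _ → solve 5
        (λ x d y a u → (:- x) :* (d :* y) :+ a :* d :* u := d :* (a :* u :+ :- (y :* x))) refl (v k j) (d i)
        (v (skip k i) m) a (v (skip k i) j)) ⟩
      ∑ (suc m) (λ i → d i * w i j)                                                       ∎
    vanish : ∀ j → j ℕ.< suc m → ∑ (suc (suc m)) (λ i → c i * v i j) ≡ 0ℤ
    vanish j j< with j ℕ.≟ m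
    ... | yes refl = trans (combine m)
      (∑-zero (suc m) (λ i _ → solve 3 (λ d a y → d :* (a :* y :+ :- (y :* a)) := con 0ℤ) refl (d i) a
      (v (skip k i) m)))
    ... | no j≢m = trans (combine j) (proj₂ (proj₂ ih) j (ℕ.≤∧≢⇒< (ℕ.≤-pred j<) j≢m))

-- Bézout's identity with integer coefficients

module IntegerBézout where

  open import Data.Nat.Coprimality using (coprime-Bézout)
  open import Data.Nat.GCD using (module Bézout)
  open import Data.Integer.Base
  open import Data.Integer.Properties
  open import Relation.Binary.PropositionalEquality

  bezoutℤ : ∀ {m n} → Coprime m n → ∃[ x ] ∃[ y ] 1ℤ ≡ x * + m + y * + n
  bezoutℤ {m} {n} cop with coprime-Bézout cop
  ... | Bézout.+- x y e = + x , - (+ y) , trans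
        (ℤSums.solve 2 (λ u v → u ℤSums.:= (u ℤSums.:+ v) ℤSums.:- v) refl 1ℤ (+ y * + n))
        (trans (cong (λ t → t - + y * + n)
          (trans (cong (λ t → 1ℤ + t) (sym (pos-* y n))) (trans (cong +_ e) (pos-* x m))))
          (cong (λ t → + x * + m + t) (neg-distribˡ-* (+ y) (+ n))))
  ... | Bézout.-+ x y e = - (+ x) , + y , trans
        (ℤSums.solve 2 (λ u v → u ℤSums.:= ℤSums.:- v ℤSums.:+ (u ℤSums.:+ v)) refl 1ℤ (+ x * + m))
        (trans (cong (λ t → - (+ x * + m) + t)
          (trans (cong (λ t → 1ℤ + t) (sym (pos-* x m))) (trans (cong +_ e) (pos-* y n))))
          (cong (λ t → t + + y * + n) (neg-distribˡ-* (+ x) (+ m))))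

-- Evaluation of polynomials and the subring ℤ[z]

module Evaluation (R : CommutativeRing 0ℓ 0ℓ) where

  open import Algebra.Bundles using (RawRing)
  open IntegerPolynomials
  open RingSums R
  open import Data.Nat.DivMod using (_%_; m≡m%n+[m/n]*n; m%n<n; _/_)
  open import Data.Integer.Base using (+_; -[1+_])
  open import Algebra.Morphism.Structures using (IsRingMonomorphism)
  import Algebra.Morphism.RingMonomorphism

  open CommutativeRing R
  open import Algebra.Properties.Semiring.Exp semiring using (_^_; ^-congˡ; ^-congʳ; ^-homo-*; ^-assocʳ)
  open import Relation.Binary.Reasoning.Setoid setoid

  ev : Carrier → Poly → Carrier
  ev z 𝟘 = 0#
  ev z 𝟙 = 1#
  ev z X = z
  ev z (a ⊕ b) = ev z a + ev z b
  ev z (a ⊗ b) = ev z a * ev z b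
  ev z (⊖ a) = - ev z a

  ev-cong : ∀ {z w} e → z ≈ w → ev z e ≈ ev w e
  ev-cong 𝟘 h = refl
  ev-cong 𝟙 h = refl
  ev-cong X h = h
  ev-cong (a ⊕ b) h = +-cong (ev-cong a h) (ev-cong b h)
  ev-cong (a ⊗ b) h = *-cong (ev-cong a h) (ev-cong b h)
  ev-cong (⊖ a) h = -‿cong (ev-cong a h)

  ev-[] : ∀ z e d → ev z (e [ d ]) ≈ ev (ev z d) e
  ev-[] z 𝟘 d = refl
  ev-[] z 𝟙 d = refl
  ev-[] z X d = refl
  ev-[] z (a ⊕ b) d = +-cong (ev-[] z a d) (ev-[] z b d)
  ev-[] z (a ⊗ b) d = *-cong (ev-[] z a d) (ev-[] z b d)
  ev-[] z (⊖ a) d = -‿cong (ev-[] z a d)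

  ev-power : ∀ z e n → ev z (power e n) ≈ ev z e ^ n
  ev-power z e zero = refl
  ev-power z e (suc n) = *-congˡ (ev-power z e n)

  ev-natural : ∀ z n → ev z (natural n) ≈ ι (+ n)
  ev-natural z zero = refl
  ev-natural z (suc n) = +-congˡ (ev-natural z n)

  ev-constant : ∀ z c → ev z (constant c) ≈ ι c
  ev-constant z (+ n) = ev-natural z n
  ev-constant z -[1+ n ] = -‿cong (ev-natural z (suc n))

  ev-fromCoeffs : ∀ z n a → ev z (fromCoeffs n a) ≈ ∑ n (λ i → ι (a i) * z ^ i)
  ev-fromCoeffs z zero a = refl
  ev-fromCoeffs z (suc n) a = +-cong (ev-fromCoeffs z n a) (*-cong (ev-constant z (a n)) (ev-power z X n))

  polyRawRing : Carrier → RawRing 0ℓ 0ℓ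
  polyRawRing z = record
    { Carrier = Poly ; _≈_ = λ a b → ev z a ≈ ev z b
    ; _+_ = _⊕_ ; _*_ = _⊗_ ; -_ = ⊖_ ; 0# = 𝟘 ; 1# = 𝟙 }

  -- The subring ℤ[z] of R.
  polyRing : Carrier → CommutativeRing 0ℓ 0ℓ
  polyRing z = record { isCommutativeRing = Algebra.Morphism.RingMonomorphism.isCommutativeRing ev-mono
    isCommutativeRing }
    where
    ev-mono : IsRingMonomorphism (polyRawRing z) rawRing (ev z)
    ev-mono = record
      { isRingHomomorphism = record
        { isSemiringHomomorphism = record
          { isNearSemiringHomomorphism = record
            { +-isMonoidHomomorphism = record
              { isMagmaHomomorphism = record
                { isRelHomomorphism = record { cong = id }
                ; homo = λ _ _ → refl }
              ; ε-homo = refl }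
            ; *-homo = λ _ _ → refl }
          ; 1#-homo = refl }
        ; -‿homo = λ _ → refl }
      ; injective = id }

  ^-*N : ∀ {z N} → z ^ N ≈ 1# → ∀ k → z ^ (k ℕ.* N) ≈ 1#
  ^-*N {z} {N} h k = trans (^-congʳ z (ℕ.*-comm k N)) (trans (sym (^-assocʳ z N k)) (trans (^-congˡ k h) (1^ k)))

  ^-% : ∀ {z N} .{{_ : NonZero N}} → z ^ N ≈ 1# → ∀ k → z ^ (k % N) ≈ z ^ k
  ^-% {z} {N} h k = sym (begin
    z ^ k                                      ≡⟨ ≡.cong (z ^_) (m≡m%n+[m/n]*n k N) ⟩
    z ^ (k % N ℕ.+ (k / N) ℕ.* N)              ≈⟨ ^-homo-* z (k % N) _ ⟩
    z ^ (k % N) * z ^ ((k / N) ℕ.* N)          ≈⟨ *-congˡ (^-*N h (k / N)) ⟩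
    z ^ (k % N) * 1#                           ≈⟨ *-identityʳ _ ⟩
    z ^ (k % N)                                ∎)

  -- For the indicator function of a set this is its exponential sum; at the powers of ζ it is the
  -- discrete Fourier transform.
  F : ℕ → (ℕ → ℤ) → Carrier → Carrier
  F N a z = ∑ N (λ i → ι (a i) * z ^ i)

  module _ {N : ℕ} .{{_ : NonZero N}} where

    ev-coeffs : ∀ e {z} → z ^ N ≈ 1# → ev z e ≈ F N (coeffs N e) z
    ev-coeffs 𝟘 h = sym (∑-zero N (λ i _ → zeroˡ _))
    ev-coeffs 𝟙 {z} h = sym (trans (∑-cong N (λ i _ → *-congʳ (ι-χℤ (i ℕ.≟ 0)))) (∑-χ N 0 (z ^_) (ℕ.>-nonZero⁻¹ N)))
    ev-coeffs X {z} h = sym (trans (∑-cong N (λ i _ → *-congʳ (ι-χℤ (i ℕ.≟ 1 % N))))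
      (trans (∑-χ N (1 % N) (z ^_) (m%n<n 1 N))
      (trans (^-% h 1) (*-identityʳ z))))
    ev-coeffs (a ⊕ b) {z} h = trans (+-cong (ev-coeffs a h) (ev-coeffs b h)) (sym (trans
      (∑-cong N (λ i _ → trans (*-congʳ (ι-+ (coeffs N a i) (coeffs N b i))) (distribʳ _ _ _))) (∑-+ N _ _)))
    ev-coeffs (⊖ a) {z} h = trans (-‿cong (ev-coeffs a h))
      (trans (solve 1 (λ x → :- x := con (ℤ.- 1ℤ) :* x) ≡.refl _) (trans (∑-*ˡ N _ _)
      (∑-cong N (λ i _ → trans (sym (*-assoc _ _ _))
        (*-congʳ (trans (sym (ι-* (ℤ.- 1ℤ) (coeffs N a i))) (reflexive (≡.cong ι (ℤ.-1*i≡-i (coeffs N a i))))))))))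
      where import Data.Integer.Properties as ℤ
    ev-coeffs (a ⊗ b) {z} h = begin
      ev z a * ev z b                                     ≈⟨ *-cong (ev-coeffs a h) (ev-coeffs b h) ⟩
      F N A z * F N B z                                   ≈⟨ ∑-*-∑ N N _ _ ⟩
      ∑ N (λ i → ∑ N (λ j → (ι (A i) * z ^ i) * (ι (B j) * z ^ j)))
        ≈⟨ ∑-cong N (λ i _ → ∑-cong N (λ j _ → term i j)) ⟩
      ∑ N (λ i → ∑ N (λ j → ∑ N (λ k → ι (T k i j) * z ^ k)))
        ≈⟨ ∑-cong N (λ i _ → ∑-swap N N _) ⟩
      ∑ N (λ i → ∑ N (λ k → ∑ N (λ j → ι (T k i j) * z ^ k)))
        ≈⟨ ∑-swap N N _ ⟩
      ∑ N (λ k → ∑ N (λ i → ∑ N (λ j → ι (T k i j) * z ^ k)))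
        ≈⟨ ∑-cong N (λ k _ → trans (∑-cong N (λ i _ → trans (sym (∑-*ʳ N _ _)) (*-congʳ (sym (ι-∑ N (T k i))))))
          (trans (sym (∑-*ʳ N _ _)) (*-congʳ (sym (ι-∑ N (λ i → sumℤ N (T k i))))))) ⟩
      ∑ N (λ k → ι (sumℤ N (λ i → sumℤ N (T k i))) * z ^ k) ∎
      where
      A = coeffs N a
      B = coeffs N b
      T : ℕ → ℕ → ℕ → ℤ
      T k i j = χℤ (k ℕ.≟ (i ℕ.+ j) % N) ℤ.* (A i ℤ.* B j)
      term : ∀ i j → (ι (A i) * z ^ i) * (ι (B j) * z ^ j) ≈ ∑ N (λ k → ι (T k i j) * z ^ k)
      term i j = sym (begin
        ∑ N (λ k → ι (T k i j) * z ^ k)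
          ≈⟨ ∑-cong N (λ k _ → trans (*-congʳ
            (trans (ι-* (χℤ (k ℕ.≟ (i ℕ.+ j) % N)) _) (*-cong (ι-χℤ (k ℕ.≟ (i ℕ.+ j) % N)) (ι-* (A i) (B j)))))
            (*-assoc _ _ _)) ⟩
        ∑ N (λ k → χ (k ℕ.≟ (i ℕ.+ j) % N) * ((ι (A i) * ι (B j)) * z ^ k))
          ≈⟨ ∑-χ N ((i ℕ.+ j) % N) _ (m%n<n (i ℕ.+ j) N) ⟩
        (ι (A i) * ι (B j)) * z ^ ((i ℕ.+ j) % N)  ≈⟨ *-congˡ (trans (^-% h (i ℕ.+ j)) (^-homo-* z i j)) ⟩
        (ι (A i) * ι (B j)) * (z ^ i * z ^ j)
          ≈⟨ solve 4 (λ a b c d → (a :* b) :* (c :* d) := (a :* c) :* (b :* d)) ≡.refl (ι (A i)) (ι (B j)) (z ^ i)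
          (z ^ j) ⟩
        (ι (A i) * z ^ i) * (ι (B j) * z ^ j)      ∎)

-- Integral relations at roots of unity

module RootRelations (R : CommutativeRing 0ℓ 0ℓ) where

  open import Data.Integer.Base using (+_)
  open CommutativeRing R

  open IntegerPolynomials
  open RingSums R
  open Evaluation R
  open Arithmetic
  open import Data.Nat.Primality using (prime⇒irreducible)
  import Data.Nat.Divisibility as ℕ
  open IntegerBézout
  open import Data.Integer.Divisibility.Signed as ℤ∣ using (divides) renaming (_∣_ to _∣ℤ_)
  open import Data.Product.Base using () renaming (_×_ to _∧_)
  open import Algebra.Properties.Semiring.Exp semiring using (_^_)
  open import Relation.Binary.Reasoning.Setoid setoid

  -- Elimination for a system of relations whose matrix is the identity modulo r: the last unknown
  -- is eliminated without division, which keeps the matrix congruent to the identity.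
  eliminate : ∀ r n (M : ℕ → ℕ → ℤ) (e : ℕ → Carrier) →
              (∀ i j → i ℕ.< suc n → j ℕ.< suc n → r ∣ℤ M i j ℤ.- χℤ (i ℕ.≟ j)) →
              (∀ i → i ℕ.< suc n → ∑ (suc n) (λ j → ι (M i j) * e j) ≈ 0#) →
              ∃[ d ] (r ∣ℤ d ℤ.- 1ℤ ∧ ι d * e 0 ≈ 0#)
  eliminate r zero M e M≡1 rel = M 0 0 , M≡1 0 0 (s≤s z≤n) (s≤s z≤n) , trans (sym (+-identityˡ _)) (rel 0 (s≤s z≤n))
  eliminate r (suc n) M e M≡1 rel = eliminate r n M′ e M′≡1 rel′
    where
    l = suc n
    M′ : ℕ → ℕ → ℤ
    M′ i j = M l l ℤ.* M i j ℤ.- M i l ℤ.* M l j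
    δ≡1 : ∀ i → χℤ (i ℕ.≟ i) ≡ 1ℤ
    δ≡1 i with i ℕ.≟ i
    ... | yes _ = ≡.refl
    ... | no i≢i = contradiction ≡.refl i≢i
    δ≡0 : ∀ i j → i ≢ j → χℤ (i ℕ.≟ j) ≡ 0ℤ
    δ≡0 i j i≢j with i ℕ.≟ j
    ... | yes i≡j = contradiction i≡j i≢j
    ... | no _ = ≡.refl
    M′≡1 : ∀ i j → i ℕ.< l → j ℕ.< l → r ∣ℤ M′ i j ℤ.- χℤ (i ℕ.≟ j)
    M′≡1 i j i< j< = ≡.subst (r ∣ℤ_)
      (ℤSums.solve 5 (λ a b x y d → (((a :- con 1ℤ) :* b :+ (b :- d)) :- (x :- con 0ℤ) :* y) :=
      ((a :* b :- x :* y) :- d)) ≡.refl (M l l) (M i j) (M i l) (M l j) (χℤ (i ℕ.≟ j)))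
      (ℤ∣.∣m∣n⇒∣m-n (ℤ∣.∣m∣n⇒∣m+n (ℤ∣.∣m⇒∣m*n (M i j)
        (≡.subst (λ δ → r ∣ℤ M l l ℤ.- δ) (δ≡1 l) (M≡1 l l ℕ.≤-refl ℕ.≤-refl)))
        (M≡1 i j (ℕ.m<n⇒m<1+n i<) (ℕ.m<n⇒m<1+n j<)))
        (ℤ∣.∣m⇒∣m*n (M l j) (≡.subst (λ δ → r ∣ℤ M i l ℤ.- δ) (δ≡0 i l (ℕ.<⇒≢ i<))
          (M≡1 i l (ℕ.m<n⇒m<1+n i<) ℕ.≤-refl))))
    rel′ : ∀ i → i ℕ.< l → ∑ l (λ j → ι (M′ i j) * e j) ≈ 0#
    rel′ i i< = begin
      ∑ l (λ j → ι (M′ i j) * e j)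
        ≈⟨ ∑-cong l (λ j _ → trans (*-congʳ (ι-M′ j))
          (solve 5 (λ a b x y z → (a :* b :+ (:- x) :* y) :* z := a :* (b :* z) :+ (:- x) :* (y :* z)) ≡.refl
          (ι (M l l)) (ι (M i j)) (ι (M i l)) (ι (M l j)) (e j))) ⟩
      ∑ l (λ j → ι (M l l) * (ι (M i j) * e j) + (- ι (M i l)) * (ι (M l j) * e j)) ≈⟨ ∑-+ l _ _ ⟩
      ∑ l (λ j → ι (M l l) * (ι (M i j) * e j)) + ∑ l (λ j → (- ι (M i l)) * (ι (M l j) * e j))
        ≈⟨ +-cong (∑-*ˡ l _ _) (∑-*ˡ l _ _) ⟨
      ι (M l l) * Si + (- ι (M i l)) * Sl
        ≈⟨ solve 6 (λ a s x t b c → a :* s :+ (:- x) :* t := a :* (s :+ x :* b) :+ (:- x) :* (t :+ a :* b)) ≡.refl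
          (ι (M l l)) Si (ι (M i l)) Sl (e l) 0# ⟩
      ι (M l l) * (Si + ι (M i l) * e l) + (- ι (M i l)) * (Sl + ι (M l l) * e l)
        ≈⟨ +-cong (trans (*-congˡ (rel i (ℕ.m<n⇒m<1+n i<))) (zeroʳ _)) (trans (*-congˡ (rel l ℕ.≤-refl)) (zeroʳ _)) ⟩
      0# + 0# ≈⟨ +-identityʳ 0# ⟩
      0# ∎
      where
      Si = ∑ l (λ j → ι (M i j) * e j)
      Sl = ∑ l (λ j → ι (M l j) * e j)
      ι-M′ : ∀ j → ι (M′ i j) ≈ ι (M l l) * ι (M i j) + (- ι (M i l)) * ι (M l j)
      ι-M′ j = trans (ι-+ (M l l ℤ.* M i j) (ℤ.- (M i l ℤ.* M l j))) (+-cong (ι-* (M l l) (M i j))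
        (trans (ι-neg (M i l ℤ.* M l j))
          (trans (-‿cong (ι-* (M i l) (M l j)))
          (solve 2 (λ x y → :- (x :* y) := (:- x) :* y) ≡.refl (ι (M i l)) (ι (M l j))))))

  -- Dividing by the lowest power of α that occurs leaves a constant c₀ that is the same for all α.
  strip : (∀ a b → a * b ≈ 0# → a ≈ 0# ⊎ b ≈ 0#) → ∀ n (c : ℕ → ℤ) → ∃[ i ] (i ℕ.< n ∧ c i ≢ 0ℤ) →
          ∃[ c₀ ] (c₀ ≢ 0ℤ ∧ (∃[ h ] (∀ α → ∑ n (λ i → ι (c i) * α ^ i) ≈ 0# → α ≈ 0# ⊎ ι c₀ ≈ α * ev α h)))
  strip domain (suc n) c (i , i<n , ci≢0) = by-head (c 0 ℤ.≟ 0ℤ) i i<n ci≢0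
    where
    S : Carrier → Carrier
    S α = ∑ n (λ i → ι (c (suc i)) * α ^ i)
    split : ∀ α → ∑ (suc n) (λ i → ι (c i) * α ^ i) ≈ ι (c 0) + α * S α
    split α = trans (∑-head n (λ i → ι (c i) * α ^ i)) (+-cong (*-identityʳ _)
      (trans (∑-cong n (λ i _ → solve 3 (λ a x p → a :* (x :* p) := x :* (a :* p)) ≡.refl (ι (c (suc i))) α (α ^ i)))
        (sym (∑-*ˡ n α _))))
    by-head : Dec (c 0 ≡ 0ℤ) → ∀ i → i ℕ.< suc n → c i ≢ 0ℤ → _
    by-head (no c0≢0) _ _ _ = c 0 , c0≢0 , ⊖ fromCoeffs n (c ∘ suc) , λ α eq → inj₂ (begin
      ι (c 0)                     ≈⟨ solve 3 (λ a x s → a := (a :+ x :* s) :+ x :* (:- s)) ≡.refl (ι (c 0)) α (S α) ⟩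
      (ι (c 0) + α * S α) + α * (- S α)
        ≈⟨ +-cong (trans (sym (split α)) eq) (*-congˡ (-‿cong (sym (ev-fromCoeffs α n (c ∘ suc))))) ⟩
      0# + α * (- ev α (fromCoeffs n (c ∘ suc))) ≈⟨ +-identityˡ _ ⟩
      α * (- ev α (fromCoeffs n (c ∘ suc))) ∎)
    by-head (yes c0≡0) zero _ c0≢0 = contradiction c0≡0 c0≢0
    by-head (yes c0≡0) (suc i) i<n ci≢0 = c₀ , c₀≢0 , h , tail
      where
      ih = strip domain n (c ∘ suc) (i , ℕ.≤-pred i<n , ci≢0)
      c₀ = proj₁ ih
      c₀≢0 = proj₁ (proj₂ ih)
      h = proj₁ (proj₂ (proj₂ ih))
      tail : ∀ α → ∑ (suc n) (λ i → ι (c i) * α ^ i) ≈ 0# → α ≈ 0# ⊎ ι c₀ ≈ α * ev α h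
      tail α eq with domain α (S α) (trans
        (trans (sym (+-identityˡ _)) (trans (+-congʳ (reflexive (≡.cong ι (≡.sym c0≡0)))) (sym (split α)))) eq)
      ... | inj₁ α≈0 = inj₁ α≈0
      ... | inj₂ S≈0 = proj₂ (proj₂ (proj₂ ih)) α S≈0

  -- The N + 1 coefficient vectors of e^0, ..., e^N have length N and are dependent, which gives one
  -- integer relation for e(z) at all N-th roots of unity z at once. That c₀ is the same for all z
  -- lets the primes to be avoided be fixed before the root is moved.
  annihilator : (∀ a b → a * b ≈ 0# → a ≈ 0# ⊎ b ≈ 0#) → ∀ N .{{_ : NonZero N}} e →
                ∃[ c₀ ] (c₀ ≢ 0ℤ ∧ (∃[ h ] (∀ z → z ^ N ≈ 1# → ev z e ≈ 0# ⊎ ι c₀ ≈ ev z e * ev (ev z e) h)))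
  annihilator domain N e = proj₁ st , proj₁ (proj₂ st) , proj₁ (proj₂ (proj₂ st)) , λ z z^N≈1 →
    proj₂ (proj₂ (proj₂ st)) (ev z e) (relation z z^N≈1)
    where
    v : ℕ → ℕ → ℤ
    v i j = coeffs N (power e i) j
    dep = ℤSums.dependence N v
    c = proj₁ dep
    st = strip domain (suc N) c (proj₁ (proj₂ dep))
    relation : ∀ z → z ^ N ≈ 1# → ∑ (suc N) (λ i → ι (c i) * ev z e ^ i) ≈ 0#
    relation z h = begin
      ∑ (suc N) (λ i → ι (c i) * ev z e ^ i)
        ≈⟨ ∑-cong (suc N) (λ i _ → trans (*-congˡ (trans (sym (ev-power z e i)) (ev-coeffs (power e i) h)))
          (trans (∑-*ˡ N _ _) (∑-cong N (λ j _ → trans (sym (*-assoc _ _ _)) (*-congʳ (sym (ι-* (c i) (v i j)))))))) ⟩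
      ∑ (suc N) (λ i → ∑ N (λ j → ι (c i ℤ.* v i j) * z ^ j)) ≈⟨ ∑-swap (suc N) N _ ⟩
      ∑ N (λ j → ∑ (suc N) (λ i → ι (c i ℤ.* v i j) * z ^ j))
        ≈⟨ ∑-zero N (λ j j<N → trans (sym (∑-*ʳ (suc N) _ _))
          (trans (*-congʳ (trans (sym (ι-∑ (suc N) _))
          (reflexive (≡.cong ι (≡.trans (ℤSums.sumℤ≡∑ (suc N) _) (proj₂ (proj₂ dep) j j<N)))))) (zeroˡ _))) ⟩
      0# ∎

  module _ (domain : ∀ a b → a * b ≈ 0# → a ≈ 0# ⊎ b ≈ 0#) (char0 : ∀ c → ι c ≈ 0# → c ≡ 0ℤ) where

    -- If 1 = r g(z), then expressing g(z) z^i through 1, z, ..., z^(N-1) gives a matrix 1 - r b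
    -- that kills the vector of these powers. Elimination yields an integer d ≡ 1 modulo r with d
    -- z^0 = 0; so d = 0, and r divides 1.
    prime-nonunit : ∀ {N r} .{{_ : NonZero N}} → Prime r → ∀ {z} → z ^ N ≈ 1# → ∀ g → ¬ (1# ≈ ι (+ r) * ev z g)
    prime-nonunit {suc n} {r} pr {z} h g eq = ℕ.>⇒∤ 1<r (ℤ∣.∣⇒∣ᵤ r∣1)
      where
      1<r = ℕ.nonTrivial⇒n>1 r {{prime⇒nonTrivial pr}}
      N = suc n
      b : ℕ → ℕ → ℤ
      b i = coeffs N (g ⊗ power X i)
      M : ℕ → ℕ → ℤ
      M i j = χℤ (i ℕ.≟ j) ℤ.- + r ℤ.* b i j
      M≡1 : ∀ i j → i ℕ.< N → j ℕ.< N → + r ∣ℤ M i j ℤ.- χℤ (i ℕ.≟ j)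
      M≡1 i j _ _ = divides (ℤ.- b i j)
        (ℤSums.solve 3 (λ d r b → (d :- r :* b) :- d := (:- b) :* r) ≡.refl (χℤ (i ℕ.≟ j)) (+ r) (b i j))
      δ-comm : ∀ i j → χ (i ℕ.≟ j) ≈ χ (j ℕ.≟ i)
      δ-comm i j with i ℕ.≟ j
      ... | yes i≡j = sym (χ-yes (j ℕ.≟ i) (≡.sym i≡j))
      ... | no i≢j = sym (χ-no (j ℕ.≟ i) (i≢j ∘ ≡.sym))
      rel : ∀ i → i ℕ.< N → ∑ N (λ j → ι (M i j) * z ^ j) ≈ 0#
      rel i i<N = begin
        ∑ N (λ j → ι (M i j) * z ^ j)
          ≈⟨ ∑-cong N (λ j _ → trans (*-congʳ (ι-M j))
          (solve 4 (λ d r b z → (d :+ (:- r) :* b) :* z := d :* z :+ (:- r) :* (b :* z)) ≡.refl (χ (j ℕ.≟ i)) (ι (+ r))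
          (ι (b i j)) (z ^ j))) ⟩
        ∑ N (λ j → χ (j ℕ.≟ i) * z ^ j + (- ι (+ r)) * (ι (b i j) * z ^ j)) ≈⟨ ∑-+ N _ _ ⟩
        ∑ N (λ j → χ (j ℕ.≟ i) * z ^ j) + ∑ N (λ j → (- ι (+ r)) * (ι (b i j) * z ^ j))
          ≈⟨ +-cong (∑-χ N i (z ^_) i<N) (sym (∑-*ˡ N _ _)) ⟩
        z ^ i + (- ι (+ r)) * F N (b i) z
          ≈⟨ +-congˡ (*-congˡ (trans (sym (ev-coeffs (g ⊗ power X i) h)) (*-congˡ (ev-power z X i)))) ⟩
        z ^ i + (- ι (+ r)) * (ev z g * z ^ i)
          ≈⟨ solve 3 (λ p r g → p :+ (:- r) :* (g :* p) := p :- (r :* g) :* p) ≡.refl (z ^ i) (ι (+ r)) (ev z g) ⟩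
        z ^ i - (ι (+ r) * ev z g) * z ^ i ≈⟨ ≈⇒-≈0 (trans (sym (*-identityˡ _)) (*-congʳ eq)) ⟩
        0# ∎
        where
        ι-M : ∀ j → ι (M i j) ≈ χ (j ℕ.≟ i) + (- ι (+ r)) * ι (b i j)
        ι-M j = trans (ι-+ (χℤ (i ℕ.≟ j)) _) (+-cong (trans (ι-χℤ (i ℕ.≟ j)) (δ-comm i j))
          (trans (ι-neg (+ r ℤ.* b i j)) (trans (-‿cong (ι-* (+ r) (b i j)))
            (solve 2 (λ x y → :- (x :* y) := (:- x) :* y) ≡.refl (ι (+ r)) (ι (b i j))))))
      el = eliminate (+ r) n M (z ^_) M≡1 rel
      d≡0 : proj₁ el ≡ 0ℤ
      d≡0 = char0 (proj₁ el) (trans (sym (*-identityʳ _)) (proj₂ (proj₂ el)))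
      r∣1 : + r ∣ℤ ℤ.- 1ℤ
      r∣1 = ≡.subst (λ d → + r ∣ℤ d ℤ.- 1ℤ) d≡0 (proj₁ (proj₂ el))

    -- If r did not divide c, Bézout's identity would turn the relation into an inverse of r in
    -- ℤ[z].
    prime-divides : ∀ {N r} .{{_ : NonZero N}} → Prime r → ∀ {z} → z ^ N ≈ 1# → ∀ g c → ι c ≈ ι (+ r) * ev z g →
      r ℕ.∣ ℤ.∣ c ∣
    prime-divides {N} {r} pr {z} h g c eq with r ℕ.∣? ℤ.∣ c ∣
    ... | yes r∣c = r∣c
    ... | no r∤c = contradiction
        (1≈ (proj₁ bezout) (proj₁ (proj₂ bezout)) (proj₂ (proj₂ bezout)))
        (prime-nonunit pr h (constant (proj₁ bezout) ⊗ g ⊕ constant (proj₁ (proj₂ bezout))))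
      where
      coprime : Coprime r ℤ.∣ c ∣
      coprime {d} (d∣r , d∣c) with prime⇒irreducible pr d∣r
      ... | inj₁ d≡1 = d≡1
      ... | inj₂ ≡.refl = contradiction d∣c r∤c
      abs : ∃[ s ] (+ ℤ.∣ c ∣ ≡ s ℤ.* c)
      abs = ℤ∣._∣_.quotient (ℤ∣.m∣∣m∣ {c}) , ℤ∣._∣_.equality (ℤ∣.m∣∣m∣ {c})
      bezout : ∃[ a ] ∃[ b ] (1ℤ ≡ a ℤ.* c ℤ.+ b ℤ.* + r)
      bezout = y ℤ.* proj₁ abs , x , ≡.trans (proj₂ (proj₂ xy))
        (≡.trans (≡.cong (λ t → x ℤ.* + r ℤ.+ y ℤ.* t) (proj₂ abs))
        (ℤSums.solve 5 (λ x r y s c → x :* r :+ y :* (s :* c) := y :* s :* c :+ x :* r) ≡.refl x (+ r) y (proj₁ abs) c))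
        where
        xy = bezoutℤ coprime
        x = proj₁ xy
        y = proj₁ (proj₂ xy)
      1≈ : ∀ a b → 1ℤ ≡ a ℤ.* c ℤ.+ b ℤ.* + r → 1# ≈ ι (+ r) * ev z (constant a ⊗ g ⊕ constant b)
      1≈ a b ab = begin
        1#                              ≈⟨ ι-1 ⟨
        ι 1ℤ                            ≡⟨ ≡.cong ι ab ⟩
        ι (a ℤ.* c ℤ.+ b ℤ.* + r)       ≈⟨ trans (ι-+ (a ℤ.* c) _) (+-cong (ι-* a c) (ι-* b (+ r))) ⟩
        ι a * ι c + ι b * ι (+ r)       ≈⟨ +-congʳ (*-congˡ eq) ⟩
        ι a * (ι (+ r) * ev z g) + ι b * ι (+ r)
          ≈⟨ solve 4 (λ a r g b → a :* (r :* g) :+ b :* r := r :* (a :* g :+ b)) ≡.refl (ι a) (ι (+ r)) (ev z g) (ι b) ⟩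
        ι (+ r) * (ι a * ev z g + ι b)  ≈⟨ *-congˡ (+-cong (*-congʳ (ev-constant z a)) (ev-constant z b)) ⟨
        ι (+ r) * ev z (constant a ⊗ g ⊕ constant b) ∎

-- Galois conjugation of relations

module Conjugation (R : CommutativeRing 0ℓ 0ℓ) where

  open import Data.Integer.Base using (+_; -[1+_])
  open CommutativeRing R
  open IntegerPolynomials
  open RingSums R
  open Evaluation R
  open RootRelations R
  open Arithmetic
  import Data.Nat.Divisibility as ℕ
  open import Data.Nat.Primality.Factorisation using (factorise; PrimeFactorisation)
  open import Data.List.Base using ([]; _∷_)
  open import Data.List.Relation.Unary.All using (All; []; _∷_)
  open import Data.Nat.ListAction using (product)
  open import Algebra.Properties.Semiring.Exp semiring using (_^_; ^-congˡ; ^-congʳ; ^-homo-*; ^-assocʳ)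
  open import Algebra.Properties.Semiring.Mult semiring using (_×_)
  open import Relation.Binary.Reasoning.Setoid setoid

  module AtRoot (z : Carrier) where
    private
      module P = CommutativeRing (polyRing z)
    open RingSums (polyRing z) using () renaming (ι to ιᴾ; *-^ to *ᴾ-^; 1^ to 1^ᴾ) public
    open RingCongruences (polyRing z) using () renaming (_≋_[_] to _≋ᴾ_[_]; ≋-+ to ≋ᴾ-+; ≋-* to ≋ᴾ-*; ≋-cong to ≋ᴾ-cong; ≋-refl to ≋ᴾ-refl; ≋-trans to ≋ᴾ-trans; -‿≋ to -‿≋ᴾ) public
    open import Algebra.Properties.Semiring.Exp P.semiring using () renaming (_^_ to _^ᴾ_; ^-congˡ to ^ᴾ-congˡ) public
    open import Algebra.Properties.Semiring.Mult P.semiring using () renaming (_×_ to _×ᴾ_)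

    ev-^ : ∀ e n → ev z (e ^ᴾ n) ≈ ev z e ^ n
    ev-^ e zero = refl
    ev-^ e (suc n) = *-congˡ (ev-^ e n)

    ev-ιℕ : ∀ n → ev z (n ×ᴾ 𝟙) ≈ n × 1#
    ev-ιℕ zero = refl
    ev-ιℕ (suc n) = +-congˡ (ev-ιℕ n)

    ev-ι : ∀ c → ev z (ιᴾ c) ≈ ι c
    ev-ι (+ n) = ev-ιℕ n
    ev-ι -[1+ n ] = -‿cong (ev-ιℕ (suc n))

    -- Taking r-th powers commutes with all ring operations modulo r, so only the variable matters.
    -- The implicit arguments are spelled out because equality in `polyRing z` unfolds to equality
    -- of values, which does not determine the expressions.
    frobenius : ∀ {r} → Prime r → ∀ e → (e ^ᴾ r) ≋ᴾ e [ power X r ] [ ιᴾ (+ r) ]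
    frobenius {r} pr 𝟘 = ≋ᴾ-cong {𝟘} {𝟘} {𝟘 ^ᴾ r} {𝟘} {ιᴾ (+ r)}
      (P.sym {𝟘 ^ᴾ r} {𝟘} (RingCongruences.0^prime (polyRing z) pr)) (P.refl {𝟘}) (≋ᴾ-refl {𝟘} {ιᴾ (+ r)})
    frobenius {r} pr 𝟙 = ≋ᴾ-cong {𝟙} {𝟙} {𝟙 ^ᴾ r} {𝟙} {ιᴾ (+ r)} (P.sym {𝟙 ^ᴾ r} {𝟙} (1^ᴾ r)) (P.refl {𝟙})
      (≋ᴾ-refl {𝟙} {ιᴾ (+ r)})
    frobenius {r} pr X = ≋ᴾ-cong {X ^ᴾ r} {X ^ᴾ r} {X ^ᴾ r} {power X r} {ιᴾ (+ r)} (P.refl {X ^ᴾ r})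
      (trans (ev-^ X r) (sym (ev-power z X r))) (≋ᴾ-refl {X ^ᴾ r} {ιᴾ (+ r)})
    frobenius {r} pr (a ⊕ b) = ≋ᴾ-trans {(a ⊕ b) ^ᴾ r} {(a ^ᴾ r) ⊕ (b ^ᴾ r)} {(a ⊕ b) [ power X r ]} {ιᴾ (+ r)}
      (RingCongruences.^-+-mod (polyRing z) pr a b)
      (≋ᴾ-+ {a ^ᴾ r} {a [ power X r ]} {b ^ᴾ r} {b [ power X r ]} {ιᴾ (+ r)} (frobenius pr a) (frobenius pr b))
    frobenius {r} pr (a ⊗ b) = ≋ᴾ-cong {(a ^ᴾ r) ⊗ (b ^ᴾ r)} {(a ⊗ b) [ power X r ]} {(a ⊗ b) ^ᴾ r}
      {(a ⊗ b) [ power X r ]} {ιᴾ (+ r)}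
      (P.sym {(a ⊗ b) ^ᴾ r} {(a ^ᴾ r) ⊗ (b ^ᴾ r)} (*ᴾ-^ a b r)) (P.refl {(a ⊗ b) [ power X r ]})
      (≋ᴾ-* {a ^ᴾ r} {a [ power X r ]} {b ^ᴾ r} {b [ power X r ]} {ιᴾ (+ r)} (frobenius pr a) (frobenius pr b))
    frobenius {r} pr (⊖ a) = ≋ᴾ-trans {(⊖ a) ^ᴾ r} {⊖ (a ^ᴾ r)} {(⊖ a) [ power X r ]} {ιᴾ (+ r)}
      (RingCongruences.^-neg-mod (polyRing z) pr a) (-‿≋ᴾ {a ^ᴾ r} {a [ power X r ]} {ιᴾ (+ r)} (frobenius pr a))

    frobenius-ev : ∀ {r} → Prime r → ∀ e → ∃[ g ] ev z e ^ r ≈ ev (z ^ r) e + ι (+ r) * ev z g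
    frobenius-ev {r} pr e = g , trans (sym (ev-^ e r)) (trans (proj₂ (frobenius pr e))
      (+-cong (trans (ev-[] z e (power X r)) (ev-cong e (ev-power z X r))) (*-congʳ (ev-ι (+ r)))))
      where g = proj₁ (frobenius pr e)

  module Galois (domain : ∀ a b → a * b ≈ 0# → a ≈ 0# ⊎ b ≈ 0#) (char0 : ∀ c → ι c ≈ 0# → c ≡ 0ℤ)
                (N : ℕ) .{{_ : NonZero N}} where

    root-^ : ∀ {z} → z ^ N ≈ 1# → ∀ k → (z ^ k) ^ N ≈ 1#
    root-^ {z} h k = trans (^-assocʳ z k N) (^-*N h k)

    module _ (e : Poly) where
      private
        ann = annihilator domain N e
        c₀ = proj₁ ann
        h = proj₁ (proj₂ (proj₂ ann))
        dichotomy = proj₂ (proj₂ (proj₂ ann))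

      -- As e(z) = 0, the value e(z^r) is r times an element of ℤ[z]. If it were not 0, it would
      -- divide c₀ with quotient in ℤ[z], and then r would divide the integer c₀.
      galois-prime : ∀ {r} → Prime r → ¬ (r ℕ.∣ ℤ.∣ c₀ ∣) → ∀ z → z ^ N ≈ 1# → ev z e ≈ 0# → ev (z ^ r) e ≈ 0#
      galois-prime {r} pr r∤c₀ z zN≈1 ez≈0 = cases (dichotomy (z ^ r) (root-^ zN≈1 r))
        where
        g = proj₁ (AtRoot.frobenius-ev z pr e)
        α = ev (z ^ r) e
        α≈ : α ≈ ι (+ r) * ev z (⊖ g)
        α≈ = begin
          α ≈⟨ solve 3 (λ a r g → a := (a :+ r :* g) :+ r :* (:- g)) ≡.refl α (ι (+ r)) (ev z g) ⟩
          (α + ι (+ r) * ev z g) + ι (+ r) * (- ev z g)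
            ≈⟨ +-congʳ (trans (sym (proj₂ (AtRoot.frobenius-ev z pr e)))
            (trans (^-congˡ r ez≈0) (RingCongruences.0^prime R pr))) ⟩
          0# + ι (+ r) * (- ev z g) ≈⟨ +-identityˡ _ ⟩
          ι (+ r) * ev z (⊖ g) ∎
        G = ⊖ g ⊗ h [ e [ power X r ] ]
        cases : α ≈ 0# ⊎ ι c₀ ≈ α * ev α h → α ≈ 0#
        cases (inj₁ α≈0) = α≈0
        cases (inj₂ eq) = contradiction (prime-divides domain char0 pr zN≈1 G c₀ (begin
          ι c₀                                       ≈⟨ eq ⟩
          α * ev α h
            ≈⟨ *-cong α≈ (ev-cong h (sym (trans (ev-[] z e (power X r)) (ev-cong e (ev-power z X r))))) ⟩
          (ι (+ r) * ev z (⊖ g)) * ev (ev z (e [ power X r ])) h ≈⟨ *-congˡ (sym (ev-[] z h (e [ power X r ]))) ⟩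
          (ι (+ r) * ev z (⊖ g)) * ev z (h [ e [ power X r ] ])  ≈⟨ *-assoc _ _ _ ⟩
          ι (+ r) * ev z G                           ∎)) r∤c₀

      galois-list : ∀ rs → All Prime rs → (∀ {r} → Prime r → r ℕ.∣ product rs → ¬ (r ℕ.∣ ℤ.∣ c₀ ∣)) →
                    ∀ z → z ^ N ≈ 1# → ev z e ≈ 0# → ev (z ^ product rs) e ≈ 0#
      galois-list [] [] av z zN≈1 ez≈0 = trans (ev-cong e (*-identityʳ z)) ez≈0
      galois-list (r ∷ rs) (pr ∷ prs) av z zN≈1 ez≈0 = trans (ev-cong e (sym (^-assocʳ z r (product rs))))
        (galois-list rs prs (λ pr′ r′∣ → av pr′ (ℕ.∣n⇒∣m*n r r′∣)) (z ^ r) (root-^ zN≈1 r)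
          (galois-prime pr (av pr (ℕ.m∣m*n (product rs))) z zN≈1 ez≈0))

      galois : ∀ u → Coprime u N → ∀ {z} → z ^ N ≈ 1# → ev z e ≈ 0# → ev (z ^ u) e ≈ 0#
      galois u coprime {z} zN≈1 ez≈0 = trans (ev-cong e (sym z^u′≈z^u))
        (trans (ev-cong e (^-congʳ z (PrimeFactorisation.isFactorisation fac)))
          (galois-list (PrimeFactorisation.factors fac) (PrimeFactorisation.factorsPrime fac)
            (λ pr r∣ → proj₂ (proj₂ av) pr (≡.subst (_ ℕ.∣_) (≡.sym (PrimeFactorisation.isFactorisation fac)) r∣)) z
              zN≈1 ez≈0))
        where
        -- The integer c₀ belongs to e and N, so it stays the same while the root is moved by one
        -- prime factor after another.
        av = avoid-primes u N ℤ.∣ c₀ ∣ coprime (λ eq → proj₁ (proj₂ ann) (ℤ.∣i∣≡0⇒i≡0 eq))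
          where import Data.Integer.Properties as ℤ
        b = proj₁ av
        u′ = u ℕ.+ b ℕ.* N
        fac = factorise u′ {{proj₁ (proj₂ av)}}
        z^u′≈z^u : z ^ u′ ≈ z ^ u
        z^u′≈z^u = trans (^-homo-* z u (b ℕ.* N)) (trans (*-congˡ (^-*N zN≈1 b)) (*-identityʳ _))

-- Relations between N-th roots of unity for N with two prime factors

module Cyclotomic where

  open import Data.Nat.Divisibility using () renaming (_∣_ to _∣ℕ_)
  open import Data.Integer.Base using (+_; -[1+_])
  open import Data.Product.Base using () renaming (_×_ to _∧_)
  open IntegerPolynomials
  import Algebra.Bundles
  import Algebra.Definitions.RawSemiring as RS
  -- Primitivity in the form `order` passes easily from ζ to ζ^u with u prime to N. This freedom of
  -- choice lets every result below be applied at the root where the duality identity is evaluated.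
  record Root (N : ℕ) : Set₁ where
    field
      R : CommutativeRing 0ℓ 0ℓ
    open CommutativeRing R
    open RingSums R using (ι)
    open RS (Algebra.Bundles.Semiring.rawSemiring semiring) using (_^_)
    field
      domain : ∀ a b → a * b ≈ 0# → a ≈ 0# ⊎ b ≈ 0#
      char0 : ∀ c → ι c ≈ 0# → c ≡ 0ℤ
      ζ : Carrier
      ζ^N≈1 : ζ ^ N ≈ 1#
      order : ∀ k → ζ ^ k ≈ 1# → N ∣ℕ k

  module Relations {N : ℕ} {{_ : NonZero N}} (M : Root N)
    {p q : ℕ} (pp : Prime p) (pq : Prime q) (p≢q : p ≢ q)
    (N′ : ℕ) (N≡ : N ≡ N′ ℕ.* (p ℕ.* q)) (primes : ∀ {r} → Prime r → r ∣ℕ N → r ≡ p ⊎ r ≡ q) where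

    open Root M public
    open CommutativeRing R public
    open RingSums R public
    open Evaluation R public
    open Arithmetic
    open import Data.Nat.DivMod using (_%_; m%n<n; m≡m%n+[m/n]*n; _/_; %-distribˡ-+)
    open import Data.Nat.Divisibility using (divides; _∣?_; ∣m+n∣m⇒∣n; ∣m∣n⇒∣m+n; ∣-refl; n∣m*n; >⇒∤; _∣0; m∣m*n; *-cancelˡ-∣; ∣-trans; *-pres-∣; m%n≡0⇒n∣m; n∣m⇒m%n≡0)
    open import Data.Nat.Primality using (euclidsLemma; prime⇒irreducible)
    open import Data.List.Base using (List; []; _∷_)
    open import Data.List.Relation.Unary.All using (All; []; _∷_)
    open import Data.List.Relation.Unary.AllPairs using ([]; _∷_)
    open import Data.List.Relation.Unary.Unique.Propositional using (Unique)
    open import Relation.Nullary using (¬?; _×-dec_)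
    open import Algebra.Properties.Semiring.Exp semiring using (_^_; ^-congˡ; ^-congʳ; ^-homo-*; ^-assocʳ)
    open import Relation.Binary.Reasoning.Setoid setoid
    module G = Conjugation.Galois R domain char0 N

    -- N/p and N/q, generators of the subgroups of order p and q.
    P₀ Q₀ : ℕ
    P₀ = N′ ℕ.* q
    Q₀ = N′ ℕ.* p

    ζ^-multiple : ∀ {k} → N ∣ℕ k → ζ ^ k ≈ 1#
    ζ^-multiple (divides l ≡.refl) = ^-*N ζ^N≈1 l

    root^ : ∀ k → (ζ ^ k) ^ N ≈ 1#
    root^ = G.root-^ ζ^N≈1

    N*≈0 : ∀ x → ι (+ N) * x ≈ 0# → x ≈ 0#
    N*≈0 x h with domain _ _ h
    ... | inj₁ N≈0 = contradiction (ℤ.+-injective (char0 (+ N) N≈0)) (ℕ.≢-nonZero⁻¹ N)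
    ... | inj₂ x≈0 = x≈0

    ∑-root : ∀ {w} → w ^ N ≈ 1# → ¬ (w ≈ 1#) → ∑ N (w ^_) ≈ 0#
    ∑-root {w} wN≈1 w≉1 with domain (w - 1#) (∑ N (w ^_)) (begin
        (w - 1#) * ∑ N (w ^_)
          ≈⟨ solve 3 (λ w o s → (w :- o) :* s := w :* s :- o :* s) ≡.refl w 1# (∑ N (w ^_)) ⟩
        w * ∑ N (w ^_) - 1# * ∑ N (w ^_)      ≈⟨ +-cong (∑-*ˡ N w _) (-‿cong (*-identityˡ _)) ⟩
        ∑ N (λ i → w ^ suc i) - ∑ N (w ^_)    ≈⟨ ≈⇒-≈0 (∑-rot N (w ^_) wN≈1) ⟩
        0#                                    ∎)
    ... | inj₁ h = contradiction (-≈0⇒≈ h) w≉1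
    ... | inj₂ h = h

    unit-cancel : ∀ {w} a x → w ^ N ≈ 1# → w ^ a * x ≈ 0# → x ≈ 0#
    unit-cancel {w} a x wN≈1 h = begin
      x                                ≈⟨ *-identityˡ x ⟨
      1# * x                           ≈⟨ *-congʳ (^-*N wN≈1 a) ⟨
      w ^ (a ℕ.* N) * x
        ≈⟨ *-congʳ (^-congʳ w (≡.trans (≡.cong (a ℕ.*_) (≡.sym (ℕ.suc-pred N)))
        (≡.trans (ℕ.*-suc a (ℕ.pred N)) (ℕ.+-comm a _)))) ⟩
      w ^ (a ℕ.* ℕ.pred N ℕ.+ a) * x   ≈⟨ trans (*-congʳ (^-homo-* w (a ℕ.* ℕ.pred N) a)) (*-assoc _ _ _) ⟩
      w ^ (a ℕ.* ℕ.pred N) * (w ^ a * x) ≈⟨ trans (*-congˡ h) (zeroʳ _) ⟩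
      0#                               ∎

    character-sum-diagonal : ∀ {i} → i ℕ.< N → ∑ N ((ζ ^ (i ℕ.+ (N ℕ.∸ i))) ^_) ≈ ι (+ N)
    character-sum-diagonal {i} i<N =
      trans (∑-cong N (λ k _ → trans (^-congˡ k (trans (^-congʳ ζ (ℕ.m+[n∸m]≡n (ℕ.<⇒≤ i<N))) ζ^N≈1)) (1^ k)))
      (trans (∑-const N 1#) (*-identityʳ _))

    character-sum-offdiagonal : ∀ {i j} → i ℕ.< N → j ℕ.< N → j ≢ i → ∑ N ((ζ ^ (j ℕ.+ (N ℕ.∸ i))) ^_) ≈ 0#
    character-sum-offdiagonal {i} {j} i<N j<N j≢i = ∑-root (root^ (j ℕ.+ (N ℕ.∸ i)))
      (λ h → N∤ (order (j ℕ.+ (N ℕ.∸ i)) h))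
      where
      N∤ : ¬ (N ∣ℕ j ℕ.+ (N ℕ.∸ i))
      N∤ (divides 0 eq) = contradiction (ℕ.m+n≡0⇒n≡0 j eq) (ℕ.m>n⇒m∸n≢0 i<N)
      N∤ (divides 1 eq) = j≢i (ℕ.+-cancelʳ-≡ (N ℕ.∸ i) j i
        (≡.trans eq (≡.trans (ℕ.*-identityˡ N) (≡.sym (ℕ.m+[n∸m]≡n (ℕ.<⇒≤ i<N))))))
      N∤ (divides (suc (suc l)) eq) = ℕ.<⇒≱ (ℕ.+-mono-<-≤ j<N (ℕ.m∸n≤m N i))
        (≡.subst (N ℕ.+ N ℕ.≤_) (≡.sym eq) (ℕ.+-monoʳ-≤ N (ℕ.m≤m+n N _)))

    fourier-inversion : ∀ (D : ℕ → ℤ) → (∀ k → k ℕ.< N → F N D (ζ ^ k) ≈ 0#) → ∀ i → i ℕ.< N → D i ≡ 0ℤ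
    fourier-inversion D h i i<N = char0 (D i) (N*≈0 (ι (D i)) (begin
      ι (+ N) * ι (D i)     ≈⟨ *-comm _ _ ⟩
      ι (D i) * ι (+ N)     ≈⟨ *-congˡ (character-sum-diagonal i<N) ⟨
      ι (D i) * S i
        ≈⟨ ∑-single N i (λ j → ι (D j) * S j) i<N (λ j j<N j≢i →
        trans (*-congˡ (character-sum-offdiagonal i<N j<N j≢i)) (zeroʳ _)) ⟨
      ∑ N (λ j → ι (D j) * S j) ≈⟨ ∑-cong N (λ j _ → trans (∑-*ˡ N _ _) (∑-cong N (λ k _ → term j k))) ⟩
      ∑ N (λ j → ∑ N (λ k → (ζ ^ k) ^ (N ℕ.∸ i) * (ι (D j) * (ζ ^ k) ^ j))) ≈⟨ ∑-swap N N _ ⟩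
      ∑ N (λ k → ∑ N (λ j → (ζ ^ k) ^ (N ℕ.∸ i) * (ι (D j) * (ζ ^ k) ^ j)))
        ≈⟨ ∑-zero N (λ k k<N → trans (sym (∑-*ˡ N _ _)) (trans (*-congˡ (h k k<N)) (zeroʳ _))) ⟩
      0# ∎))
      where
      e : ℕ → ℕ
      e j = j ℕ.+ (N ℕ.∸ i)
      S : ℕ → Carrier
      S j = ∑ N ((ζ ^ e j) ^_)
      term : ∀ j k → ι (D j) * (ζ ^ e j) ^ k ≈ (ζ ^ k) ^ (N ℕ.∸ i) * (ι (D j) * (ζ ^ k) ^ j)
      term j k = begin
        ι (D j) * (ζ ^ e j) ^ k
          ≈⟨ *-congˡ (trans (^-assocʳ ζ (e j) k) (trans (^-congʳ ζ (ℕ.*-comm (e j) k)) (sym (^-assocʳ ζ k (e j))))) ⟩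
        ι (D j) * (ζ ^ k) ^ e j     ≈⟨ *-congˡ (^-homo-* (ζ ^ k) j _) ⟩
        ι (D j) * ((ζ ^ k) ^ j * (ζ ^ k) ^ (N ℕ.∸ i))
          ≈⟨ solve 3 (λ d a b → d :* (a :* b) := b :* (d :* a)) ≡.refl (ι (D j)) ((ζ ^ k) ^ j) ((ζ ^ k) ^ (N ℕ.∸ i)) ⟩
        (ζ ^ k) ^ (N ℕ.∸ i) * (ι (D j) * (ζ ^ k) ^ j) ∎

    Periodic : (ℕ → ℤ) → Set
    Periodic f = ∀ i → f (N ℕ.+ i) ≡ f i

    shift : ℕ → (ℕ → ℤ) → ℕ → ℤ
    shift a f i = f (a ℕ.+ i)

    shift-periodic : ∀ a {f} → Periodic f → Periodic (shift a f)
    shift-periodic a {f} per i = ≡.trans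
      (≡.cong f (≡.trans (≡.sym (ℕ.+-assoc a N i)) (≡.trans (≡.cong (ℕ._+ i) (ℕ.+-comm a N)) (ℕ.+-assoc N a i))))
      (per (a ℕ.+ i))

    ^-periodic : ∀ {w} → w ^ N ≈ 1# → ∀ i → w ^ (N ℕ.+ i) ≈ w ^ i
    ^-periodic {w} h i = trans (^-homo-* w N i) (trans (*-congʳ h) (*-identityˡ _))

    F-shift : ∀ a {f} → Periodic f → ∀ {w} → w ^ N ≈ 1# → w ^ a * F N (shift a f) w ≈ F N f w
    F-shift a {f} per {w} h = begin
      w ^ a * F N (shift a f) w                      ≈⟨ ∑-*ˡ N _ _ ⟩
      ∑ N (λ i → w ^ a * (ι (f (a ℕ.+ i)) * w ^ i))
        ≈⟨ ∑-cong N (λ i _ → trans (solve 3 (λ a b c → a :* (b :* c) := b :* (a :* c)) ≡.refl (w ^ a) (ι (f (a ℕ.+ i)))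
        (w ^ i)) (*-congˡ (sym (^-homo-* w a i)))) ⟩
      ∑ N (λ i → ι (f (a ℕ.+ i)) * w ^ (a ℕ.+ i))
        ≈⟨ ∑-shift N (λ i → ι (f i) * w ^ i) (λ i → *-cong (reflexive (≡.cong ι (per i))) (^-periodic h i)) a ⟩
      F N f w                                        ∎

    F-+ : ∀ f g w → F N (λ i → f i ℤ.+ g i) w ≈ F N f w + F N g w
    F-+ f g w = trans (∑-cong N (λ i _ → trans (*-congʳ (ι-+ (f i) (g i))) (distribʳ _ _ _))) (∑-+ N _ _)

    F-* : ∀ c f w → F N (λ i → c ℤ.* f i) w ≈ ι c * F N f w
    F-* c f w = trans (∑-cong N (λ i _ → trans (*-congʳ (ι-* c (f i))) (*-assoc _ _ _))) (sym (∑-*ˡ N _ _))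

    F-neg : ∀ f w → F N (λ i → ℤ.- f i) w ≈ - F N f w
    F-neg f w = trans (∑-cong N (λ i _ → *-congʳ (reflexive (≡.cong ι (≡.sym (ℤ.-1*i≡-i (f i)))))))
      (trans (F-* (ℤ.- 1ℤ) f w) (trans (*-congʳ (-‿cong ι-1))
        (solve 2 (λ o x → (:- o) :* x := :- (o :* x)) ≡.refl 1# _ ⟨≈⟩ -‿cong (*-identityˡ _))))
      where _⟨≈⟩_ = trans

    F-− : ∀ f g w → F N (λ i → f i ℤ.- g i) w ≈ F N f w - F N g w
    F-− f g w = trans (F-+ f (λ i → ℤ.- g i) w) (+-congˡ (F-neg g w))

    -- The alternating sum over a rectangle with sides in the subgroups of order p and q.
    Δ : (ℕ → ℤ) → ℕ → ℤ
    Δ f x = (f x ℤ.- f (P₀ ℕ.+ x)) ℤ.- (f (Q₀ ℕ.+ x) ℤ.- f (P₀ ℕ.+ (Q₀ ℕ.+ x)))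

    -- Translating by a divides the transform by w^a, so Δ multiplies it by (1 - w^(-P₀)) (1 -
    -- w^(-Q₀)); the power of w on the left clears the inverses.
    F-Δ : ∀ {f} → Periodic f → ∀ {w} → w ^ N ≈ 1# → w ^ (Q₀ ℕ.+ P₀) * F N (Δ f) w ≈ F N f w *
      ((w ^ P₀ - 1#) * (w ^ Q₀ - 1#))
    F-Δ {f} per {w} h = begin
      w ^ (Q₀ ℕ.+ P₀) * F N (Δ f) w
        ≈⟨ *-cong (^-homo-* w Q₀ P₀) (trans
          (F-− (λ x → f x ℤ.- f (P₀ ℕ.+ x)) (λ x → f (Q₀ ℕ.+ x) ℤ.- f (P₀ ℕ.+ (Q₀ ℕ.+ x))) w)
          (+-cong (F-− f (shift P₀ f) w) (-‿cong (F-− (shift Q₀ f) (shift Q₀ (shift P₀ f)) w)))) ⟩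
      (w ^ Q₀ * w ^ P₀) * ((F N f w - F N (shift P₀ f) w) - (F N (shift Q₀ f) w - F N (shift Q₀ (shift P₀ f)) w))
        ≈⟨ solve 6 (λ x y a b c d → (y :* x) :* ((a :- b) :- (c :- d)) := (y :* x :* a :- y :* (x :* b)) :-
          (x :* (y :* c) :- x :* (y :* d))) ≡.refl (w ^ P₀) (w ^ Q₀) (F N f w) (F N (shift P₀ f) w) (F N (shift Q₀ f) w)
          (F N (shift Q₀ (shift P₀ f)) w) ⟩
      (w ^ Q₀ * w ^ P₀ * F N f w - w ^ Q₀ * (w ^ P₀ * F N (shift P₀ f) w)) -
        (w ^ P₀ * (w ^ Q₀ * F N (shift Q₀ f) w) - w ^ P₀ * (w ^ Q₀ * F N (shift Q₀ (shift P₀ f)) w))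
        ≈⟨ +-cong (+-congˡ (-‿cong (*-congˡ (F-shift P₀ per h))))
          (-‿cong (+-cong (*-congˡ (F-shift Q₀ per h))
          (-‿cong (trans (*-congˡ (F-shift Q₀ (shift-periodic P₀ per) h)) (F-shift P₀ per h))))) ⟩
      (w ^ Q₀ * w ^ P₀ * F N f w - w ^ Q₀ * F N f w) - (w ^ P₀ * F N f w - F N f w)
        ≈⟨ solve 3 (λ x y a → (y :* x :* a :- y :* a) :- (x :* a :- a) := a :* ((x :- con 1ℤ) :* (y :- con 1ℤ))) ≡.refl
          (w ^ P₀) (w ^ Q₀) (F N f w) ⟩
      F N f w * ((w ^ P₀ - ι 1ℤ) * (w ^ Q₀ - ι 1ℤ)) ≈⟨ *-congˡ (*-cong (+-congˡ (-‿cong ι-1)) (+-congˡ (-‿cong ι-1))) ⟩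
      F N f w * ((w ^ P₀ - 1#) * (w ^ Q₀ - 1#)) ∎

    N≡pP₀ : N ≡ p ℕ.* P₀
    N≡pP₀ = ≡.trans N≡ (≡.trans (≡.cong (N′ ℕ.*_) (ℕ.*-comm p q)) (≡.trans (≡.sym (ℕ.*-assoc N′ q p)) (ℕ.*-comm P₀ p)))

    N≡qQ₀ : N ≡ q ℕ.* Q₀
    N≡qQ₀ = ≡.trans N≡ (≡.trans (≡.sym (ℕ.*-assoc N′ p q)) (ℕ.*-comm Q₀ q))

    p∣N : p ∣ℕ N
    p∣N = ≡.subst (p ∣ℕ_) (≡.sym N≡pP₀) (m∣m*n P₀)

    q∣N : q ∣ℕ N
    q∣N = ≡.subst (q ∣ℕ_) (≡.sym N≡qQ₀) (m∣m*n Q₀)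

    coprime-N : ∀ k → ¬ (p ∣ℕ k) → ¬ (q ∣ℕ k) → Coprime k N
    coprime-N k p∤k q∤k = no-common-prime⇒coprime k N go
      where
      go : ∀ {r} → Prime r → r ∣ℕ k → r ∣ℕ N → _
      go pr r∣k r∣N with primes pr r∣N
      ... | inj₁ ≡.refl = p∤k r∣k
      ... | inj₂ ≡.refl = q∤k r∣k

    -- The transform of Δ f vanishes at every ζ^k: if p or q divides k, one of the two factors in
    -- `F-Δ` is 0, and otherwise k is prime to N and the relation is conjugated to ζ^k. Fourier
    -- inversion then gives Δ f = 0.
    Δ-relation : ∀ {f} → Periodic f → F N f ζ ≈ 0# → ∀ x → x ℕ.< N → Δ f x ≡ 0ℤ
    Δ-relation {f} per F≈0 = fourier-inversion (Δ f) (λ k _ →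
      unit-cancel (Q₀ ℕ.+ P₀) _ (root^ k) (trans (F-Δ per (root^ k)) (cases k (p ∣? k) (q ∣? k))))
      where
      trivial : ∀ {a m k} → N ≡ a ℕ.* m → a ∣ℕ k → (ζ ^ k) ^ m - 1# ≈ 0#
      trivial {a} {m} {k} eq a∣k = ≈⇒-≈0
        (trans (^-assocʳ ζ k m) (ζ^-multiple (≡.subst (_∣ℕ k ℕ.* m) (≡.sym eq) (*-pres-∣ a∣k ∣-refl))))
      cases : ∀ k → Dec (p ∣ℕ k) → Dec (q ∣ℕ k) → F N f (ζ ^ k) * (((ζ ^ k) ^ P₀ - 1#) * ((ζ ^ k) ^ Q₀ - 1#)) ≈ 0#
      cases k (yes p∣k) _ = trans (*-congˡ (trans (*-congʳ (trivial N≡pP₀ p∣k)) (zeroˡ _))) (zeroʳ _)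
      cases k (no _) (yes q∣k) = trans (*-congˡ (trans (*-congˡ (trivial N≡qQ₀ q∣k)) (zeroʳ _))) (zeroʳ _)
      cases k (no p∤k) (no q∤k) = trans (*-congʳ (trans (sym (ev-fromCoeffs (ζ ^ k) N f))
        (G.galois (fromCoeffs N f) k (coprime-N k p∤k q∤k) ζ^N≈1 (trans (ev-fromCoeffs ζ N f) F≈0)))) (zeroˡ _)

    prime-∣ : ∀ {r r′} → Prime r → Prime r′ → r ∣ℕ r′ → r ≡ r′
    prime-∣ pr pr′ r∣r′ with prime⇒irreducible pr′ r∣r′
    ... | inj₁ ≡.refl = contradiction ∣-refl (prime∤1 pr)
    ... | inj₂ r≡r′ = r≡r′

    -- Coordinates on the subgroup of order p q: i counts modulo p and j modulo q.
    pt : ℕ → ℕ → ℕ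
    pt i j = i ℕ.* P₀ ℕ.+ j ℕ.* Q₀

    pt-∣ : ∀ i j → N ∣ℕ pt i j → p ∣ℕ i ∧ q ∣ℕ j
    pt-∣ i j N∣pt = p∣i , q∣j
      where
      N′≢0 : NonZero N′
      N′≢0 = ℕ.≢-nonZero (λ eq → ℕ.≢-nonZero⁻¹ N (≡.trans N≡ (≡.cong (ℕ._* (p ℕ.* q)) eq)))
      rearrange : pt i j ≡ N′ ℕ.* (i ℕ.* q ℕ.+ j ℕ.* p)
      rearrange = ≡.trans (≡.cong₂ ℕ._+_ (swap i q) (swap j p)) (≡.sym (ℕ.*-distribˡ-+ N′ (i ℕ.* q) (j ℕ.* p)))
        where
        swap : ∀ i q → i ℕ.* (N′ ℕ.* q) ≡ N′ ℕ.* (i ℕ.* q)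
        swap i q = ≡.trans (≡.sym (ℕ.*-assoc i N′ q)) (≡.trans (≡.cong (ℕ._* q) (ℕ.*-comm i N′)) (ℕ.*-assoc N′ i q))
      pq∣ : p ℕ.* q ∣ℕ i ℕ.* q ℕ.+ j ℕ.* p
      pq∣ = *-cancelˡ-∣ N′ {{N′≢0}} (≡.subst₂ _∣ℕ_ N≡ rearrange N∣pt)
      p∣i : p ∣ℕ i
      p∣i with euclidsLemma i q pp (∣m+n∣m⇒∣n (≡.subst (p ∣ℕ_) (ℕ.+-comm (i ℕ.* q) (j ℕ.* p)) (∣-trans (m∣m*n q) pq∣))
        (n∣m*n j))
      ... | inj₁ h = h
      ... | inj₂ p∣q = contradiction (prime-∣ pp pq p∣q) p≢q
      q∣j : q ∣ℕ j
      q∣j with euclidsLemma j p pq (∣m+n∣m⇒∣n (∣-trans (n∣m*n p) pq∣) (n∣m*n i))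
      ... | inj₁ h = h
      ... | inj₂ q∣p = contradiction (≡.sym (prime-∣ pq pp q∣p)) p≢q

    δ : ℕ → ℤ
    δ x = χℤ (N ∣? x)

    δ-yes : ∀ {x} → N ∣ℕ x → δ x ≡ 1ℤ
    δ-yes {x} h with N ∣? x
    ... | yes _ = ≡.refl
    ... | no ¬h = contradiction h ¬h

    δ-no : ∀ {x} → ¬ (N ∣ℕ x) → δ x ≡ 0ℤ
    δ-no {x} ¬h with N ∣? x
    ... | yes h = contradiction h ¬h
    ... | no _ = ≡.refl

    δ-periodic : Periodic δ
    δ-periodic i with N ∣? i
    ... | yes h = δ-yes (∣m∣n⇒∣m+n ∣-refl h)
    ... | no ¬h = δ-no (λ h → ¬h (∣m+n∣m⇒∣n h ∣-refl))

    F-δ : ∀ w → F N δ w ≈ 1#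
    F-δ w = trans (∑-single N 0 (λ i → ι (δ i) * w ^ i) (ℕ.>-nonZero⁻¹ N) off)
      (trans (*-congʳ (trans (reflexive (≡.cong ι (δ-yes (N ∣0)))) ι-1)) (*-identityʳ 1#))
      where
      off : ∀ i → i ℕ.< N → i ≢ 0 → ι (δ i) * w ^ i ≈ 0#
      off i i<N i≢0 = trans (*-congʳ (reflexive (≡.cong ι (δ-no (>⇒∤ {{ℕ.≢-nonZero i≢0}} i<N))))) (zeroˡ _)

    ν : (ℕ → ℤ) → ℕ → ℤ
    ν a y = ℤSums.∑ N (λ x → a x ℤ.* a (y ℕ.+ x))

    ν-periodic : ∀ {a} → Periodic a → Periodic (ν a)
    ν-periodic {a} per y = ℤSums.∑-cong N {λ x → a x ℤ.* a ((N ℕ.+ y) ℕ.+ x)} {λ x → a x ℤ.* a (y ℕ.+ x)}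
      (λ x _ → ≡.cong (a x ℤ.*_) (≡.trans (≡.cong a (ℕ.+-assoc N y x)) (per (y ℕ.+ x))))

    ι-∑ℤ : ∀ n f → ι (ℤSums.∑ n f) ≈ ∑ n (λ i → ι (f i))
    ι-∑ℤ n f = trans (reflexive (≡.cong ι (≡.sym (ℤSums.sumℤ≡∑ n f)))) (ι-∑ n f)

    -- Complex conjugation on N-th roots of unity.
    conj : Carrier → Carrier
    conj w = w ^ (N ℕ.∸ 1)

    conj-inverse : ∀ {w} → w ^ N ≈ 1# → ∀ x → conj w ^ x * w ^ x ≈ 1#
    conj-inverse {w} h x = begin
      conj w ^ x * w ^ x          ≈⟨ *-^ (conj w) w x ⟨
      (w ^ (N ℕ.∸ 1) * w) ^ x     ≈⟨ ^-congˡ x (trans (*-comm _ _) (trans (^-congʳ w (ℕ.suc-pred N)) h)) ⟩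
      1# ^ x                      ≈⟨ 1^ x ⟩
      1#                          ∎

    F-ν : ∀ {a} → Periodic a → ∀ {w} → w ^ N ≈ 1# → F N (ν a) w ≈ F N a (conj w) * F N a w
    F-ν {a} per {w} h = begin
      F N (ν a) w
        ≈⟨ ∑-cong N (λ y _ → trans (*-congʳ (ι-∑ℤ N (λ x → a x ℤ.* a (y ℕ.+ x)))) (∑-*ʳ N _ _)) ⟩
      ∑ N (λ y → ∑ N (λ x → ι (a x ℤ.* a (y ℕ.+ x)) * w ^ y)) ≈⟨ ∑-swap N N _ ⟩
      ∑ N (λ x → ∑ N (λ y → ι (a x ℤ.* a (y ℕ.+ x)) * w ^ y))
        ≈⟨ ∑-cong N (λ x _ → trans (∑-cong N
          (λ y _ → trans (*-congʳ (trans (ι-* (a x) (a (y ℕ.+ x)))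
          (*-congˡ (reflexive (≡.cong (λ m → ι (a m)) (ℕ.+-comm y x)))))) (*-assoc _ _ _))) (sym (∑-*ˡ N _ _))) ⟩
      ∑ N (λ x → ι (a x) * F N (shift x a) w)
        ≈⟨ ∑-cong N (λ x _ → trans (*-congˡ (unshift x)) (sym (*-assoc _ _ _))) ⟩
      ∑ N (λ x → (ι (a x) * conj w ^ x) * F N a w) ≈⟨ ∑-*ʳ N _ _ ⟨
      F N a (conj w) * F N a w ∎
      where
      unshift : ∀ x → F N (shift x a) w ≈ conj w ^ x * F N a w
      unshift x = begin
        F N (shift x a) w                          ≈⟨ *-identityˡ _ ⟨
        1# * F N (shift x a) w                     ≈⟨ *-congʳ (conj-inverse h x) ⟨
        (conj w ^ x * w ^ x) * F N (shift x a) w   ≈⟨ *-assoc _ _ _ ⟩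
        conj w ^ x * (w ^ x * F N (shift x a) w)   ≈⟨ *-congˡ (F-shift x per h) ⟩
        conj w ^ x * F N a w                       ∎

    -- Written with the trailing 0 that `Δ` produces at the point 0.
    P₀+Q₀ : ℕ
    P₀+Q₀ = P₀ ℕ.+ (Q₀ ℕ.+ 0)

    N∤P₀ : ¬ (N ∣ℕ P₀ ℕ.+ 0)
    N∤P₀ h = prime∤1 pp (proj₁ (pt-∣ 1 0 (≡.subst (N ∣ℕ_) (≡.cong (ℕ._+ 0) (≡.sym (ℕ.+-identityʳ P₀))) h)))

    N∤Q₀ : ¬ (N ∣ℕ Q₀ ℕ.+ 0)
    N∤Q₀ h = prime∤1 pq (proj₂ (pt-∣ 0 1 h))

    N∤P₀+Q₀ : ¬ (N ∣ℕ P₀+Q₀)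
    N∤P₀+Q₀ h = prime∤1 pq (proj₂ (pt-∣ 1 1 (≡.subst (N ∣ℕ_) (≡.cong (ℕ._+ (Q₀ ℕ.+ 0)) (≡.sym (ℕ.+-identityʳ P₀))) h)))

    -- `Δ-relation` is applied to t ν - K δ, whose transform at ζ is t |S(ζ)|² - K. At the point 0
    -- the function δ contributes 1 and its three translates nothing. This is how the norm becomes
    -- an integer comparable with sizes.
    norm-integral : ∀ {S} → Periodic S → ∀ t K → ι t * (F N S (conj ζ) * F N S ζ) ≈ ι K → t ℤ.* Δ (ν S) 0 ≡ K
    norm-integral {S} per t K eq = ≡.trans (ℤSums.solve 2 (λ x k → x := (x :- k) :+ k) ≡.refl (t ℤ.* Δ (ν S) 0) K)
      (≡.trans (≡.cong (ℤ._+ K) (≡.trans (≡.sym expand) (Δ-relation f-periodic F≈0 0 (ℕ.>-nonZero⁻¹ N))))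
        (ℤ.+-identityˡ K))
      where
      f : ℕ → ℤ
      f x = t ℤ.* ν S x ℤ.- K ℤ.* δ x
      f-periodic : Periodic f
      f-periodic i = ≡.cong₂ (λ u v → t ℤ.* u ℤ.- K ℤ.* v) (ν-periodic per i) (δ-periodic i)
      F≈0 : F N f ζ ≈ 0#
      F≈0 = trans (F-− (λ x → t ℤ.* ν S x) (λ x → K ℤ.* δ x) ζ)
        (≈⇒-≈0 (trans (F-* t (ν S) ζ) (trans (*-congˡ (F-ν per ζ^N≈1)) (trans eq
        (sym (trans (F-* K δ ζ) (trans (*-congˡ (F-δ ζ)) (*-identityʳ _))))))))
      expand : Δ f 0 ≡ t ℤ.* Δ (ν S) 0 ℤ.- K
      expand = ≡.trans (≡.cong₂ (λ u v → (u ℤ.- f (P₀ ℕ.+ 0)) ℤ.- v)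
        (≡.cong (λ d → t ℤ.* ν S 0 ℤ.- K ℤ.* d) (δ-yes (N ∣0)))
          (≡.cong₂ (λ u v → (t ℤ.* ν S (Q₀ ℕ.+ 0) ℤ.- K ℤ.* u) ℤ.- (t ℤ.* ν S P₀+Q₀ ℤ.- K ℤ.* v)) (δ-no N∤Q₀)
            (δ-no N∤P₀+Q₀)))
        (≡.trans (≡.cong (λ u → ((t ℤ.* ν S 0 ℤ.- K ℤ.* 1ℤ) ℤ.- (t ℤ.* ν S (P₀ ℕ.+ 0) ℤ.- K ℤ.* u)) ℤ.-
          ((t ℤ.* ν S (Q₀ ℕ.+ 0) ℤ.- K ℤ.* 0ℤ) ℤ.- (t ℤ.* ν S P₀+Q₀ ℤ.- K ℤ.* 0ℤ))) (δ-no N∤P₀))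
        (ℤSums.solve 6 (λ t K a b c d → ((t :* a :- K :* con 1ℤ) :- (t :* b :- K :* con 0ℤ)) :-
          ((t :* c :- K :* con 0ℤ) :- (t :* d :- K :* con 0ℤ)) := t :* ((a :- b) :- (c :- d)) :- K) ≡.refl
          t K (ν S 0) (ν S (P₀ ℕ.+ 0)) (ν S (Q₀ ℕ.+ 0)) (ν S P₀+Q₀)))

    ∑-nonneg : ∀ n {f} → (∀ i → i ℕ.< n → 0ℤ ℤ.≤ f i) → 0ℤ ℤ.≤ ℤSums.∑ n f
    ∑-nonneg zero h = ℤ.≤-refl
    ∑-nonneg (suc n) h = ℤ.+-mono-≤ (∑-nonneg n (λ i i<n → h i (ℕ.m<n⇒m<1+n i<n))) (h n ℕ.≤-refl)

    ∑-mono : ∀ n {f g} → (∀ i → i ℕ.< n → f i ℤ.≤ g i) → ℤSums.∑ n f ℤ.≤ ℤSums.∑ n g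
    ∑-mono zero h = ℤ.≤-refl
    ∑-mono (suc n) h = ℤ.+-mono-≤ (∑-mono n (λ i i<n → h i (ℕ.m<n⇒m<1+n i<n))) (h n ℕ.≤-refl)

    ∑-nonneg-zero : ∀ n {f} → (∀ i → i ℕ.< n → 0ℤ ℤ.≤ f i) → ℤSums.∑ n f ℤ.≤ 0ℤ → ∀ i → i ℕ.< n → f i ≡ 0ℤ
    ∑-nonneg-zero (suc n) {f} h le i i<n with i ℕ.≟ n
    ... | yes ≡.refl = ℤ.≤-antisym (ℤ.≤-trans
      (≡.subst (ℤ._≤ ℤSums.∑ n f ℤ.+ f n) (ℤ.+-identityˡ (f n))
      (ℤ.+-monoˡ-≤ (f n) (∑-nonneg n (λ i i<n → h i (ℕ.m<n⇒m<1+n i<n))))) le) (h n ℕ.≤-refl)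
    ... | no i≢n = ∑-nonneg-zero n (λ i i<n → h i (ℕ.m<n⇒m<1+n i<n))
          (ℤ.≤-trans (≡.subst (ℤ._≤ ℤSums.∑ n f ℤ.+ f n) (ℤ.+-identityʳ (ℤSums.∑ n f))
            (ℤ.+-monoʳ-≤ (ℤSums.∑ n f) (h n ℕ.≤-refl))) le) i (ℕ.≤∧≢⇒< (ℕ.≤-pred i<n) i≢n)

    +ℤ-cancelˡ-≤ : ∀ i {j k} → i ℤ.+ j ℤ.≤ i ℤ.+ k → j ℤ.≤ k
    +ℤ-cancelˡ-≤ i {j} {k} h = ≡.subst₂ ℤ._≤_ (cancel j) (cancel k) (ℤ.+-monoʳ-≤ (ℤ.- i) h)
      where
      cancel : ∀ j → ℤ.- i ℤ.+ (i ℤ.+ j) ≡ j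
      cancel j = ℤSums.solve 2 (λ i j → :- i :+ (i :+ j) := j) ≡.refl i j

    Indicator : (ℕ → ℤ) → Set
    Indicator S = ∀ x → S x ≡ 0ℤ ⊎ S x ≡ 1ℤ

    square-nonneg : ∀ i → 0ℤ ℤ.≤ i ℤ.* i
    square-nonneg (+ n) = ≡.subst (0ℤ ℤ.≤_) (ℤ.pos-* n n) (ℤ.+≤+ z≤n)
    square-nonneg -[1+ n ] = ℤ.+≤+ z≤n

    module NormBound {S : ℕ → ℤ} (per : Periodic S) (ind : Indicator S) where

      size : ℤ
      size = ℤSums.∑ N S

      private
        idempotent : ∀ x → S x ℤ.* S x ≡ S x
        idempotent x with ind x
        ... | inj₁ eq rewrite eq = ≡.refl
        ... | inj₂ eq rewrite eq = ≡.refl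

        product-nonneg : ∀ x y → 0ℤ ℤ.≤ S x ℤ.* S y
        product-nonneg x y with ind x | ind y
        ... | inj₁ eq | _ rewrite eq = ℤ.≤-refl
        ... | inj₂ eq | inj₁ eq′ rewrite eq | eq′ = ℤ.≤-refl
        ... | inj₂ eq | inj₂ eq′ rewrite eq | eq′ = ℤ.+≤+ z≤n

        product-≤ : ∀ x y → S x ℤ.* S y ℤ.≤ S x
        product-≤ x y with ind x | ind y
        ... | inj₁ eq | _ rewrite eq = ℤ.≤-refl
        ... | inj₂ eq | inj₁ eq′ rewrite eq | eq′ = ℤ.+≤+ z≤n
        ... | inj₂ eq | inj₂ eq′ rewrite eq | eq′ = ℤ.≤-refl

      ν-nonneg : ∀ y → 0ℤ ℤ.≤ ν S y
      ν-nonneg y = ∑-nonneg N (λ x _ → product-nonneg x (y ℕ.+ x))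

      ν-≤ : ∀ y → ν S y ℤ.≤ size
      ν-≤ y = ∑-mono N (λ x _ → product-≤ x (y ℕ.+ x))

      ν-0 : ν S 0 ≡ size
      ν-0 = ℤSums.∑-cong N {λ x → S x ℤ.* S (0 ℕ.+ x)} {S} (λ x _ → idempotent x)

      -- Only ν(0), which is the size, and ν(N/p + N/q) enter `Δ` with a positive sign.
      Δν≤ : Δ (ν S) 0 ℤ.≤ size ℤ.+ ν S P₀+Q₀
      Δν≤ = ≡.subst₂ ℤ._≤_ (≡.cong (λ s → (s ℤ.- ν S (P₀ ℕ.+ 0)) ℤ.- (ν S (Q₀ ℕ.+ 0) ℤ.- ν S P₀+Q₀)) (≡.sym ν-0)) ≡.refl
        (≡.subst₂ ℤ._≤_ (ℤSums.solve 4 (λ s a b c → (s :+ c) :- (a :+ b) := (s :- a) :- (b :- c)) ≡.refl size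
          (ν S (P₀ ℕ.+ 0)) (ν S (Q₀ ℕ.+ 0)) (ν S P₀+Q₀)) (ℤ.+-identityʳ _)
          (ℤ.+-monoʳ-≤ (size ℤ.+ ν S P₀+Q₀) (ℤ.neg-mono-≤ (ℤ.+-mono-≤ (ν-nonneg (P₀ ℕ.+ 0)) (ν-nonneg (Q₀ ℕ.+ 0))))))

      Δν≤2size : Δ (ν S) 0 ℤ.≤ size ℤ.+ size
      Δν≤2size = ℤ.≤-trans Δν≤ (ℤ.+-monoʳ-≤ size (ν-≤ P₀+Q₀))

      -- If the bound is attained then S is invariant under a nontrivial translation, so S(ζ) = 0.
      Δν<2size : ¬ (F N S ζ ≈ 0#) → Δ (ν S) 0 ℤ.< size ℤ.+ size
      Δν<2size F≉0 = ℤ.≤∧≢⇒< Δν≤2size λ eq → F≉0 (F≈0 (size≤ν eq))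
        where
        z = P₀+Q₀
        size≤ν : Δ (ν S) 0 ≡ size ℤ.+ size → size ℤ.≤ ν S z
        size≤ν eq = +ℤ-cancelˡ-≤ size (≡.subst (ℤ._≤ size ℤ.+ ν S z) eq Δν≤)
        sq : ℕ → ℤ
        sq x = (S x ℤ.- S (z ℕ.+ x)) ℤ.* (S x ℤ.- S (z ℕ.+ x))
        -- Since S takes only the values 0 and 1, the squared differences under translation by z add
        -- up to 2 (size - ν z), which is 0 if the bound is attained.
        sum-sq : ℤSums.∑ N sq ≡ (size ℤ.- ν S z) ℤ.+ (size ℤ.- ν S z)
        sum-sq = ≡.trans (ℤSums.∑-cong N {sq} {λ x → (S x ℤ.+ S (z ℕ.+ x)) ℤ.+ ℤ.- (+ 2) ℤ.* (S x ℤ.* S (z ℕ.+ x))}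
          λ x _ → pointwise x)
          (≡.trans (ℤSums.∑-+ N (λ x → S x ℤ.+ S (z ℕ.+ x)) (λ x → ℤ.- (+ 2) ℤ.* (S x ℤ.* S (z ℕ.+ x))))
          (≡.trans (≡.cong₂ ℤ._+_ (≡.trans (ℤSums.∑-+ N S (λ x → S (z ℕ.+ x)))
            (≡.cong (λ s → size ℤ.+ s) (ℤSums.∑-shift N S per z)))
            (≡.sym (ℤSums.∑-*ˡ N (ℤ.- (+ 2)) (λ x → S x ℤ.* S (z ℕ.+ x)))))
            (ℤSums.solve 2 (λ s v → (s :+ s) :+ con (ℤ.- (+ 2)) :* v := (s :- v) :+ (s :- v)) ≡.refl size (ν S z))))
          where
          pointwise : ∀ x → sq x ≡ (S x ℤ.+ S (z ℕ.+ x)) ℤ.+ ℤ.- (+ 2) ℤ.* (S x ℤ.* S (z ℕ.+ x))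
          pointwise x = ≡.trans (ℤSums.solve 2
            (λ a b → (a :- b) :* (a :- b) := (a :* a :+ b :* b) :+ con (ℤ.- (+ 2)) :* (a :* b)) ≡.refl (S x)
            (S (z ℕ.+ x)))
            (≡.cong (ℤ._+ ℤ.- (+ 2) ℤ.* (S x ℤ.* S (z ℕ.+ x))) (≡.cong₂ ℤ._+_ (idempotent x) (idempotent (z ℕ.+ x))))
        F≈0 : size ℤ.≤ ν S z → F N S ζ ≈ 0#
        F≈0 le = cases (domain (ζ ^ z - 1#) (F N S ζ) (begin
            (ζ ^ z - 1#) * F N S ζ
              ≈⟨ solve 3 (λ u o x → (u :- o) :* x := u :* x :- o :* x) ≡.refl (ζ ^ z) 1# (F N S ζ) ⟩
            ζ ^ z * F N S ζ - 1# * F N S ζ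
              ≈⟨ +-cong (*-congˡ (∑-cong N (λ x x<N → *-congʳ (reflexive (≡.cong ι (invariant x x<N))))))
              (-‿cong (*-identityˡ _)) ⟩
            ζ ^ z * F N (shift z S) ζ - F N S ζ ≈⟨ ≈⇒-≈0 (F-shift z per ζ^N≈1) ⟩
            0#                                  ∎))
          where
          sum≤0 : ℤSums.∑ N sq ℤ.≤ 0ℤ
          sum≤0 = ≡.subst (ℤ._≤ 0ℤ) (≡.sym sum-sq) (ℤ.+-mono-≤ (ℤ.i≤j⇒i-j≤0 le) (ℤ.i≤j⇒i-j≤0 le))
          invariant : ∀ x → x ℕ.< N → S x ≡ S (z ℕ.+ x)
          invariant x x<N with ℤ.i*j≡0⇒i≡0∨j≡0 (S x ℤ.- S (z ℕ.+ x))
            (∑-nonneg-zero N (λ x _ → square-nonneg (S x ℤ.- S (z ℕ.+ x))) sum≤0 x x<N)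
          ... | inj₁ h = ℤ.i-j≡0⇒i≡j (S x) _ h
          ... | inj₂ h = ℤ.i-j≡0⇒i≡j (S x) _ h
          cases : ζ ^ z - 1# ≈ 0# ⊎ F N S ζ ≈ 0# → F N S ζ ≈ 0#
          cases (inj₁ h) = contradiction (order z (-≈0⇒≈ h)) N∤P₀+Q₀
          cases (inj₂ h) = h

    -- Elements of absolute value one are signed roots of unity

    periodic-multiple : ∀ {f} → Periodic f → ∀ l i → f (l ℕ.* N ℕ.+ i) ≡ f i
    periodic-multiple per zero i = ≡.refl
    periodic-multiple {f} per (suc l) i = ≡.trans (≡.cong f (ℕ.+-assoc N (l ℕ.* N) i))
      (≡.trans (per (l ℕ.* N ℕ.+ i)) (periodic-multiple per l i))

    periodic-% : ∀ {f} → Periodic f → ∀ i → f i ≡ f (i % N)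
    periodic-% {f} per i = ≡.trans (≡.cong f (≡.trans (m≡m%n+[m/n]*n i N) (ℕ.+-comm (i % N) _)))
      (periodic-multiple per (i / N) (i % N))

    periodic-∣ : ∀ {f} → Periodic f → ∀ {i} → N ∣ℕ i → f i ≡ f 0
    periodic-∣ {f} per (divides l ≡.refl) = ≡.trans (≡.cong f (≡.sym (ℕ.+-identityʳ (l ℕ.* N))))
      (periodic-multiple per l 0)

    x∙yz≡y∙xz : ∀ a b c → a ℕ.+ (b ℕ.+ c) ≡ b ℕ.+ (a ℕ.+ c)
    x∙yz≡y∙xz a b c = ≡.trans (≡.sym (ℕ.+-assoc a b c)) (≡.trans (≡.cong (ℕ._+ c) (ℕ.+-comm a b)) (ℕ.+-assoc b a c))

    Δ-periodic : ∀ {f} → Periodic f → Periodic (Δ f)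
    Δ-periodic {f} per i = ≡.cong₂ ℤ._-_ (≡.cong₂ ℤ._-_ (per i) (s P₀ i))
      (≡.cong₂ ℤ._-_ (s Q₀ i) (≡.trans (≡.cong (λ m → f (P₀ ℕ.+ m)) (x∙yz≡y∙xz Q₀ N i)) (s P₀ (Q₀ ℕ.+ i))))
      where
      s : ∀ a i → f (a ℕ.+ (N ℕ.+ i)) ≡ f (a ℕ.+ i)
      s a i = shift-periodic a per i

    module Correlation {a : ℕ → ℤ} (per : Periodic a) where

      private
        r = Δ a

        ∑-alternating : ∀ (f g h k : ℕ → ℤ) → ℤSums.∑ N (λ x → (f x ℤ.- g x) ℤ.- (h x ℤ.- k x)) ≡
          (ℤSums.∑ N f ℤ.- ℤSums.∑ N g) ℤ.- (ℤSums.∑ N h ℤ.- ℤSums.∑ N k)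
        ∑-alternating f g h k = go N
          where
          go : ∀ n → ℤSums.∑ n (λ x → (f x ℤ.- g x) ℤ.- (h x ℤ.- k x)) ≡ (ℤSums.∑ n f ℤ.- ℤSums.∑ n g) ℤ.-
            (ℤSums.∑ n h ℤ.- ℤSums.∑ n k)
          go zero = ≡.refl
          go (suc n) = ≡.trans (≡.cong (ℤ._+ ((f n ℤ.- g n) ℤ.- (h n ℤ.- k n))) (go n))
            (ℤSums.solve 8 (λ a b c d f g h k → ((a :- b) :- (c :- d)) :+ ((f :- g) :- (h :- k)) :=
              ((a :+ f) :- (b :+ g)) :- ((c :+ h) :- (d :+ k))) ≡.refl (ℤSums.∑ n f) (ℤSums.∑ n g) (ℤSums.∑ n h)
              (ℤSums.∑ n k) (f n) (g n) (h n) (k n))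

        C : ℕ → ℤ
        C y = ℤSums.∑ N (λ x → a x ℤ.* r (y ℕ.+ x))

        C≡ : ∀ y → C y ≡ Δ (ν a) y
        C≡ y = ≡.trans (ℤSums.∑-cong N {λ x → a x ℤ.* r (y ℕ.+ x)}
          {λ x → (a x ℤ.* a (y ℕ.+ x) ℤ.- a x ℤ.* a ((P₀ ℕ.+ y) ℕ.+ x)) ℤ.-
          (a x ℤ.* a ((Q₀ ℕ.+ y) ℕ.+ x) ℤ.- a x ℤ.* a ((P₀ ℕ.+ (Q₀ ℕ.+ y)) ℕ.+ x))} (λ x _ → pointwise x))
          (∑-alternating (λ x → a x ℤ.* a (y ℕ.+ x)) (λ x → a x ℤ.* a ((P₀ ℕ.+ y) ℕ.+ x))
            (λ x → a x ℤ.* a ((Q₀ ℕ.+ y) ℕ.+ x)) (λ x → a x ℤ.* a ((P₀ ℕ.+ (Q₀ ℕ.+ y)) ℕ.+ x)))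
          where
          pointwise : ∀ x → a x ℤ.* r (y ℕ.+ x) ≡ (a x ℤ.* a (y ℕ.+ x) ℤ.- a x ℤ.* a ((P₀ ℕ.+ y) ℕ.+ x)) ℤ.-
            (a x ℤ.* a ((Q₀ ℕ.+ y) ℕ.+ x) ℤ.- a x ℤ.* a ((P₀ ℕ.+ (Q₀ ℕ.+ y)) ℕ.+ x))
          pointwise x rewrite ℕ.+-assoc P₀ y x | ℕ.+-assoc Q₀ y x | ℕ.+-assoc P₀ (Q₀ ℕ.+ y) x | ℕ.+-assoc Q₀ y x =
            ℤSums.solve 5 (λ x b c d e → x :* ((b :- c) :- (d :- e)) := (x :* b :- x :* c) :- (x :* d :- x :* e)) ≡.refl
              (a x) (a (y ℕ.+ x)) (a (P₀ ℕ.+ (y ℕ.+ x))) (a (Q₀ ℕ.+ (y ℕ.+ x))) (a (P₀ ℕ.+ (Q₀ ℕ.+ (y ℕ.+ x))))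

        shifted : ∀ c y → ℤSums.∑ N (λ x → a (c ℕ.+ x) ℤ.* r ((c ℕ.+ y) ℕ.+ x)) ≡ C y
        shifted c y = ≡.trans (ℤSums.∑-cong N {λ x → a (c ℕ.+ x) ℤ.* r ((c ℕ.+ y) ℕ.+ x)} {λ x → g (c ℕ.+ x)}
          (λ x _ → ≡.cong (λ m → a (c ℕ.+ x) ℤ.* r m) (≡.trans (ℕ.+-assoc c y x) (x∙yz≡y∙xz c y x))))
          (ℤSums.∑-shift N g (λ i → ≡.cong₂ ℤ._*_ (per i) (shift-periodic y (Δ-periodic per) i)) c)
          where
          g : ℕ → ℤ
          g x = a x ℤ.* r (y ℕ.+ x)

      -- Replacing both factors of the correlation by their Δ applies Δ to ν a once forwards and
      -- once backwards. The backward shifts lower the coordinates, so the point is taken with both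
      -- of them positive.
      ν-Δ : ∀ i j → let D = Δ (ν a) in
            ν r (pt (suc i) (suc j)) ≡ (D (pt (suc i) (suc j)) ℤ.- D (pt i (suc j))) ℤ.-
              (D (pt (suc i) j) ℤ.- D (pt i j))
      ν-Δ i j = ≡.trans (ℤSums.∑-cong N {λ x → r x ℤ.* r (y ℕ.+ x)}
        {λ x → (a x ℤ.* r (y ℕ.+ x) ℤ.- a (P₀ ℕ.+ x) ℤ.* r (y ℕ.+ x)) ℤ.-
        (a (Q₀ ℕ.+ x) ℤ.* r (y ℕ.+ x) ℤ.- a (P₀ ℕ.+ (Q₀ ℕ.+ x)) ℤ.* r (y ℕ.+ x))}
            (λ x _ → ℤSums.solve 5 (λ b c d e r → ((b :- c) :- (d :- e)) :* r := (b :* r :- c :* r) :-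
              (d :* r :- e :* r)) ≡.refl (a x) (a (P₀ ℕ.+ x)) (a (Q₀ ℕ.+ x)) (a (P₀ ℕ.+ (Q₀ ℕ.+ x))) (r (y ℕ.+ x))))
        (≡.trans (∑-alternating (λ x → a x ℤ.* r (y ℕ.+ x)) (λ x → a (P₀ ℕ.+ x) ℤ.* r (y ℕ.+ x))
          (λ x → a (Q₀ ℕ.+ x) ℤ.* r (y ℕ.+ x)) (λ x → a (P₀ ℕ.+ (Q₀ ℕ.+ x)) ℤ.* r (y ℕ.+ x)))
        (≡.cong₂ ℤ._-_ (≡.cong₂ ℤ._-_ (C≡ y)
          (term (λ x → P₀ ℕ.+ x) P₀ (λ _ → ≡.refl) (pt i (suc j)) (ℕ.+-assoc P₀ (i ℕ.* P₀) (suc j ℕ.* Q₀))))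
          (≡.cong₂ ℤ._-_ (term (λ x → Q₀ ℕ.+ x) Q₀ (λ _ → ≡.refl) (pt (suc i) j)
            (x∙yz≡y∙xz (suc i ℕ.* P₀) Q₀ (j ℕ.* Q₀)))
                         (term (λ x → P₀ ℕ.+ (Q₀ ℕ.+ x)) (P₀ ℕ.+ Q₀) (λ x → ≡.sym (ℕ.+-assoc P₀ Q₀ x)) (pt i j)
                           (≡.trans (ℕ.+-assoc P₀ (i ℕ.* P₀) (suc j ℕ.* Q₀))
                             (≡.trans (≡.cong (P₀ ℕ.+_) (x∙yz≡y∙xz (i ℕ.* P₀) Q₀ (j ℕ.* Q₀)))
                             (≡.sym (ℕ.+-assoc P₀ Q₀ (pt i j)))))))))
        where
        y = pt (suc i) (suc j)
        term : ∀ (s : ℕ → ℕ) c → (∀ x → s x ≡ c ℕ.+ x) → ∀ y′ → y ≡ c ℕ.+ y′ →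
          ℤSums.∑ N (λ x → a (s x) ℤ.* r (y ℕ.+ x)) ≡ Δ (ν a) y′
        term s c s≡ y′ y≡ = ≡.trans (ℤSums.∑-cong N {λ x → a (s x) ℤ.* r (y ℕ.+ x)}
          {λ x → a (c ℕ.+ x) ℤ.* r ((c ℕ.+ y′) ℕ.+ x)} (λ x _ → ≡.cong₂ (λ u v → a u ℤ.* r (v ℕ.+ x)) (s≡ x) y≡))
          (≡.trans (shifted c y′) (C≡ y′))

    δ-pt : ℕ → ℕ → ℤ
    δ-pt i j = δ (pt i j)

    Δδ-pt : ∀ i j → Δ δ (pt i j) ≡ (δ-pt i j ℤ.- δ-pt (suc i) j) ℤ.- (δ-pt i (suc j) ℤ.- δ-pt (suc i) (suc j))
    Δδ-pt i j = ≡.cong₂ ℤ._-_ (≡.cong (λ m → δ-pt i j ℤ.- δ m) (≡.sym (ℕ.+-assoc P₀ (i ℕ.* P₀) (j ℕ.* Q₀))))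
      (≡.cong₂ (λ m n → δ m ℤ.- δ n) (x∙yz≡y∙xz Q₀ (i ℕ.* P₀) (j ℕ.* Q₀))
        (≡.trans (≡.cong (P₀ ℕ.+_) (x∙yz≡y∙xz Q₀ (i ℕ.* P₀) (j ℕ.* Q₀)))
          (≡.sym (ℕ.+-assoc P₀ (i ℕ.* P₀) (suc j ℕ.* Q₀)))))

    ∣-pt : ∀ {i j} → p ∣ℕ i → q ∣ℕ j → N ∣ℕ pt i j
    ∣-pt {i} {j} p∣i q∣j = ∣m∣n⇒∣m+n (≡.subst (_∣ℕ i ℕ.* P₀) (≡.sym N≡pP₀) (*-pres-∣ p∣i ∣-refl))
      (≡.subst (_∣ℕ j ℕ.* Q₀) (≡.sym N≡qQ₀) (*-pres-∣ q∣j ∣-refl))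

    δ-pt-1 : ∀ {i j} → p ∣ℕ i → q ∣ℕ j → δ-pt i j ≡ 1ℤ
    δ-pt-1 p∣i q∣j = δ-yes (∣-pt p∣i q∣j)

    δ-pt-p : ∀ {i} j → ¬ (p ∣ℕ i) → δ-pt i j ≡ 0ℤ
    δ-pt-p {i} j p∤i = δ-no (λ h → p∤i (proj₁ (pt-∣ i j h)))

    δ-pt-q : ∀ i {j} → ¬ (q ∣ℕ j) → δ-pt i j ≡ 0ℤ
    δ-pt-q i {j} q∤j = δ-no (λ h → q∤j (proj₂ (pt-∣ i j h)))

    δ-nonneg : ∀ x → 0ℤ ℤ.≤ δ x
    δ-nonneg x with N ∣? x
    ... | yes _ = ℤ.+≤+ z≤n
    ... | no _ = ℤ.≤-refl

    module NormOne {a : ℕ → ℤ} (per : Periodic a) (norm≈1 : F N a (conj ζ) * F N a ζ ≈ 1#) where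

      -- Both ν a and δ have transform 1 at ζ, so their difference is a relation and is annihilated
      -- by Δ.
      Δν≡Δδ : ∀ x → Δ (ν a) x ≡ Δ δ x
      Δν≡Δδ x = ℤ.i-j≡0⇒i≡j _ _ (≡.trans
        (ℤSums.solve 8 (λ a b c d e f g h → ((a :- b) :- (c :- d)) :- ((e :- f) :- (g :- h)) := ((a :- e) :- (b :- f))
        :- ((c :- g) :- (d :- h))) ≡.refl
          (ν a x) (ν a (P₀ ℕ.+ x)) (ν a (Q₀ ℕ.+ x)) (ν a (P₀ ℕ.+ (Q₀ ℕ.+ x))) (δ x) (δ (P₀ ℕ.+ x)) (δ (Q₀ ℕ.+ x))
            (δ (P₀ ℕ.+ (Q₀ ℕ.+ x))))
        (≡.trans (periodic-% (Δ-periodic f-periodic) x) (Δ-relation f-periodic F≈0 (x % N) (m%n<n x N))))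
        where
        f : ℕ → ℤ
        f x = ν a x ℤ.- δ x
        f-periodic : Periodic f
        f-periodic i = ≡.cong₂ ℤ._-_ (ν-periodic per i) (δ-periodic i)
        F≈0 : F N f ζ ≈ 0#
        F≈0 = trans (F-− (ν a) δ ζ) (≈⇒-≈0 (trans (F-ν per ζ^N≈1) (trans norm≈1 (sym (F-δ ζ)))))

      r : ℕ → ℤ
      r = Δ a

      r-periodic : Periodic r
      r-periodic = Δ-periodic per

      private
        d = δ-pt

      -- At these points r = Δ a has the same autocorrelation as Δ δ, a function on the four corners
      -- of a rectangle. The goal is to conclude that r itself looks like that.
      ν-r : ∀ i j → ν r (pt (suc i) (suc j)) ≡
        (((d (suc i) (suc j) ℤ.- d (2 ℕ.+ i) (suc j)) ℤ.- (d (suc i) (2 ℕ.+ j) ℤ.- d (2 ℕ.+ i) (2 ℕ.+ j))) ℤ.-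
          ((d i (suc j) ℤ.- d (suc i) (suc j)) ℤ.- (d i (2 ℕ.+ j) ℤ.- d (suc i) (2 ℕ.+ j))))
        ℤ.- (((d (suc i) j ℤ.- d (2 ℕ.+ i) j) ℤ.- (d (suc i) (suc j) ℤ.- d (2 ℕ.+ i) (suc j))) ℤ.-
          ((d i j ℤ.- d (suc i) j) ℤ.- (d i (suc j) ℤ.- d (suc i) (suc j))))
      ν-r i j = ≡.trans (Correlation.ν-Δ per i j)
        (≡.cong₂ ℤ._-_ (≡.cong₂ ℤ._-_ (D≡ (suc i) (suc j)) (D≡ i (suc j))) (≡.cong₂ ℤ._-_ (D≡ (suc i) j) (D≡ i j)))
        where
        D≡ : ∀ i j → Δ (ν a) (pt i j) ≡ (d i j ℤ.- d (suc i) j) ℤ.- (d i (suc j) ℤ.- d (suc i) (suc j))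
        D≡ i j = ≡.trans (Δν≡Δδ (pt i j)) (Δδ-pt i j)

      -- Two opposite corners of the model rectangle differ by (1, 1) and carry equal signs. The
      -- summands `d 0 2` and `d 2 0` appear for q = 2 and p = 2 and can only increase the value.
      ν-r-diagonal>0 : 0ℤ ℤ.< ν r (pt 1 1)
      ν-r-diagonal>0 = ≡.subst (0ℤ ℤ.<_) (≡.sym eq)
        (ℤ.+-mono-<-≤ (ℤ.+<+ (s≤s z≤n))
        (ℤ.+-mono-≤ (ℤ.+-mono-≤ (δ-nonneg (pt 0 2)) (δ-nonneg (pt 2 0))) (δ-nonneg (pt 2 2))))
        where
        eq : ν r (pt 1 1) ≡ 1ℤ ℤ.+ ((d 0 2 ℤ.+ d 2 0) ℤ.+ d 2 2)
        eq = ≡.trans (ν-r 0 0) (≡.trans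
          (ℤSums.solve 9 (λ d00 d01 d02 d10 d11 d12 d20 d21 d22 →
              (((d11 :- d21) :- (d12 :- d22)) :- ((d01 :- d11) :- (d02 :- d12))) :-
                (((d10 :- d20) :- (d11 :- d21)) :- ((d00 :- d10) :- (d01 :- d11)))
              := ((d00 :+ ((d02 :+ d20) :+ d22)) :+ con (+ 4) :* d11) :- con (+ 2) :* (d21 :+ d12 :+ d01 :+ d10)) ≡.refl
            (d 0 0) (d 0 1) (d 0 2) (d 1 0) (d 1 1) (d 1 2) (d 2 0) (d 2 1) (d 2 2))
          (≡.trans (≡.cong₂ (λ u v → ((u ℤ.+ ((d 0 2 ℤ.+ d 2 0) ℤ.+ d 2 2)) ℤ.+ (+ 4) ℤ.* v) ℤ.- (+ 2) ℤ.*
            (d 2 1 ℤ.+ d 1 2 ℤ.+ d 0 1 ℤ.+ d 1 0)) (δ-pt-1 (p ∣0) (q ∣0)) (δ-pt-p 1 (prime∤1 pp)))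
          (≡.trans (≡.cong (λ w → ((1ℤ ℤ.+ ((d 0 2 ℤ.+ d 2 0) ℤ.+ d 2 2)) ℤ.+ (+ 4) ℤ.* 0ℤ) ℤ.- (+ 2) ℤ.* w)
            (≡.cong₂ ℤ._+_ (≡.cong₂ ℤ._+_ (≡.cong₂ ℤ._+_ (δ-pt-q 2 (prime∤1 pq)) (δ-pt-p 2 (prime∤1 pp)))
              (δ-pt-q 0 (prime∤1 pq))) (δ-pt-p 0 (prime∤1 pp))))
            (ℤSums.solve 1 (λ x → ((con 1ℤ :+ x) :+ con 0ℤ) :- con 0ℤ := con 1ℤ :+ x) ≡.refl
              ((d 0 2 ℤ.+ d 2 0) ℤ.+ d 2 2)))))

      -- The sum is the autocorrelation at 0. It is read off at the point (p, q), which is 0 modulo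
      -- N and has positive coordinates, as `ν-r` demands; four of the sixteen terms are 1 there and
      -- the others vanish.
      ∑r²≡4 : ℤSums.∑ N (λ x → r x ℤ.* r x) ≡ + 4
      ∑r²≡4 = ≡.trans (≡.sym (periodic-∣ (ν-periodic r-periodic) (∣-pt {p} {q} ∣-refl ∣-refl)))
        (≡.subst₂ (λ i j → ν r (pt i j) ≡ + 4) (suc-pred pp) (suc-pred pq)
        (≡.trans (ν-r i j) (≡.trans
          (≡.cong₂ ℤ._-_ (≡.cong₂ ℤ._-_ (≡.cong₂ ℤ._-_ (≡.cong₂ ℤ._-_ one (δ-pt-p (suc j) p∤+))
            (≡.cong₂ ℤ._-_ (δ-pt-q (suc i) q∤+) (δ-pt-p (2 ℕ.+ j) p∤+)))
                                        (≡.cong₂ ℤ._-_ (≡.cong₂ ℤ._-_ (δ-pt-p (suc j) p∤-) one)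
                                          (≡.cong₂ ℤ._-_ (δ-pt-q i q∤+) (δ-pt-q (suc i) q∤+))))
                         (≡.cong₂ ℤ._-_ (≡.cong₂ ℤ._-_ (≡.cong₂ ℤ._-_ (δ-pt-q (suc i) q∤-) (δ-pt-p j p∤+))
                           (≡.cong₂ ℤ._-_ one (δ-pt-p (suc j) p∤+)))
                                        (≡.cong₂ ℤ._-_ (≡.cong₂ ℤ._-_ (δ-pt-p j p∤-) (δ-pt-q (suc i) q∤-))
                                          (≡.cong₂ ℤ._-_ (δ-pt-p (suc j) p∤-) one)))) ≡.refl)))
        where
        i = ℕ.pred p
        j = ℕ.pred q
        suc-pred : ∀ {r} → Prime r → suc (ℕ.pred r) ≡ r
        suc-pred {r} pr = ℕ.suc-pred r {{prime⇒nonZero pr}}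
        ∤+ : ∀ {r} → Prime r → ¬ (r ∣ℕ 2 ℕ.+ ℕ.pred r)
        ∤+ {r} pr h = prime∤1 pr (∣m+n∣m⇒∣n (≡.subst (r ∣ℕ_) (≡.trans (≡.cong suc (suc-pred pr)) (ℕ.+-comm 1 r)) h)
          ∣-refl)
        ∤- : ∀ {r} → Prime r → ¬ (r ∣ℕ ℕ.pred r)
        ∤- {r} pr h = prime∤1 pr (∣m+n∣m⇒∣n
          (≡.subst (r ∣ℕ_) (≡.trans (≡.sym (suc-pred pr)) (ℕ.+-comm 1 (ℕ.pred r))) ∣-refl) h)
        p∤+ = ∤+ pp
        q∤+ = ∤+ pq
        p∤- = ∤- pp
        q∤- = ∤- pq
        one : d (suc i) (suc j) ≡ 1ℤ
        one = ≡.subst₂ (λ i j → d i j ≡ 1ℤ) (≡.sym (suc-pred pp)) (≡.sym (suc-pred pq)) (δ-pt-1 ∣-refl ∣-refl)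

    private
      ℤ-points : List ℕ → (ℕ → ℤ) → ℤ
      ℤ-points = ℤSums.∑-points

    points-≤ : ∀ n ks f → (∀ i → i ℕ.< n → 0ℤ ℤ.≤ f i) → Unique ks → All (ℕ._< n) ks → ℤ-points ks f ℤ.≤ ℤSums.∑ n f
    points-≤ n [] f h _ _ = ∑-nonneg n h
    points-≤ n (k ∷ ks) f h (k∉ ∷ u) (k<n ∷ ks<n) = ≡.subst₂ ℤ._≤_
      (≡.cong (λ s → f k ℤ.+ s) (ℤSums.∑-points-drop k ks f k∉)) (≡.sym (ℤSums.∑-drop n k f k<n))
      (ℤ.+-monoʳ-≤ (f k) (points-≤ n ks (ℤSums.drop k f) nonneg u ks<n))
      where
      nonneg : ∀ i → i ℕ.< n → 0ℤ ℤ.≤ ℤSums.drop k f i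
      nonneg i i<n with i ℕ.≟ k
      ... | yes _ = ℤ.≤-refl
      ... | no _ = h i i<n

    square-positive : ∀ {i} → i ≢ 0ℤ → 1ℤ ℤ.≤ i ℤ.* i
    square-positive {+ zero} h = contradiction ≡.refl h
    square-positive {+ suc n} h = ℤ.+≤+ (s≤s z≤n)
    square-positive { -[1+ n ]} h = ℤ.+≤+ (s≤s z≤n)

    ∑-positive : ∀ n f → 0ℤ ℤ.< ℤSums.∑ n f → ∃[ i ] (i ℕ.< n ∧ 0ℤ ℤ.< f i)
    ∑-positive n f pos with ℕ.anyUpTo? (λ i → 0ℤ ℤ.<? f i) n
    ... | yes h = h
    ... | no none = contradiction pos
      (ℤ.≤⇒≯ (≡.subst (ℤSums.∑ n f ℤ.≤_) (ℤSums.∑-zero n {λ _ → 0ℤ} (λ _ _ → ≡.refl))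
      (∑-mono n {f} {λ _ → 0ℤ} (λ i i<n → ℤ.≮⇒≥ (λ lt → none (i , i<n , lt))))))

    nonzero-elsewhere : ∀ n (f : ℕ → ℤ) → 0 ℕ.< n → ℤSums.∑ n f ≡ 0ℤ → f 0 ≢ 0ℤ → ∃[ k ] (0 ℕ.< k ∧ k ℕ.< n ∧ f k ≢ 0ℤ)
    nonzero-elsewhere n f 0<n sum≡0 f0≢0 with ℕ.anyUpTo? (λ k → 0 ℕ.<? k ×-dec ¬? (f k ℤ.≟ 0ℤ)) n
    ... | yes (k , k<n , 0<k , fk≢0) = k , 0<k , k<n , fk≢0
    ... | no none = contradiction (≡.trans (≡.sym (ℤSums.∑-single n 0 f 0<n zero-off)) sum≡0) f0≢0
      where
      zero-off : ∀ i → i ℕ.< n → i ≢ 0 → f i ≡ 0ℤ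
      zero-off i i<n i≢0 with f i ℤ.≟ 0ℤ
      ... | yes eq = eq
      ... | no neq = contradiction (i , i<n , ℕ.n≢0⇒n>0 i≢0 , neq) none

    sum-of-two : ∀ n (f : ℕ → ℤ) → 1 ℕ.< n → (∀ k → 0 ℕ.< k → k ℕ.< n → f k ≢ 0ℤ → k ≡ 1) → ℤSums.∑ n f ≡ f 0 ℤ.+ f 1
    sum-of-two (suc n) f (s≤s 0<n) h = ≡.trans (ℤSums.∑-head n f) (≡.cong (λ s → f 0 ℤ.+ s) (ℤSums.∑-single n 0 (f ∘ suc) 0<n off))
      where
      off : ∀ i → i ℕ.< n → i ≢ 0 → f (suc i) ≡ 0ℤ
      off i i<n i≢0 with f (suc i) ℤ.≟ 0ℤ
      ... | yes eq = eq
      ... | no neq = contradiction (ℕ.suc-injective (h (suc i) (s≤s z≤n) (s≤s i<n) neq)) i≢0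

    telescope : ∀ n (g : ℕ → ℤ) → ℤSums.∑ n (λ k → g k ℤ.- g (suc k)) ≡ g 0 ℤ.- g n
    telescope zero g = ≡.sym (ℤ.+-inverseʳ (g 0))
    telescope (suc n) g = ≡.trans (≡.cong (ℤ._+ (g n ℤ.- g (suc n))) (telescope n g))
      (ℤSums.solve 3 (λ a b c → (a :- b) :+ (b :- c) := a :- c) ≡.refl (g 0) (g n) (g (suc n)))

    -- Along a coset of the subgroup of order p, Δ a is the difference of consecutive values of b
    -- and telescopes; after p steps the argument has grown by N.
    p-line-sum : ∀ {a} → Periodic a → ∀ x → ℤSums.∑ p (λ k → Δ a (k ℕ.* P₀ ℕ.+ x)) ≡ 0ℤ
    p-line-sum {a} per x = ≡.trans (ℤSums.∑-cong p {λ k → Δ a (k ℕ.* P₀ ℕ.+ x)}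
      {λ k → b (k ℕ.* P₀ ℕ.+ x) ℤ.- b (suc k ℕ.* P₀ ℕ.+ x)} (λ k _ → pointwise k))
      (≡.trans (telescope p (λ k → b (k ℕ.* P₀ ℕ.+ x)))
        (ℤ.i≡j⇒i-j≡0 (≡.sym (≡.trans (≡.cong (λ m → b (m ℕ.+ x)) (≡.sym N≡pP₀))
        (≡.cong₂ ℤ._-_ (per x) (shift-periodic Q₀ per x))))))
      where
      b : ℕ → ℤ
      b z = a z ℤ.- a (Q₀ ℕ.+ z)
      pointwise : ∀ k → Δ a (k ℕ.* P₀ ℕ.+ x) ≡ b (k ℕ.* P₀ ℕ.+ x) ℤ.- b (suc k ℕ.* P₀ ℕ.+ x)
      pointwise k rewrite ℕ.+-assoc P₀ (k ℕ.* P₀) x | x∙yz≡y∙xz Q₀ P₀ (k ℕ.* P₀ ℕ.+ x) =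
        ℤSums.solve 4 (λ s t u v → (s :- t) :- (u :- v) := (s :- u) :- (t :- v)) ≡.refl (a (k ℕ.* P₀ ℕ.+ x))
          (a (P₀ ℕ.+ (k ℕ.* P₀ ℕ.+ x))) (a (Q₀ ℕ.+ (k ℕ.* P₀ ℕ.+ x))) (a (P₀ ℕ.+ (Q₀ ℕ.+ (k ℕ.* P₀ ℕ.+ x))))

    q-line-sum : ∀ {a} → Periodic a → ∀ x → ℤSums.∑ q (λ l → Δ a (l ℕ.* Q₀ ℕ.+ x)) ≡ 0ℤ
    q-line-sum {a} per x = ≡.trans (ℤSums.∑-cong q {λ l → Δ a (l ℕ.* Q₀ ℕ.+ x)}
      {λ l → b (l ℕ.* Q₀ ℕ.+ x) ℤ.- b (suc l ℕ.* Q₀ ℕ.+ x)} (λ l _ → pointwise l))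
      (≡.trans (telescope q (λ l → b (l ℕ.* Q₀ ℕ.+ x)))
        (ℤ.i≡j⇒i-j≡0 (≡.sym (≡.trans (≡.cong (λ m → b (m ℕ.+ x)) (≡.sym N≡qQ₀))
        (≡.cong₂ ℤ._-_ (per x) (shift-periodic P₀ per x))))))
      where
      b : ℕ → ℤ
      b z = a z ℤ.- a (P₀ ℕ.+ z)
      pointwise : ∀ l → Δ a (l ℕ.* Q₀ ℕ.+ x) ≡ b (l ℕ.* Q₀ ℕ.+ x) ℤ.- b (suc l ℕ.* Q₀ ℕ.+ x)
      pointwise l rewrite ℕ.+-assoc Q₀ (l ℕ.* Q₀) x = ≡.refl

    %-congʳ-+ : ∀ {m n} c → m % N ≡ n % N → (m ℕ.+ c) % N ≡ (n ℕ.+ c) % N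
    %-congʳ-+ {m} {n} c eq = ≡.trans (%-distribˡ-+ m c N)
      (≡.trans (≡.cong (λ k → (k ℕ.+ c % N) % N) eq) (≡.sym (%-distribˡ-+ n c N)))

    -- In the conclusion the factor `pred p` stands for -1, so it expresses i ≡ i′ modulo p and j ≡
    -- j′ modulo q. The proof adds to both points the negative `c` of the second one, written with
    -- such factors.
    separation : ∀ x i j i′ j′ → (pt i j ℕ.+ x) % N ≡ (pt i′ j′ ℕ.+ x) % N → p ∣ℕ i ℕ.+ ℕ.pred p ℕ.* i′ ∧
      q ∣ℕ j ℕ.+ ℕ.pred q ℕ.* j′
    separation x i j i′ j′ eq = pt-∣ _ _ (∣m+n∣m⇒∣n (≡.subst (N ∣ℕ_) left N∣) (n∣m*n x))
      where
      c = ℕ.pred N ℕ.* x ℕ.+ pt (ℕ.pred p ℕ.* i′) (ℕ.pred q ℕ.* j′)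
      gather : ∀ i j i′ j′ → (pt i j ℕ.+ x) ℕ.+ (ℕ.pred N ℕ.* x ℕ.+ pt i′ j′) ≡ x ℕ.* suc (ℕ.pred N) ℕ.+ pt (i ℕ.+ i′)
        (j ℕ.+ j′)
      gather i j i′ j′ = gather-identity i j i′ j′ P₀ Q₀ x (ℕ.pred N)
      left : (pt i j ℕ.+ x) ℕ.+ c ≡ x ℕ.* N ℕ.+ pt (i ℕ.+ ℕ.pred p ℕ.* i′) (j ℕ.+ ℕ.pred q ℕ.* j′)
      left = ≡.trans (gather i j _ _)
        (≡.cong (λ n → x ℕ.* n ℕ.+ pt (i ℕ.+ ℕ.pred p ℕ.* i′) (j ℕ.+ ℕ.pred q ℕ.* j′)) (ℕ.suc-pred N))
      multiple : ∀ {r} → Prime r → ∀ i → r ∣ℕ i ℕ.+ ℕ.pred r ℕ.* i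
      multiple {r} pr i = ≡.subst (λ n → n ∣ℕ i ℕ.+ ℕ.pred r ℕ.* i) (ℕ.suc-pred r {{prime⇒nonZero pr}}) (m∣m*n i)
      right : N ∣ℕ (pt i′ j′ ℕ.+ x) ℕ.+ c
      right = ≡.subst (N ∣ℕ_) (≡.sym (≡.trans (gather i′ j′ _ _)
        (≡.cong (λ n → x ℕ.* n ℕ.+ pt (i′ ℕ.+ ℕ.pred p ℕ.* i′) (j′ ℕ.+ ℕ.pred q ℕ.* j′)) (ℕ.suc-pred N))))
        (∣m∣n⇒∣m+n (n∣m*n x) (∣-pt (multiple pp i′) (multiple pq j′)))
      N∣ : N ∣ℕ (pt i j ℕ.+ x) ℕ.+ c
      N∣ = m%n≡0⇒n∣m _ N (≡.trans (%-congʳ-+ c eq) (n∣m⇒m%n≡0 _ N right))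

    ∣pred*⇒≡1 : ∀ {r} → Prime r → ∀ l → 0 ℕ.< l → l ℕ.< r → r ∣ℕ 1 ℕ.+ ℕ.pred r ℕ.* l → l ≡ 1
    ∣pred*⇒≡1 {r} pr (suc l) _ l<r h with l ℕ.≟ 0
    ... | yes ≡.refl = ≡.refl
    ... | no l≢0 = contradiction (∣m+n∣m⇒∣n (≡.subst (r ∣ℕ_) eq (m∣m*n (suc l))) h)
      (>⇒∤ {{ℕ.≢-nonZero l≢0}} (ℕ.<-trans (ℕ.n<1+n l) l<r))
      where
      eq : r ℕ.* suc l ≡ (1 ℕ.+ ℕ.pred r ℕ.* suc l) ℕ.+ l
      eq = ≡.trans (≡.cong (ℕ._* suc l) (≡.sym (ℕ.suc-pred r {{prime⇒nonZero pr}})))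
        (≡.cong suc (ℕ.+-comm l (ℕ.pred r ℕ.* suc l)))

    prime∤small : ∀ {r k} → Prime r → 0 ℕ.< k → k ℕ.< r → ¬ (r ∣ℕ k)
    prime∤small pr 0<k k<r = >⇒∤ {{ℕ.>-nonZero 0<k}} k<r

    -- A function with vanishing sums along the cosets of the subgroups of order p and q whose squares
    -- sum to 4 lives on four points, the corners of a rectangle.
    module Rectangle (r : ℕ → ℤ) (r-periodic : Periodic r) (∑r²≡4 : ℤSums.∑ N (λ x → r x ℤ.* r x) ≡ + 4)
      (p-lines : ∀ x → ℤSums.∑ p (λ k → r (k ℕ.* P₀ ℕ.+ x)) ≡ 0ℤ)
        (q-lines : ∀ x → ℤSums.∑ q (λ l → r (l ℕ.* Q₀ ℕ.+ x)) ≡ 0ℤ)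
      (x : ℕ) (positive : 0ℤ ℤ.< r x ℤ.* r (pt 1 1 ℕ.+ x)) where

      private
        X₀≢0 : r x ≢ 0ℤ
        X₀≢0 eq = ℤ.<-irrefl ≡.refl (≡.subst (0ℤ ℤ.<_) (≡.cong (ℤ._* r (pt 1 1 ℕ.+ x)) eq) positive)

        X₃≢0 : r (pt 1 1 ℕ.+ x) ≢ 0ℤ
        X₃≢0 eq = ℤ.<-irrefl ≡.refl (≡.subst (0ℤ ℤ.<_) (≡.trans (≡.cong (r x ℤ.*_) eq) (ℤ.*-zeroʳ (r x))) positive)

        pt-p : ∀ k x → pt k 0 ℕ.+ x ≡ k ℕ.* P₀ ℕ.+ x
        pt-p k x = ≡.cong (ℕ._+ x) (ℕ.+-identityʳ (k ℕ.* P₀))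

        -- Nonzero values at x, at one more point of its p-line, at one more point of its q-line and
        -- at x + (1, 1) use up the sum of squares 4, so r vanishes elsewhere. The offsets k and l
        -- are still unknown.
        module FourPoints (k l : ℕ) (0<k : 0 ℕ.< k) (k<p : k ℕ.< p) (0<l : 0 ℕ.< l) (l<q : l ℕ.< q)
          (X₁≢0 : r (pt k 0 ℕ.+ x) ≢ 0ℤ) (X₂≢0 : r (pt 0 l ℕ.+ x) ≢ 0ℤ) where

          res : ℕ → ℕ → ℕ
          res i j = (pt i j ℕ.+ x) % N

          ks : List ℕ
          ks = res 0 0 ∷ res k 0 ∷ res 0 l ∷ res 1 1 ∷ []

          unpad : ∀ {r n m} → r ∣ℕ n ℕ.+ m ℕ.* 0 → r ∣ℕ n
          unpad {r} {n} {m} = ≡.subst (r ∣ℕ_) (≡.trans (≡.cong (n ℕ.+_) (ℕ.*-zeroʳ m)) (ℕ.+-identityʳ n))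

          unique : Unique ks
          unique =
            ((λ eq → prime∤small pp 0<k k<p (unpad {n = k} {ℕ.pred p} (proj₁ (separation x k 0 0 0 (≡.sym eq)))))
             ∷ (λ eq → prime∤small pq 0<l l<q (unpad {n = l} {ℕ.pred q} (proj₂ (separation x 0 l 0 0 (≡.sym eq)))))
             ∷ (λ eq → prime∤1 pp (unpad {n = 1} {ℕ.pred p} (proj₁ (separation x 1 1 0 0 (≡.sym eq)))))
             ∷ [])
            ∷ ((λ eq → prime∤small pq 0<l l<q (unpad {n = l} {ℕ.pred q} (proj₂ (separation x 0 l k 0 (≡.sym eq)))))
             ∷ (λ eq → prime∤1 pq (unpad {n = 1} {ℕ.pred q} (proj₂ (separation x 1 1 k 0 (≡.sym eq)))))
             ∷ [])
            ∷ ((λ eq → prime∤1 pp (unpad {n = 1} {ℕ.pred p} (proj₁ (separation x 1 1 0 l (≡.sym eq))))) ∷ [])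
            ∷ [] ∷ []

          below : All (ℕ._< N) ks
          below = m%n<n _ N ∷ m%n<n _ N ∷ m%n<n _ N ∷ m%n<n _ N ∷ []

          at-res : ∀ {i j} → r (pt i j ℕ.+ x) ≢ 0ℤ → 1ℤ ℤ.≤ r (res i j) ℤ.* r (res i j)
          at-res {i} {j} h = square-positive (h ∘ ≡.trans (periodic-% r-periodic (pt i j ℕ.+ x)))

          support : ∀ z → z ℕ.< N → All (z ≢_) ks → r z ≡ 0ℤ
          support z z<N z∉ with r z ℤ.≟ 0ℤ
          ... | yes eq = eq
          ... | no rz≢0 = contradiction (ℤ.≤-trans five
            (points-≤ N (z ∷ ks) sq (λ i _ → square-nonneg (r i)) (z∉ ∷ unique) (z<N ∷ below))) (4≱5 ∑r²≡4)
            where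
            sq : ℕ → ℤ
            sq x = r x ℤ.* r x
            five : + 5 ℤ.≤ ℤ-points (z ∷ ks) sq
            five = ℤ.+-mono-≤ {1ℤ} {sq z} {+ 4} {ℤ-points ks sq} (square-positive rz≢0)
              (ℤ.+-mono-≤ {1ℤ} {sq (res 0 0)} {+ 3} (at-res {0} {0} X₀≢0)
              (ℤ.+-mono-≤ {1ℤ} {sq (res k 0)} {+ 2} (at-res {k} {0} X₁≢0)
              (ℤ.+-mono-≤ {1ℤ} {sq (res 0 l)} {+ 1} (at-res {0} {l} X₂≢0)
                (ℤ.+-mono-≤ {1ℤ} {sq (res 1 1)} {+ 0} {+ 0} (at-res {1} {1} X₃≢0) ℤ.≤-refl))))
            4≱5 : ∀ {i} → i ≡ + 4 → ¬ (+ 5 ℤ.≤ i)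
            4≱5 ≡.refl (ℤ.+≤+ (s≤s (s≤s (s≤s (s≤s ())))))

          among : ∀ i j → r (pt i j ℕ.+ x) ≢ 0ℤ → (res i j ≡ res 0 0 ⊎ res i j ≡ res k 0) ⊎
            (res i j ≡ res 0 l ⊎ res i j ≡ res 1 1)
          among i j h with res i j ℕ.≟ res 0 0 | res i j ℕ.≟ res k 0 | res i j ℕ.≟ res 0 l | res i j ℕ.≟ res 1 1
          ... | yes e | _ | _ | _ = inj₁ (inj₁ e)
          ... | no _ | yes e | _ | _ = inj₁ (inj₂ e)
          ... | no _ | no _ | yes e | _ = inj₂ (inj₁ e)
          ... | no _ | no _ | no _ | yes e = inj₂ (inj₂ e)
          ... | no a | no b | no c | no d =
            contradiction (≡.trans (periodic-% r-periodic (pt i j ℕ.+ x))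
            (support (res i j) (m%n<n _ N) (a ∷ b ∷ c ∷ d ∷ []))) h

          -- The p-line through x + (1, 1) has sum 0, so it meets the support a second time. That
          -- point has q-coordinate 1, which leaves only the corner (0, l).
          l≡1 : l ≡ 1
          l≡1 with nonzero-elsewhere p (λ k → r (k ℕ.* P₀ ℕ.+ (pt 1 1 ℕ.+ x))) (ℕ.>-nonZero⁻¹ p {{prime⇒nonZero pp}})
            (p-lines (pt 1 1 ℕ.+ x)) X₃≢0
          ... | k′ , 0<k′ , k′<p , h = conclude (among (suc k′) 1 (h ∘ ≡.trans (≡.cong r move)))
            where
            move : k′ ℕ.* P₀ ℕ.+ (pt 1 1 ℕ.+ x) ≡ pt (suc k′) 1 ℕ.+ x
            move = move-p k′ P₀ Q₀ x
            conclude : _ → l ≡ 1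
            conclude (inj₁ (inj₁ e)) = contradiction (unpad {n = 1} {ℕ.pred q} (proj₂ (separation x (suc k′) 1 0 0 e)))
              (prime∤1 pq)
            conclude (inj₁ (inj₂ e)) = contradiction (unpad {n = 1} {ℕ.pred q} (proj₂ (separation x (suc k′) 1 k 0 e)))
              (prime∤1 pq)
            conclude (inj₂ (inj₁ e)) = ∣pred*⇒≡1 pq l 0<l l<q (proj₂ (separation x (suc k′) 1 0 l e))
            conclude (inj₂ (inj₂ e)) = contradiction
              (∣m+n∣m⇒∣n (≡.subst (p ∣ℕ_) shuffle (proj₁ (separation x (suc k′) 1 1 1 e))) ∣-refl)
              (prime∤small pp 0<k′ k′<p)
              where
              shuffle : suc k′ ℕ.+ ℕ.pred p ℕ.* 1 ≡ p ℕ.+ k′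
              shuffle = ≡.trans (≡.cong (λ m → suc (k′ ℕ.+ m)) (ℕ.*-identityʳ (ℕ.pred p)))
                (≡.trans (ℕ.+-comm (suc k′) (ℕ.pred p))
                (≡.trans (ℕ.+-suc (ℕ.pred p) k′) (≡.cong (ℕ._+ k′) (ℕ.suc-pred p {{prime⇒nonZero pp}}))))

          k≡1 : k ≡ 1
          k≡1 with nonzero-elsewhere q (λ l → r (l ℕ.* Q₀ ℕ.+ (pt 1 1 ℕ.+ x))) (ℕ.>-nonZero⁻¹ q {{prime⇒nonZero pq}})
            (q-lines (pt 1 1 ℕ.+ x)) X₃≢0
          ... | l′ , 0<l′ , l′<q , h = conclude (among 1 (suc l′) (h ∘ ≡.trans (≡.cong r move)))
            where
            move : l′ ℕ.* Q₀ ℕ.+ (pt 1 1 ℕ.+ x) ≡ pt 1 (suc l′) ℕ.+ x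
            move = move-q l′ P₀ Q₀ x
            conclude : _ → k ≡ 1
            conclude (inj₁ (inj₁ e)) = contradiction (unpad {n = 1} {ℕ.pred p} (proj₁ (separation x 1 (suc l′) 0 0 e)))
              (prime∤1 pp)
            conclude (inj₁ (inj₂ e)) = ∣pred*⇒≡1 pp k 0<k k<p (proj₁ (separation x 1 (suc l′) k 0 e))
            conclude (inj₂ (inj₁ e)) = contradiction (unpad {n = 1} {ℕ.pred p} (proj₁ (separation x 1 (suc l′) 0 l e)))
              (prime∤1 pp)
            conclude (inj₂ (inj₂ e)) = contradiction
              (∣m+n∣m⇒∣n (≡.subst (q ∣ℕ_) shuffle (proj₂ (separation x 1 (suc l′) 1 1 e))) ∣-refl)
              (prime∤small pq 0<l′ l′<q)
              where
              shuffle : suc l′ ℕ.+ ℕ.pred q ℕ.* 1 ≡ q ℕ.+ l′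
              shuffle = ≡.trans (≡.cong (λ m → suc (l′ ℕ.+ m)) (ℕ.*-identityʳ (ℕ.pred q)))
                (≡.trans (ℕ.+-comm (suc l′) (ℕ.pred q))
                (≡.trans (ℕ.+-suc (ℕ.pred q) l′) (≡.cong (ℕ._+ l′) (ℕ.suc-pred q {{prime⇒nonZero pq}}))))

        p-line = nonzero-elsewhere p (λ k → r (k ℕ.* P₀ ℕ.+ x)) (ℕ.>-nonZero⁻¹ p {{prime⇒nonZero pp}}) (p-lines x) X₀≢0
        q-line = nonzero-elsewhere q (λ l → r (l ℕ.* Q₀ ℕ.+ x)) (ℕ.>-nonZero⁻¹ q {{prime⇒nonZero pq}}) (q-lines x) X₀≢0

        to-pt : ∀ k → r (k ℕ.* P₀ ℕ.+ x) ≢ 0ℤ → r (pt k 0 ℕ.+ x) ≢ 0ℤ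
        to-pt k h = h ∘ ≡.trans (≡.cong r (≡.sym (pt-p k x)))

        -- Any offset with a nonzero value can be fed to `FourPoints` and is therefore 1; so the
        -- p-line through x carries just two nonzero values.
        p-unique : ∀ k → 0 ℕ.< k → k ℕ.< p → r (k ℕ.* P₀ ℕ.+ x) ≢ 0ℤ → k ≡ 1
        p-unique k 0<k k<p h = FourPoints.k≡1 k (proj₁ q-line) 0<k k<p (proj₁ (proj₂ q-line))
          (proj₁ (proj₂ (proj₂ q-line))) (to-pt k h) (proj₂ (proj₂ (proj₂ q-line)))

        q-unique : ∀ l → 0 ℕ.< l → l ℕ.< q → r (l ℕ.* Q₀ ℕ.+ x) ≢ 0ℤ → l ≡ 1
        q-unique l 0<l l<q h = FourPoints.l≡1 (proj₁ p-line) l (proj₁ (proj₂ p-line)) (proj₁ (proj₂ (proj₂ p-line))) 0<l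
          l<q (to-pt (proj₁ p-line) (proj₂ (proj₂ (proj₂ p-line)))) h

        1<prime : ∀ {r} → Prime r → 1 ℕ.< r
        1<prime {r} pr = ℕ.nonTrivial⇒n>1 r {{prime⇒nonTrivial pr}}

        s t : ℤ
        s = r x
        t = r (pt 1 1 ℕ.+ x)

        negative : ∀ {i j} → i ℤ.+ j ≡ 0ℤ → j ≡ ℤ.- i
        negative {i} {j} eq = ≡.trans (ℤSums.solve 2 (λ i j → j := (i :+ j) :- i) ≡.refl i j)
          (≡.trans (≡.cong (ℤ._- i) eq) (ℤ.+-identityˡ (ℤ.- i)))

        r₁ : r (pt 1 0 ℕ.+ x) ≡ ℤ.- s
        r₁ = ≡.trans (≡.cong r (pt-p 1 x)) (negative (≡.trans (≡.sym (sum-of-two p (λ k → r (k ℕ.* P₀ ℕ.+ x)) (1<prime pp) p-unique)) (p-lines x)))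

        r₂ : r (pt 0 1 ℕ.+ x) ≡ ℤ.- s
        r₂ = negative (≡.trans (≡.sym (sum-of-two q (λ l → r (l ℕ.* Q₀ ℕ.+ x)) (1<prime pq) q-unique)) (q-lines x))

        -s≢0 : ℤ.- s ≢ 0ℤ
        -s≢0 eq = X₀≢0 (≡.trans (≡.sym (ℤ.neg-involutive s)) (≡.cong ℤ.-_ eq))

        open FourPoints 1 1 (s≤s z≤n) (1<prime pp) (s≤s z≤n) (1<prime pq) (-s≢0 ∘ ≡.trans (≡.sym r₁)) (-s≢0 ∘ ≡.trans (≡.sym r₂))

        r-res : ∀ i j → r (res i j) ≡ r (pt i j ℕ.+ x)
        r-res i j = ≡.sym (periodic-% r-periodic (pt i j ℕ.+ x))

        -- Three corners carry s or - s and the fourth carries t. From 3 s² + t² ≤ 4 with s and t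
        -- nonzero, both are 1 or -1, and s t > 0 makes them equal.
        sum≤4 : s ℤ.* s ℤ.+ (s ℤ.* s ℤ.+ (s ℤ.* s ℤ.+ (t ℤ.* t ℤ.+ 0ℤ))) ℤ.≤ + 4
        sum≤4 = ≡.subst₂ ℤ._≤_ (≡.cong₂ ℤ._+_ (sq (r-res 0 0))
          (≡.cong₂ ℤ._+_ (≡.trans (sq (≡.trans (r-res 1 0) r₁)) neg-sq)
          (≡.cong₂ ℤ._+_ (≡.trans (sq (≡.trans (r-res 0 1) r₂)) neg-sq) (≡.cong (ℤ._+ 0ℤ) (sq (r-res 1 1)))))) ∑r²≡4
          (points-≤ N ks (λ x → r x ℤ.* r x) (λ i _ → square-nonneg (r i)) unique below)
          where
          sq : ∀ {u v} → u ≡ v → u ℤ.* u ≡ v ℤ.* v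
          sq ≡.refl = ≡.refl
          neg-sq : (ℤ.- s) ℤ.* (ℤ.- s) ≡ s ℤ.* s
          neg-sq = ℤSums.solve 1 (λ s → (:- s) :* (:- s) := s :* s) ≡.refl s

        s²≥1 = square-positive X₀≢0
        t²≥1 = square-positive X₃≢0

        s²≤1 : s ℤ.* s ℤ.≤ 1ℤ
        s²≤1 = +ℤ-cancelˡ-≤ (+ 3) (ℤ.≤-trans
          (≡.subst (ℤ._≤ s ℤ.* s ℤ.+ (s ℤ.* s ℤ.+ (s ℤ.* s ℤ.+ (t ℤ.* t ℤ.+ 0ℤ)))) (ℤ.+-comm (s ℤ.* s) (+ 3))
          (ℤ.+-monoʳ-≤ (s ℤ.* s) (ℤ.+-mono-≤ s²≥1 (ℤ.+-mono-≤ s²≥1 (ℤ.+-monoˡ-≤ 0ℤ t²≥1))))) sum≤4)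

        t²≤1 : t ℤ.* t ℤ.≤ 1ℤ
        t²≤1 = +ℤ-cancelˡ-≤ (+ 3) (ℤ.≤-trans
          (≡.subst₂ ℤ._≤_ (ℤSums.solve 1 (λ t → con 1ℤ :+ (con 1ℤ :+ (con 1ℤ :+ (t :+ con 0ℤ))) := con (+ 3) :+ t)
          ≡.refl (t ℤ.* t)) ≡.refl
          (ℤ.+-mono-≤ s²≥1 (ℤ.+-mono-≤ s²≥1 (ℤ.+-monoˡ-≤ (t ℤ.* t ℤ.+ 0ℤ) s²≥1)))) sum≤4)

        unit : ∀ i → i ≢ 0ℤ → i ℤ.* i ℤ.≤ 1ℤ → i ≡ 1ℤ ⊎ i ≡ ℤ.- 1ℤ
        unit (+ 0) h _ = contradiction ≡.refl h
        unit (+ 1) _ _ = inj₁ ≡.refl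
        unit (+ suc (suc n)) _ (ℤ.+≤+ (s≤s ()))
        unit -[1+ 0 ] _ _ = inj₂ ≡.refl
        unit -[1+ suc n ] _ (ℤ.+≤+ (s≤s ()))

        s-unit : s ≡ 1ℤ ⊎ s ≡ ℤ.- 1ℤ
        s-unit = unit s X₀≢0 s²≤1

        same-sign : ∀ s t → 0ℤ ℤ.< s ℤ.* t → s ≡ 1ℤ ⊎ s ≡ ℤ.- 1ℤ → t ≡ 1ℤ ⊎ t ≡ ℤ.- 1ℤ → t ≡ s
        same-sign _ _ pos (inj₁ ≡.refl) (inj₁ ≡.refl) = ≡.refl
        same-sign _ _ () (inj₁ ≡.refl) (inj₂ ≡.refl)
        same-sign _ _ () (inj₂ ≡.refl) (inj₁ ≡.refl)
        same-sign _ _ pos (inj₂ ≡.refl) (inj₂ ≡.refl) = ≡.refl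

        t≡s : t ≡ s
        t≡s = same-sign s t positive s-unit (unit t X₃≢0 t²≤1)

        η θ : Carrier
        η = ζ ^ P₀
        θ = ζ ^ Q₀

        ζ^pt : ∀ i j → ζ ^ (pt i j ℕ.+ x) ≈ (η ^ i * θ ^ j) * ζ ^ x
        ζ^pt i j = trans (^-homo-* ζ (pt i j) x)
          (*-congʳ (trans (^-homo-* ζ (i ℕ.* P₀) (j ℕ.* Q₀)) (*-cong (pow-* i P₀) (pow-* j Q₀))))
          where
          pow-* : ∀ i P → ζ ^ (i ℕ.* P) ≈ (ζ ^ P) ^ i
          pow-* i P = trans (^-congʳ ζ (ℕ.*-comm i P)) (sym (^-assocʳ ζ P i))

        at : ∀ i j {c} → r (pt i j ℕ.+ x) ≡ c → ι (r (res i j)) * ζ ^ res i j ≈ ι c * ((η ^ i * θ ^ j) * ζ ^ x)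
        at i j eq = *-cong (reflexive (≡.cong ι (≡.trans (r-res i j) eq))) (trans (^-% ζ^N≈1 (pt i j ℕ.+ x)) (ζ^pt i j))

      corners : F N r ζ ≈ (ι (r x) * ζ ^ x) * ((η - 1#) * (θ - 1#))
      corners = begin
          F N r ζ
            ≈⟨ ∑-support N ks (λ i → ι (r i) * ζ ^ i) unique below
            (λ i i<N i∉ → trans (*-congʳ (reflexive (≡.cong ι (support i i<N i∉)))) (zeroˡ _)) ⟩
          ∑-points ks (λ i → ι (r i) * ζ ^ i)
            ≈⟨ +-cong (at 0 0 ≡.refl) (+-cong (trans (at 1 0 r₁) (*-congʳ (ι-neg s)))
              (+-cong (trans (at 0 1 r₂) (*-congʳ (ι-neg s))) (+-congʳ (at 1 1 t≡s)))) ⟩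
          ι s * ((1# * 1#) * ζ ^ x) + (- ι s * ((η * 1# * 1#) * ζ ^ x) +
            (- ι s * ((1# * (θ * 1#)) * ζ ^ x) + (ι s * ((η * 1# * (θ * 1#)) * ζ ^ x) + 0#)))
            ≈⟨ +-cong (*-congˡ (*-congʳ (*-identityˡ _)))
              (+-cong (*-congˡ (*-congʳ (trans (*-identityʳ _) (*-identityʳ _))))
              (+-cong (*-congˡ (*-congʳ (trans (*-identityˡ _) (*-identityʳ _))))
              (trans (+-identityʳ _) (*-congˡ (*-congʳ (*-cong (*-identityʳ _) (*-identityʳ _))))))) ⟩
          ι s * (1# * ζ ^ x) + (- ι s * (η * ζ ^ x) + (- ι s * (θ * ζ ^ x) + ι s * ((η * θ) * ζ ^ x)))
            ≈⟨ +-congʳ (*-congˡ (*-congʳ ι-1)) ⟨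
          ι s * (ι 1ℤ * ζ ^ x) + (- ι s * (η * ζ ^ x) + (- ι s * (θ * ζ ^ x) + ι s * ((η * θ) * ζ ^ x)))
            ≈⟨ solve 4 (λ s z h t → s :* (con 1ℤ :* z) :+
              (:- s :* (h :* z) :+ (:- s :* (t :* z) :+ s :* ((h :* t) :* z))) := (s :* z) :*
              ((h :- con 1ℤ) :* (t :- con 1ℤ))) ≡.refl (ι s) (ζ ^ x) η θ ⟩
          (ι s * ζ ^ x) * ((η - ι 1ℤ) * (θ - ι 1ℤ)) ≈⟨ *-congˡ (*-cong (+-congˡ (-‿cong ι-1)) (+-congˡ (-‿cong ι-1))) ⟩
          (ι s * ζ ^ x) * ((η - 1#) * (θ - 1#)) ∎

      sign : r x ≡ 1ℤ ⊎ r x ≡ ℤ.- 1ℤ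
      sign = s-unit

    Corners : (ℕ → ℤ) → Set
    Corners r = ∃[ c ] ∃[ x ] ((c ≡ 1ℤ ⊎ c ≡ ℤ.- 1ℤ) ∧ F N r ζ ≈ (ι c * ζ ^ x) * ((ζ ^ P₀ - 1#) * (ζ ^ Q₀ - 1#)))

    -- A positive autocorrelation at (1, 1) has a positive summand, which supplies a point x with
    -- nonzero values of equal sign at x and x + (1, 1).
    rectangle : ∀ r → Periodic r → ℤSums.∑ N (λ x → r x ℤ.* r x) ≡ + 4 →
      (∀ x → ℤSums.∑ p (λ k → r (k ℕ.* P₀ ℕ.+ x)) ≡ 0ℤ) → (∀ x → ℤSums.∑ q (λ l → r (l ℕ.* Q₀ ℕ.+ x)) ≡ 0ℤ) →
        0ℤ ℤ.< ν r (pt 1 1) → Corners r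
    rectangle r r-periodic ∑r²≡4 p-lines q-lines positive = r x , x , Rectangle.sign r r-periodic ∑r²≡4 p-lines q-lines
      x pos , Rectangle.corners r r-periodic ∑r²≡4 p-lines q-lines x pos
      where
      found : ∃[ x ] (x ℕ.< N ∧ 0ℤ ℤ.< r x ℤ.* r (pt 1 1 ℕ.+ x))
      found = ∑-positive N (λ x → r x ℤ.* r (pt 1 1 ℕ.+ x)) positive
      x : ℕ
      x = proj₁ found
      pos : 0ℤ ℤ.< r x ℤ.* r (pt 1 1 ℕ.+ x)
      pos = proj₂ (proj₂ found)

    -- An elementary case of Kronecker's theorem. Up to a power of ζ, the transform of Δ a is that
    -- of a times (ζ^P₀ - 1) (ζ^Q₀ - 1), and the four corners give a signed power of ζ times the
    -- same product. The product is not 0 and cancels.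
    signed-root : ∀ {a} → Periodic a → F N a (conj ζ) * F N a ζ ≈ 1# →
      ∃[ c ] ∃[ j ] ((c ≡ 1ℤ ⊎ c ≡ ℤ.- 1ℤ) ∧ F N a ζ ≈ ι c * ζ ^ j)
    signed-root {a} per norm≈1 = c , (Q₀ ℕ.+ P₀) ℕ.+ x , proj₁ (proj₂ (proj₂ rect)) , cases (domain _ _ difference)
      where
      rect : Corners (Δ a)
      rect = rectangle (Δ a) (Δ-periodic per) (NormOne.∑r²≡4 per norm≈1) (p-line-sum per) (q-line-sum per)
        (NormOne.ν-r-diagonal>0 per norm≈1)
      c = proj₁ rect
      x = proj₁ (proj₂ rect)
      η θ w : Carrier
      η = ζ ^ P₀
      θ = ζ ^ Q₀
      w = ζ ^ (Q₀ ℕ.+ P₀)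
      difference : (F N a ζ - w * (ι c * ζ ^ x)) * ((η - 1#) * (θ - 1#)) ≈ 0#
      difference = trans (solve 4 (λ f w y e → (f :- w :* y) :* e := f :* e :- w :* (y :* e)) ≡.refl (F N a ζ) w
        (ι c * ζ ^ x) ((η - 1#) * (θ - 1#)))
        (≈⇒-≈0 (trans (sym (F-Δ per ζ^N≈1)) (*-congˡ (proj₂ (proj₂ (proj₂ rect))))))
      pad : ∀ {m} → N ∣ℕ m → N ∣ℕ m ℕ.+ 0
      pad {m} = ≡.subst (N ∣ℕ_) (≡.sym (ℕ.+-identityʳ m))
      nonzero : ¬ ((η - 1#) * (θ - 1#) ≈ 0#)
      nonzero h with domain _ _ h
      ... | inj₁ η≈1 = N∤P₀ (pad (order P₀ (-≈0⇒≈ η≈1)))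
      ... | inj₂ θ≈1 = N∤Q₀ (pad (order Q₀ (-≈0⇒≈ θ≈1)))
      cases : F N a ζ - w * (ι c * ζ ^ x) ≈ 0# ⊎ (η - 1#) * (θ - 1#) ≈ 0# → F N a ζ ≈ ι c * ζ ^ ((Q₀ ℕ.+ P₀) ℕ.+ x)
      cases (inj₁ h) = trans (-≈0⇒≈ h)
        (trans (solve 3 (λ w s z → w :* (s :* z) := s :* (w :* z)) ≡.refl w (ι c) (ζ ^ x))
        (*-congˡ (sym (^-homo-* ζ (Q₀ ℕ.+ P₀) x))))
      cases (inj₂ h) = contradiction h nonzero

-- Automorphisms and divisibility by powers of q

module LocalConjugation where

  open import Data.Nat.Divisibility using (>⇒∤)
  open import Data.Integer.Base using (+_)
  open import Data.Product.Base using () renaming (_×_ to _∧_)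
  open IntegerPolynomials
  open Arithmetic
  open Cyclotomic using (Root)

  module Local {N : ℕ} {{_ : NonZero N}} (M : Root N) {q : ℕ} (pq : Prime q) (L n : ℕ) .{{_ : NonZero L}}
    (N≡ : N ≡ L ℕ.* q ℕ.^ suc n) (L⊥q : Coprime L q) where

    open Root M
    open CommutativeRing R
    open RingSums R
    open Evaluation R
    open import Algebra.Properties.Semiring.Exp semiring using (_^_; ^-congˡ; ^-congʳ; ^-homo-*; ^-assocʳ)
    module P = CommutativeRing (polyRing ζ)
    module E = Conjugation.AtRoot R ζ
    module D = RingCongruences (polyRing ζ)
    module G = Conjugation.Galois R domain char0 N
    open E using (ιᴾ; ev-ι; _≋ᴾ_[_]; _^ᴾ_) public

    private
      instance
        nonZero-q : NonZero q
        nonZero-q = prime⇒nonZero pq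

    1<q : 1 ℕ.< q
    1<q = ℕ.nonTrivial⇒n>1 q {{prime⇒nonTrivial pq}}

    domainᴾ : ∀ a b → a ⊗ b P.≈ 𝟘 → a P.≈ 𝟘 ⊎ b P.≈ 𝟘
    domainᴾ a b = domain (ev ζ a) (ev ζ b)

    -- θ has order q^(n+1), and π = θ - 1 takes the place of the product of the distinct primes
    -- above q.
    θ π : Poly
    θ = power X L
    π = θ ⊕ ⊖ 𝟙

    ev-θ : ev ζ θ ≈ ζ ^ L
    ev-θ = ev-power ζ X L

    θ-^ : ∀ k → ev ζ (θ ^ᴾ k) ≈ ζ ^ (L ℕ.* k)
    θ-^ k = trans (E.ev-^ θ k) (trans (^-congˡ k ev-θ) (^-assocʳ ζ L k))

    θ-order : ∀ k → k ℕ.< q ℕ.^ suc n → 0 ℕ.< k → ¬ (θ ^ᴾ k P.≈ 𝟙)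
    θ-order k k< 0<k h = >⇒∤ {{ℕ.>-nonZero (ℕ.*-mono-≤ (ℕ.>-nonZero⁻¹ L) 0<k)}}
      (≡.subst (L ℕ.* k ℕ.<_) (≡.sym N≡) (ℕ.*-monoʳ-< L k<)) (order (L ℕ.* k) (trans (sym (θ-^ k)) h))

    ram : ∃[ e ] D.Ramification.Associated domainᴾ pq (π ^ᴾ suc e) (ιᴾ (+ q))
    ram = D.Ramification.ramified domainᴾ pq n θ
      (trans (θ-^ (q ℕ.^ suc n)) (trans (^-congʳ ζ (≡.sym N≡)) ζ^N≈1))
      (θ-order (q ℕ.^ n) (ℕ.^-monoʳ-< q 1<q (ℕ.n<1+n n)) (ℕ.m^n>0 q n))

    e : ℕ
    e = proj₁ ram

    π∣q : π D.∣ ιᴾ (+ q)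
    π∣q = D.∣-trans {π} {π ^ᴾ suc e} {ιᴾ (+ q)} (D.x∣x^suc {π} e) (proj₁ (proj₂ ram))

    π≉0 : ¬ (π P.≈ 𝟘)
    π≉0 h = θ-order 1 (ℕ.<-≤-trans 1<q (ℕ.m≤m*n q (q ℕ.^ n) {{ℕ.m^n≢0 q n}})) (s≤s z≤n)
      (trans (*-identityʳ _) (-≈0⇒≈ h))

    cancel : ∀ a b → π ⊗ a P.≈ π ⊗ b → a P.≈ b
    cancel a b eq with domain (ev ζ π) (ev ζ a - ev ζ b)
      (trans (solve 3 (λ p a b → p :* (a :- b) := p :* a :- p :* b) ≡.refl (ev ζ π) (ev ζ a) (ev ζ b)) (≈⇒-≈0 eq))
    ... | inj₁ h = contradiction h π≉0
    ... | inj₂ h = -≈0⇒≈ h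

    1≋θ^ : ∀ k → power X (k ℕ.* L) ≋ᴾ 𝟙 [ π ]
    1≋θ^ k = proj₁ d , (begin
      ev ζ (power X (k ℕ.* L))
        ≈⟨ trans (ev-power ζ X (k ℕ.* L))
        (trans (^-congʳ ζ (ℕ.*-comm k L)) (trans (sym (^-assocʳ ζ L k)) (^-congˡ k (sym ev-θ)))) ⟩
      ev ζ θ ^ k                              ≈⟨ E.ev-^ θ k ⟨
      ev ζ (θ ^ᴾ k)                           ≈⟨ solve 2 (λ x o → x := o :+ (x :- o)) ≡.refl (ev ζ (θ ^ᴾ k)) 1# ⟩
      1# + (ev ζ (θ ^ᴾ k) - 1#)               ≈⟨ +-congˡ (proj₂ d) ⟩
      1# + ev ζ π * ev ζ (proj₁ d)            ∎)
      where
      open import Relation.Binary.Reasoning.Setoid setoid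
      d = D.x-1∣xⁿ-1 θ k

    -- Modulo π the element ζ^L is 1, so exponents of ζ matter only modulo L.
    substitution-mod : ∀ u k f → f [ power X (u ℕ.+ k ℕ.* L) ] ≋ᴾ f [ power X u ] [ π ]
    substitution-mod u k 𝟘 = D.≋-refl {𝟘} {π}
    substitution-mod u k 𝟙 = D.≋-refl {𝟙} {π}
    substitution-mod u k X = D.≋-cong {power X u ⊗ power X (k ℕ.* L)} {power X u ⊗ 𝟙} {power X (u ℕ.+ k ℕ.* L)}
      {power X u} {π}
      (sym (trans (ev-power ζ X (u ℕ.+ k ℕ.* L))
        (trans (^-homo-* ζ u (k ℕ.* L)) (sym (*-cong (ev-power ζ X u) (ev-power ζ X (k ℕ.* L)))))))
      (*-identityʳ _) (D.≋-* {power X u} {power X u} {power X (k ℕ.* L)} {𝟙} {π} (D.≋-refl {power X u} {π}) (1≋θ^ k))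
    substitution-mod u k (a ⊕ b) = D.≋-+ {a [ power X (u ℕ.+ k ℕ.* L) ]} {a [ power X u ]}
      {b [ power X (u ℕ.+ k ℕ.* L) ]} {b [ power X u ]} {π} (substitution-mod u k a) (substitution-mod u k b)
    substitution-mod u k (a ⊗ b) = D.≋-* {a [ power X (u ℕ.+ k ℕ.* L) ]} {a [ power X u ]}
      {b [ power X (u ℕ.+ k ℕ.* L) ]} {b [ power X u ]} {π} (substitution-mod u k a) (substitution-mod u k b)
    substitution-mod u k (⊖ a) = D.-‿≋ {a [ power X (u ℕ.+ k ℕ.* L) ]} {a [ power X u ]} {π} (substitution-mod u k a)

    frobenius-^ : ∀ d f → f [ power X (q ℕ.^ d) ] ≋ᴾ f ^ᴾ (q ℕ.^ d) [ π ]
    frobenius-^ zero f = D.≋-cong {f} {f} {f [ power X 1 ]} {f ^ᴾ 1} {π}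
      (sym (trans (ev-[] ζ f (power X 1)) (ev-cong f (*-identityʳ ζ)))) (sym (*-identityʳ _)) (D.≋-refl {f} {π})
    frobenius-^ (suc d) f = D.≋-trans {f [ power X (q ℕ.^ suc d) ]} {f′ ^ᴾ q} {f ^ᴾ (q ℕ.^ suc d)} {π}
      (D.≋-sym {f′ ^ᴾ q} {f [ power X (q ℕ.^ suc d) ]} {π}
        (D.≋-cong {f′ ^ᴾ q} {f′ [ power X q ]} {f′ ^ᴾ q} {f [ power X (q ℕ.^ suc d) ]} {π} refl subst≈
        (D.≋-weaken {f′ ^ᴾ q} {f′ [ power X q ]} {ιᴾ (+ q)} {π} π∣q (E.frobenius pq f′))))
      (D.≋-cong {f′ ^ᴾ q} {(f ^ᴾ (q ℕ.^ d)) ^ᴾ q} {f′ ^ᴾ q} {f ^ᴾ (q ℕ.^ suc d)} {π} refl pow≈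
        (D.≋-^ {f′} {f ^ᴾ (q ℕ.^ d)} {π} q (frobenius-^ d f)))
      where
      f′ = f [ power X (q ℕ.^ d) ]
      pow≈ : ev ζ ((f ^ᴾ (q ℕ.^ d)) ^ᴾ q) ≈ ev ζ (f ^ᴾ (q ℕ.^ suc d))
      pow≈ = trans (E.ev-^ (f ^ᴾ (q ℕ.^ d)) q)
        (trans (^-congˡ q (E.ev-^ f (q ℕ.^ d)))
        (trans (^-assocʳ (ev ζ f) (q ℕ.^ d) q)
        (trans (^-congʳ (ev ζ f) (ℕ.*-comm (q ℕ.^ d) q)) (sym (E.ev-^ f (q ℕ.^ suc d))))))
      subst≈ : ev ζ (f′ [ power X q ]) ≈ ev ζ (f [ power X (q ℕ.^ suc d) ])
      subst≈ = trans (ev-[] ζ f′ (power X q)) (trans (ev-[] (ev ζ (power X q)) f (power X (q ℕ.^ d))) (trans (ev-cong f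
        (trans (ev-power (ev ζ (power X q)) X (q ℕ.^ d))
          (trans (^-congˡ (q ℕ.^ d) (ev-power ζ X q))
          (trans (^-assocʳ ζ q (q ℕ.^ d)) (sym (ev-power ζ X (q ℕ.^ suc d)))))))
        (sym (ev-[] ζ f (power X (q ℕ.^ suc d))))))

    -- Choose d with q^d ≡ 1 modulo L; then f ≡ f(ζ^(q^d)) ≡ f^(q^d) modulo π. This is the explicit
    -- form of the quotient by π having no nilpotents.
    reduced : ∀ B f → ∃[ l ] (B ℕ.≤ l ∧ f ≋ᴾ f ^ᴾ suc l [ π ])
    reduced B f = l , ℕ.≤-pred (≡.subst (suc B ℕ.≤_) (≡.sym suc-l) B<) ,
      D.≋-trans {f} {f [ power X (q ℕ.^ d) ]} {f ^ᴾ suc l} {π}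
        (D.≋-sym {f [ power X (q ℕ.^ d) ]} {f} {π}
          (D.≋-cong {f [ power X (1 ℕ.+ k ℕ.* L) ]} {f [ power X 1 ]} {f [ power X (q ℕ.^ d) ]} {f} {π}
          (reflexive (≡.cong (λ w → ev ζ (f [ power X w ])) (≡.sym q^d≡)))
            (trans (ev-[] ζ f (power X 1)) (ev-cong f (*-identityʳ ζ))) (substitution-mod 1 k f)))
        (≡.subst (λ w → f [ power X (q ℕ.^ d) ] ≋ᴾ f ^ᴾ w [ π ]) (≡.sym suc-l) (frobenius-^ d f))
      where
      big = large-power≡1 q L 1<q L⊥q B
      d = proj₁ big
      k = proj₁ (proj₂ big)
      B< : B ℕ.< q ℕ.^ d
      B< = proj₁ (proj₂ (proj₂ (proj₂ big)))
      q^d≡ : q ℕ.^ d ≡ 1 ℕ.+ k ℕ.* L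
      q^d≡ = proj₂ (proj₂ (proj₂ (proj₂ big)))
      l = ℕ.pred (q ℕ.^ d)
      suc-l : suc l ≡ q ℕ.^ d
      suc-l = ℕ.suc-pred (q ℕ.^ d) {{ℕ.m^n≢0 q d}}

    module _ (v d k : ℕ) (v≡ : v ≡ q ℕ.^ d ℕ.+ k ℕ.* L) (v⊥N : Coprime v N) where

      σ : Poly → Poly
      σ f = f [ power X v ]

      σ-ev : ∀ f → ev ζ (σ f) ≈ ev (ζ ^ v) f
      σ-ev f = trans (ev-[] ζ f (power X v)) (ev-cong f (ev-power ζ X v))

      -- Substitution respects equality of values by the Galois statement for a - b; this is where v
      -- prime to N enters.
      σ-cong : ∀ {a b} → a P.≈ b → σ a P.≈ σ b
      σ-cong {a} {b} h = trans (σ-ev a) (trans (-≈0⇒≈ (G.galois (a ⊕ ⊖ b) v v⊥N ζ^N≈1 (≈⇒-≈0 h))) (sym (σ-ev b)))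

      π∣σπ : π D.∣ σ π
      π∣σπ = proj₁ g , trans (+-congʳ eq) (proj₂ g)
        where
        g = D.x-1∣xⁿ-1 θ v
        eq : ev ζ (σ θ) ≈ ev ζ (θ ^ᴾ v)
        eq = trans (σ-ev θ) (trans (ev-power (ζ ^ v) X L)
          (trans (^-assocʳ ζ v L) (trans (^-congʳ ζ (ℕ.*-comm v L)) (sym (θ-^ v)))))

      private
        Q = ℕ.pred (q ℕ.^ d)
        suc-Q : suc Q ≡ q ℕ.^ d
        suc-Q = ℕ.suc-pred (q ℕ.^ d) {{ℕ.m^n≢0 q d}}

      σ-frobenius : ∀ f → σ f ≋ᴾ f ^ᴾ suc Q [ π ]
      σ-frobenius f = D.≋-trans {σ f} {f [ power X (q ℕ.^ d) ]} {f ^ᴾ suc Q} {π}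
        (≡.subst (λ w → f [ power X w ] ≋ᴾ f [ power X (q ℕ.^ d) ] [ π ]) (≡.sym v≡) (substitution-mod (q ℕ.^ d) k f))
        (≡.subst (λ w → f [ power X (q ℕ.^ d) ] ≋ᴾ f ^ᴾ w [ π ]) (≡.sym suc-Q) (frobenius-^ d f))

      π^∣σ : ∀ c x y → (π ^ᴾ c) D.∣ x ⊗ y → (π ^ᴾ c) D.∣ σ x ⊗ y
      π^∣σ = D.FrobeniusInvariance.^∣σ pq π π∣q cancel σ (λ {a} {b} → σ-cong {a} {b}) (λ _ _ → refl) (λ _ _ → refl) refl
        π∣σπ Q σ-frobenius reduced

      -- q and π^(e+1) divide each other, so powers of q are converted to powers of π and back.
      q^∣σ : ∀ c x y → (ιᴾ (+ q) ^ᴾ c) D.∣ x ⊗ y → (ιᴾ (+ q) ^ᴾ c) D.∣ σ x ⊗ y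
      q^∣σ c x y h = D.∣-trans {ιᴾ (+ q) ^ᴾ c} {(π ^ᴾ suc e) ^ᴾ c} {σ x ⊗ y}
        (D.∣-^ {ιᴾ (+ q)} {π ^ᴾ suc e} c (proj₂ (proj₂ ram)))
        (D.∣-congˡ {π ^ᴾ (suc e ℕ.* c)} {(π ^ᴾ suc e) ^ᴾ c} {σ x ⊗ y} (sym assoc)
          (π^∣σ (suc e ℕ.* c) x y (D.∣-congˡ {(π ^ᴾ suc e) ^ᴾ c} {π ^ᴾ (suc e ℕ.* c)} {x ⊗ y} assoc
            (D.∣-trans {(π ^ᴾ suc e) ^ᴾ c} {ιᴾ (+ q) ^ᴾ c} {x ⊗ y} (D.∣-^ {π ^ᴾ suc e} {ιᴾ (+ q)} c (proj₁ (proj₂ ram)))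
              h))))
        where
        assoc : ev ζ ((π ^ᴾ suc e) ^ᴾ c) ≈ ev ζ (π ^ᴾ (suc e ℕ.* c))
        assoc = trans (E.ev-^ (π ^ᴾ suc e) c)
          (trans (^-congˡ c (E.ev-^ π (suc e))) (trans (^-assocʳ (ev ζ π) (suc e) c) (sym (E.ev-^ π (suc e ℕ.* c)))))

-- From the norm to few exponents

module NormDescent where

  open import Data.Nat.Divisibility using () renaming (_∣_ to _∣ℕ_)
  open import Data.Integer.Base using (+_)
  open import Data.Product.Base using () renaming (_×_ to _∧_)
  open IntegerPolynomials
  open Cyclotomic
  import Data.Nat.Properties as ℕP
  open Arithmetic
  open IntegerBézout
  prime∣^⇒≡ : ∀ {p r} → Prime p → Prime r → ∀ m → r ∣ℕ p ℕ.^ m → r ≡ p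
  prime∣^⇒≡ {p} {r} pp pr m h with r ℕP.≟ p
  ... | yes r≡p = r≡p
  ... | no r≢p = contradiction h (prime-∤-^ pr pp r≢p m)

  module Core {N : ℕ} {{_ : NonZero N}} (M : Root N)
    {p q : ℕ} (pp : Prime p) (pq : Prime q) (p≢q : p ≢ q) (m n : ℕ) (N≡ : N ≡ p ℕ.^ suc m ℕ.* q ℕ.^ suc n) where

    open import Function.Base using (it)
    open import Data.Nat.Divisibility using (>⇒∤; ∣1⇒≡1; _∣?_; ∣m+n∣m⇒∣n; ∣m∣n⇒∣m+n; n∣m*n; ∣⇒≤)
    open import Data.Nat.DivMod using (_%_; m%n<n; m<n⇒m%n≡m; [m+n]%n≡m%n)
    open import Data.Nat.Coprimality as Coprimality using (Coprime; coprime-divisor)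
    open import Relation.Binary.Definitions using (tri<; tri≈; tri>)
    open import Data.Nat.Primality using (euclidsLemma)

    N-primes : ∀ {r} → Prime r → r ∣ℕ N → r ≡ p ⊎ r ≡ q
    N-primes pr r∣N with euclidsLemma (p ℕ.^ suc m) (q ℕ.^ suc n) pr (≡.subst (_ ∣ℕ_) N≡ r∣N)
    ... | inj₁ h = inj₁ (prime∣^⇒≡ pp pr (suc m) h)
    ... | inj₂ h = inj₂ (prime∣^⇒≡ pq pr (suc n) h)

    N′ : ℕ
    N′ = p ℕ.^ m ℕ.* q ℕ.^ n

    N≡N′pq : N ≡ N′ ℕ.* (p ℕ.* q)
    N≡N′pq = ≡.trans N≡ (regroup p q (p ℕ.^ m) (q ℕ.^ n))

    open Relations M pp pq p≢q N′ N≡N′pq N-primes public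
    open import Algebra.Properties.Semiring.Exp semiring using (_^_; ^-congˡ; ^-congʳ; ^-homo-*; ^-assocʳ)
    open import Algebra.Properties.Semiring.Mult semiring using (×1-homo-*)
    open import Relation.Binary.Reasoning.Setoid setoid

    private
      instance
        nonZero-p : NonZero p
        nonZero-p = prime⇒nonZero pp
        nonZero-q : NonZero q
        nonZero-q = prime⇒nonZero pq
        nonZero-p^ : NonZero (p ℕ.^ suc m)
        nonZero-p^ = ℕ.m^n≢0 p (suc m)
        nonZero-q^ : NonZero (q ℕ.^ suc n)
        nonZero-q^ = ℕ.m^n≢0 q (suc n)

      p^⊥q : Coprime (p ℕ.^ suc m) q
      p^⊥q = ≡.subst (Coprime (p ℕ.^ suc m)) (ℕ.^-identityʳ q) (coprime-prime-powers pp pq p≢q (suc m) 1)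
      q^⊥p : Coprime (q ℕ.^ suc n) p
      q^⊥p = ≡.subst (Coprime (q ℕ.^ suc n)) (ℕ.^-identityʳ p) (coprime-prime-powers pq pp (p≢q ∘ ≡.sym) (suc n) 1)
        where open import Function.Base using (_∘_)

    module Lq = LocalConjugation.Local M pq (p ℕ.^ suc m) n N≡ p^⊥q
    module Lp = LocalConjugation.Local M pp (q ℕ.^ suc n) m (≡.trans N≡ (ℕ.*-comm (p ℕ.^ suc m) (q ℕ.^ suc n))) q^⊥p

    ι-^ : ∀ r b → ι (+ r) ^ b ≈ ι (+ (r ℕ.^ b))
    ι-^ r zero = sym ι-1
    ι-^ r (suc b) = trans (*-congˡ (ι-^ r b)) (sym (×1-homo-* r (r ℕ.^ b)))

    galois-cong : ∀ f g u → Coprime u N → ∀ {z} → z ^ N ≈ 1# → ev z f ≈ ev z g → ev (z ^ u) f ≈ ev (z ^ u) g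
    galois-cong f g u cop h eq = -≈0⇒≈ (G.galois (f ⊕ ⊖ g) u cop h (≈⇒-≈0 eq))

    poly : (ℕ → ℤ) → Poly
    poly = fromCoeffs N

    F-cong : ∀ a {w z} → w ≈ z → F N a w ≈ F N a z
    F-cong a h = ∑-cong N (λ i _ → *-congˡ (^-congˡ i h))

    F-galois : ∀ a b u → Coprime u N → F N a ζ ≈ F N b ζ → F N a (ζ ^ u) ≈ F N b (ζ ^ u)
    F-galois a b u cop h = trans (sym (ev-fromCoeffs (ζ ^ u) N a))
      (trans (galois-cong (poly a) (poly b) u cop ζ^N≈1
      (trans (ev-fromCoeffs ζ N a) (trans h (sym (ev-fromCoeffs ζ N b))))) (ev-fromCoeffs (ζ ^ u) N b))

    pred-coprime : Coprime (N ℕ.∸ 1) N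
    pred-coprime {d} (d∣N-1 , d∣N) =
      ∣1⇒≡1 (∣m+n∣m⇒∣n (≡.subst (d ∣ℕ_) (≡.trans (≡.sym (ℕ.suc-pred N)) (ℕ.+-comm 1 (ℕ.pred N))) d∣N) d∣N-1)

    conj-conj : conj (conj ζ) ≈ ζ
    conj-conj = begin
      conj (conj ζ)                     ≈⟨ trans (sym (*-identityʳ _)) (*-congˡ (sym inverse)) ⟩
      conj (conj ζ) * (conj ζ * ζ)      ≈⟨ *-assoc _ _ _ ⟨
      (conj (conj ζ) * conj ζ) * ζ
        ≈⟨ *-congʳ (trans (sym (*-cong (*-identityʳ _) (*-identityʳ _))) (conj-inverse (root^ (N ℕ.∸ 1)) 1)) ⟩
      1# * ζ                            ≈⟨ *-identityˡ ζ ⟩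
      ζ                                 ∎
      where
      inverse : conj ζ * ζ ≈ 1#
      inverse = trans (sym (*-cong (*-identityʳ _) (*-identityʳ _))) (conj-inverse ζ^N≈1 1)

    module Descent {S : ℕ → ℤ} (per : Periodic S) (v d₁ k₁ d₂ k₂ : ℕ)
      (v≡₁ : v ≡ q ℕ.^ d₁ ℕ.+ k₁ ℕ.* p ℕ.^ suc m) (v≡₂ : v ≡ p ℕ.^ d₂ ℕ.+ k₂ ℕ.* q ℕ.^ suc n) (v⊥N : Coprime v N)
      (a b : ℕ) (norm : F N S (conj ζ) * F N S ζ ≈ ι (+ (p ℕ.^ a ℕ.* q ℕ.^ b))) where

      A : ℕ
      A = p ℕ.^ a ℕ.* q ℕ.^ b

      A≢0 : ¬ (ι (+ A) ≈ 0#)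
      A≢0 h = ℕ.≢-nonZero⁻¹ A {{ℕ.m*n≢0 _ _ {{ℕ.m^n≢0 p a}} {{ℕ.m^n≢0 q b}}}} (ℤ.+-injective (char0 (+ A) h))

      A-cancel : ∀ x y → ι (+ A) * x ≈ ι (+ A) * y → x ≈ y
      A-cancel x y h with domain (ι (+ A)) (x - y)
        (trans (solve 3 (λ a x y → a :* (x :- y) := a :* x :- a :* y) ≡.refl (ι (+ A)) x y) (≈⇒-≈0 h))
      ... | inj₁ A≈0 = contradiction A≈0 A≢0
      ... | inj₂ h′ = -≈0⇒≈ h′

      -- `X̄P` represents S(ζ^(-1)). `Y` arises from the product S(ζ) S(ζ^(-1)) = A by twisting the
      -- first factor only.
      X̄P Y : Poly
      X̄P = poly S [ power X (N ℕ.∸ 1) ]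
      Y = poly S [ power X v ] ⊗ X̄P

      ev-poly : ∀ w → ev w (poly S) ≈ F N S w
      ev-poly w = ev-fromCoeffs w N S

      ev-subst : ∀ w u → ev w (poly S [ power X u ]) ≈ F N S (w ^ u)
      ev-subst w u = trans (ev-[] w (poly S) (power X u)) (trans (ev-cong (poly S) (ev-power w X u)) (ev-poly (w ^ u)))

      ιA : ι (+ A) ≈ ι (+ (p ℕ.^ a)) * ι (+ (q ℕ.^ b))
      ιA = ×1-homo-* (p ℕ.^ a) (q ℕ.^ b)

      product≈A : ev ζ (poly S ⊗ X̄P) ≈ ι (+ A)
      product≈A = trans (*-cong (ev-poly ζ) (ev-subst ζ (N ℕ.∸ 1))) (trans (*-comm _ _) norm)

      q^∣Y : Lq.D._∣_ (Lq.ιᴾ (+ q) Lq.^ᴾ b) Y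
      q^∣Y = Lq.q^∣σ v d₁ k₁ v≡₁ v⊥N b (poly S) X̄P
        (constant (+ (p ℕ.^ a)) , trans product≈A (trans ιA (trans (*-comm _ _)
        (*-cong (sym (trans (Lq.E.ev-^ (Lq.ιᴾ (+ q)) b) (trans (^-congˡ b (Lq.ev-ι (+ q))) (ι-^ q b))))
          (sym (ev-constant ζ (+ (p ℕ.^ a))))))))

      p^∣Y : Lp.D._∣_ (Lp.ιᴾ (+ p) Lp.^ᴾ a) Y
      p^∣Y = Lp.q^∣σ v d₂ k₂ v≡₂ v⊥N a (poly S) X̄P (constant (+ (q ℕ.^ b)) , trans product≈A (trans ιA
        (*-cong (sym (trans (Lp.E.ev-^ (Lp.ιᴾ (+ p)) a) (trans (^-congˡ a (Lp.ev-ι (+ p))) (ι-^ p a))))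
          (sym (ev-constant ζ (+ (q ℕ.^ b)))))))

      uq up : Poly
      uq = proj₁ q^∣Y
      up = proj₁ p^∣Y

      Y≈q : ev ζ Y ≈ ι (+ (q ℕ.^ b)) * ev ζ uq
      Y≈q = trans (proj₂ q^∣Y) (*-congʳ
        (trans (Lq.E.ev-^ (Lq.ιᴾ (+ q)) b) (trans (^-congˡ b (Lq.ev-ι (+ q))) (ι-^ q b))))

      Y≈p : ev ζ Y ≈ ι (+ (p ℕ.^ a)) * ev ζ up
      Y≈p = trans (proj₂ p^∣Y) (*-congʳ
        (trans (Lp.E.ev-^ (Lp.ιᴾ (+ p)) a) (trans (^-congˡ a (Lp.ev-ι (+ p))) (ι-^ p a))))

      bez : ∃[ x ] ∃[ y ] 1ℤ ≡ x ℤ.* + (p ℕ.^ a) ℤ.+ y ℤ.* + (q ℕ.^ b)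
      bez = bezoutℤ (coprime-prime-powers pp pq p≢q a b)

      -- Y is divisible by q^b and by p^a; these are coprime, so Bézout's identity combines the two
      -- quotients into one by A = p^a q^b.
      quotient : ∃[ ε ] ev ζ Y ≈ ι (+ A) * ev ζ ε
      quotient = constant (proj₁ bez) ⊗ uq ⊕ constant (proj₁ (proj₂ bez)) ⊗ up , (begin
        ev ζ Y                                              ≈⟨ trans (sym (*-identityˡ _)) (*-congʳ (sym ι-1)) ⟩
        ι 1ℤ * ev ζ Y                                       ≡⟨ ≡.cong (λ c → ι c * ev ζ Y) (proj₂ (proj₂ bez)) ⟩
        ι (x ℤ.* P ℤ.+ y ℤ.* Q) * ev ζ Y
          ≈⟨ *-congʳ (trans (ι-+ (x ℤ.* P) (y ℤ.* Q)) (+-cong (ι-* x P) (ι-* y Q))) ⟩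
        (ι x * ι P + ι y * ι Q) * ev ζ Y
          ≈⟨ solve 5 (λ x p y q z → (x :* p :+ y :* q) :* z := x :* p :* z :+ y :* q :* z) ≡.refl (ι x) (ι P) (ι y)
          (ι Q) (ev ζ Y) ⟩
        ι x * ι P * ev ζ Y + ι y * ι Q * ev ζ Y             ≈⟨ +-cong (*-congˡ Y≈q) (*-congˡ Y≈p) ⟩
        ι x * ι P * (ι Q * ev ζ uq) + ι y * ι Q * (ι P * ev ζ up)
          ≈⟨ solve 6 (λ x p y q u w → x :* p :* (q :* u) :+ y :* q :* (p :* w) := (p :* q) :* (x :* u :+ y :* w)) ≡.refl
          (ι x) (ι P) (ι y) (ι Q) (ev ζ uq) (ev ζ up) ⟩
        (ι P * ι Q) * (ι x * ev ζ uq + ι y * ev ζ up)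
          ≈⟨ *-cong (sym ιA) (+-cong (*-congʳ (sym (ev-constant ζ x))) (*-congʳ (sym (ev-constant ζ y)))) ⟩
        ι (+ A) * (ev ζ (constant x) * ev ζ uq + ev ζ (constant y) * ev ζ up) ∎)
        where
        x = proj₁ bez
        y = proj₁ (proj₂ bez)
        P = + (p ℕ.^ a)
        Q = + (q ℕ.^ b)

      -- The automorphism ζ ↦ ζ⁻¹ turns Y = A ε into Ȳ = A ε̄, and Y Ȳ = A².
      module Quotient (ε : Poly) (Y≈Aε : ev ζ Y ≈ ι (+ A) * ev ζ ε) where

        conj-Y : ev (conj ζ) Y ≈ ι (+ A) * ev (conj ζ) ε
        conj-Y = trans (galois-cong Y (constant (+ A) ⊗ ε) (N ℕ.∸ 1) pred-coprime ζ^N≈1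
          (trans Y≈Aε (*-congʳ (sym (ev-constant ζ (+ A))))))
          (*-congʳ (ev-constant (conj ζ) (+ A)))

        conj-comm : conj ζ ^ v ≈ conj (ζ ^ v)
        conj-comm = trans (^-assocʳ ζ (N ℕ.∸ 1) v)
          (trans (^-congʳ ζ (ℕ.*-comm (N ℕ.∸ 1) v)) (sym (^-assocʳ ζ v (N ℕ.∸ 1))))

        norm-v : F N S (conj ζ ^ v) * F N S (ζ ^ v) ≈ ι (+ A)
        norm-v = trans (*-congʳ (F-cong S conj-comm))
          (trans (*-cong (sym (ev-subst (ζ ^ v) (N ℕ.∸ 1))) (sym (ev-poly (ζ ^ v))))
          (trans (galois-cong (X̄P ⊗ poly S) (constant (+ A)) v v⊥N ζ^N≈1
            (trans (*-comm _ _) (trans product≈A (sym (ev-constant ζ (+ A)))))) (ev-constant (ζ ^ v) (+ A))))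

        conj-Y-F : ev (conj ζ) Y ≈ F N S (conj ζ ^ v) * F N S ζ
        conj-Y-F = *-cong (ev-subst (conj ζ) v) (trans (ev-subst (conj ζ) (N ℕ.∸ 1)) (F-cong S conj-conj))

        Y-F : ev ζ Y ≈ F N S (ζ ^ v) * F N S (conj ζ)
        Y-F = *-cong (ev-subst ζ v) (ev-subst ζ (N ℕ.∸ 1))

        norm-identity : ∀ {a e ē f₁ f₂ f₃ f₄} → a * ē ≈ f₁ * f₂ → a * e ≈ f₃ * f₄ → f₁ * f₃ ≈ a → f₄ * f₂ ≈ a →
          a * (a * (ē * e)) ≈ a * (a * 1#)
        norm-identity {a} {e} {ē} {f₁} {f₂} {f₃} {f₄} h₁ h₂ h₃ h₄ =
          trans (solve 3 (λ a x y → a :* (a :* (x :* y)) := (a :* x) :* (a :* y)) ≡.refl a ē e)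
          (trans (*-cong h₁ h₂) (trans (solve 4 (λ a b c d → (a :* b) :* (c :* d) := (a :* c) :* (d :* b)) ≡.refl f₁ f₂
            f₃ f₄)
          (trans (*-cong h₃ h₄) (*-congˡ (sym (*-identityʳ a))))))

        ε-norm : ev (conj ζ) ε * ev ζ ε ≈ 1#
        ε-norm = A-cancel (ev (conj ζ) ε * ev ζ ε) 1# (A-cancel (ι (+ A) * (ev (conj ζ) ε * ev ζ ε)) (ι (+ A) * 1#)
          (norm-identity (trans (sym conj-Y) conj-Y-F) (trans (sym Y≈Aε) Y-F) norm-v norm))

        -- The index is reduced modulo N because `signed-root` expects a periodic function.
        ε-coeffs : ℕ → ℤ
        ε-coeffs i = coeffs N ε (i % N)

        ε-periodic : Periodic ε-coeffs
        ε-periodic i = ≡.cong (coeffs N ε) (≡.trans (≡.cong (_% N) (ℕ.+-comm N i)) ([m+n]%n≡m%n i N))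

        ε-F : ∀ {w} → w ^ N ≈ 1# → ev w ε ≈ F N ε-coeffs w
        ε-F h = trans (ev-coeffs ε h) (∑-cong N
          (λ i i<N → *-congʳ (reflexive (≡.cong (λ k → ι (coeffs N ε k)) (≡.sym (m<n⇒m%n≡m i<N))))))

        -- A S(ζ^v) = S(ζ^(-1)) S(ζ) S(ζ^v) = Y S(ζ) = A ε S(ζ), where ε is a signed root of unity;
        -- A cancels.
        twisted : ∃[ c ] ∃[ j ] ((c ≡ 1ℤ ⊎ c ≡ ℤ.- 1ℤ) ∧ F N S (ζ ^ v) ≈ ι c * (ζ ^ j * F N S ζ))
        twisted = c , j , proj₁ (proj₂ (proj₂ root)) , A-cancel _ _ (begin
          ι (+ A) * F N S (ζ ^ v)                                  ≈⟨ *-congʳ norm ⟨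
          (F N S (conj ζ) * F N S ζ) * F N S (ζ ^ v)
            ≈⟨ solve 3 (λ b x y → (b :* x) :* y := (y :* b) :* x) ≡.refl (F N S (conj ζ)) (F N S ζ) (F N S (ζ ^ v)) ⟩
          (F N S (ζ ^ v) * F N S (conj ζ)) * F N S ζ
            ≈⟨ *-congʳ (trans (sym Y-F) (trans Y≈Aε (*-congˡ (trans (ε-F ζ^N≈1) (proj₂ (proj₂ (proj₂ root))))))) ⟩
          (ι (+ A) * (ι c * ζ ^ j)) * F N S ζ
            ≈⟨ solve 4 (λ a c z x → (a :* (c :* z)) :* x := a :* (c :* (z :* x))) ≡.refl (ι (+ A)) (ι c) (ζ ^ j)
            (F N S ζ) ⟩
          ι (+ A) * (ι c * (ζ ^ j * F N S ζ))                      ∎)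
          where
          root : ∃[ c ] ∃[ j ] ((c ≡ 1ℤ ⊎ c ≡ ℤ.- 1ℤ) ∧ F N ε-coeffs ζ ≈ ι c * ζ ^ j)
          root = signed-root ε-periodic (trans (*-cong (sym (ε-F (root^ (N ℕ.∸ 1)))) (sym (ε-F ζ^N≈1))) ε-norm)
          c = proj₁ root
          j = proj₁ (proj₂ root)

      twisted : ∃[ c ] ∃[ j ] ((c ≡ 1ℤ ⊎ c ≡ ℤ.- 1ℤ) ∧ F N S (ζ ^ v) ≈ ι c * (ζ ^ j * F N S ζ))
      twisted = Quotient.twisted (proj₁ quotient) (proj₂ quotient)

      -- The sign c is fixed by the automorphism, so twisting a second time turns it into c² = 1.
      -- For this reason v² is used from here on.
      twisted² : ∃[ J ] F N S (ζ ^ (v ℕ.* v)) ≈ ζ ^ J * F N S ζ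
      twisted² = v ℕ.* j ℕ.+ j , (begin
        F N S (ζ ^ (v ℕ.* v))                               ≈⟨ F-cong S (^-assocʳ ζ v v) ⟨
        F N S ((ζ ^ v) ^ v)                                 ≈⟨ ev-subst (ζ ^ v) v ⟨
        ev (ζ ^ v) (poly S [ power X v ])
          ≈⟨ galois-cong (poly S [ power X v ]) (constant c ⊗ (power X j ⊗ poly S)) v v⊥N ζ^N≈1
          (trans (ev-subst ζ v) (trans eq (sym (rhs ζ)))) ⟩
        ev (ζ ^ v) (constant c ⊗ (power X j ⊗ poly S))      ≈⟨ rhs (ζ ^ v) ⟩
        ι c * ((ζ ^ v) ^ j * F N S (ζ ^ v))                 ≈⟨ *-congˡ (*-cong (^-assocʳ ζ v j) eq) ⟩
        ι c * (ζ ^ (v ℕ.* j) * (ι c * (ζ ^ j * F N S ζ)))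
          ≈⟨ solve 4 (λ c a b x → c :* (a :* (c :* (b :* x))) := (c :* c) :* ((a :* b) :* x)) ≡.refl (ι c)
          (ζ ^ (v ℕ.* j)) (ζ ^ j) (F N S ζ) ⟩
        (ι c * ι c) * ((ζ ^ (v ℕ.* j) * ζ ^ j) * F N S ζ)
          ≈⟨ *-cong (trans (sym (ι-* c c)) (trans (reflexive (≡.cong ι (square (proj₁ (proj₂ (proj₂ twisted)))))) ι-1))
          (*-congʳ (sym (^-homo-* ζ (v ℕ.* j) j))) ⟩
        1# * (ζ ^ (v ℕ.* j ℕ.+ j) * F N S ζ)                ≈⟨ *-identityˡ _ ⟩
        ζ ^ (v ℕ.* j ℕ.+ j) * F N S ζ                       ∎)
        where
        c = proj₁ twisted
        j = proj₁ (proj₂ twisted)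
        eq : F N S (ζ ^ v) ≈ ι c * (ζ ^ j * F N S ζ)
        eq = proj₂ (proj₂ (proj₂ twisted))
        rhs : ∀ w → ev w (constant c ⊗ (power X j ⊗ poly S)) ≈ ι c * (w ^ j * F N S w)
        rhs w = *-cong (ev-constant w c) (*-cong (ev-power w X j) (ev-poly w))
        square : ∀ {c} → c ≡ 1ℤ ⊎ c ≡ ℤ.- 1ℤ → c ℤ.* c ≡ 1ℤ
        square (inj₁ ≡.refl) = ≡.refl
        square (inj₂ ≡.refl) = ≡.refl

    χℤ-yes : ∀ {P : Set} (d : Dec P) → P → χℤ d ≡ 1ℤ
    χℤ-yes (yes _) _ = ≡.refl
    χℤ-yes (no ¬p) p = contradiction p ¬p

    χℤ-no : ∀ {P : Set} (d : Dec P) → ¬ P → χℤ d ≡ 0ℤ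
    χℤ-no (yes p) ¬p = contradiction p ¬p
    χℤ-no (no _) _ = ≡.refl

    ∑ℤ-const : ∀ k (c : ℤ) → ℤSums.∑ k (λ _ → c) ≡ + k ℤ.* c
    ∑ℤ-const zero c = ≡.refl
    ∑ℤ-const (suc k) c = ≡.trans (≡.cong (ℤ._+ c) (∑ℤ-const k c))
      (≡.trans (ℤSums.solve 2 (λ k c → k :* c :+ c := (con 1ℤ :+ k) :* c) ≡.refl (+ k) c) ≡.refl)

    -- An injective map of the residues modulo N is bijective, in counting form: each fibre has at
    -- most one element and all fibres together have N, so each has exactly one.
    module Reindexing (c : ℕ → ℕ) (injective : ∀ {l l′} → l ℕ.< N → l′ ℕ.< N → c l % N ≡ c l′ % N → l ≡ l′) where

      hit : ℕ → ℕ → ℤ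
      hit y l = χℤ (y ℕ.≟ c l % N)

      count : ℕ → ℤ
      count y = ℤSums.∑ N (hit y)

      count≤1 : ∀ y → count y ℤ.≤ 1ℤ
      count≤1 y with ℕ.anyUpTo? (λ l → y ℕ.≟ c l % N) N
      ... | yes (l , l<N , eq) = ℤ.≤-reflexive
        (≡.trans (ℤSums.∑-single N l (hit y) l<N (λ l′ l′<N l′≢l →
        χℤ-no (y ℕ.≟ c l′ % N) (λ eq′ → l′≢l (injective l′<N l<N (≡.trans (≡.sym eq′) eq)))))
          (χℤ-yes (y ℕ.≟ c l % N) eq))
      ... | no none = ≡.subst (ℤ._≤ 1ℤ)
        (≡.sym (ℤSums.∑-zero N {hit y} (λ l l<N → χℤ-no (y ℕ.≟ c l % N) (λ eq → none (l , l<N , eq))))) (ℤ.+≤+ z≤n)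

      ∑-count : ℤSums.∑ N count ≡ + N
      ∑-count = ≡.trans (ℤSums.∑-swap N N hit) (≡.trans (ℤSums.∑-cong N {λ l → ℤSums.∑ N (λ y → hit y l)} {λ _ → 1ℤ}
        (λ l _ → ≡.trans (ℤSums.∑-single N (c l % N) (λ y → hit y l) (m%n<n (c l) N)
          (λ y _ y≢ → χℤ-no (y ℕ.≟ c l % N) y≢)) (χℤ-yes (c l % N ℕ.≟ c l % N) ≡.refl)))
        (≡.trans (∑ℤ-const N 1ℤ) (ℤ.*-identityʳ (+ N))))

      count≡1 : ∀ y → y ℕ.< N → count y ≡ 1ℤ
      count≡1 y y<N = ≡.sym (ℤ.i-j≡0⇒i≡j 1ℤ (count y)
        (∑-nonneg-zero N {λ y → 1ℤ ℤ.- count y} (λ y _ → ℤ.i≤j⇒0≤j-i (count≤1 y)) (ℤ.≤-reflexive sum≡0) y y<N))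
        where
        sum≡0 : ℤSums.∑ N (λ y → 1ℤ ℤ.- count y) ≡ 0ℤ
        sum≡0 = ≡.trans (ℤSums.∑-cong N {λ y → 1ℤ ℤ.- count y} {λ y → 1ℤ ℤ.+ (ℤ.- 1ℤ) ℤ.* count y}
          (λ y _ → ≡.cong (λ t → 1ℤ ℤ.+ t) (≡.sym (ℤ.-1*i≡-i (count y)))))
          (≡.trans (ℤSums.∑-+ N (λ _ → 1ℤ) (λ y → (ℤ.- 1ℤ) ℤ.* count y))
            (≡.trans (≡.cong₂ ℤ._+_ (≡.trans (∑ℤ-const N 1ℤ) (ℤ.*-identityʳ (+ N)))
            (≡.trans (≡.sym (ℤSums.∑-*ˡ N (ℤ.- 1ℤ) count)) (≡.cong ((ℤ.- 1ℤ) ℤ.*_) ∑-count)))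
            (≡.trans (≡.cong (λ t → + N ℤ.+ t) (ℤ.-1*i≡-i (+ N))) (ℤ.+-inverseʳ (+ N)))))

      reindex : ∀ (g : ℕ → Carrier) → (∀ i → g (i % N) ≈ g i) → ∑ N (λ l → g (c l)) ≈ ∑ N g
      reindex g g-% = begin
        ∑ N (λ l → g (c l))
          ≈⟨ ∑-cong N (λ l _ → trans (sym (g-% (c l))) (sym (∑-χ N (c l % N) g (m%n<n (c l) N)))) ⟩
        ∑ N (λ l → ∑ N (λ y → χ (y ℕ.≟ c l % N) * g y))  ≈⟨ ∑-swap N N _ ⟩
        ∑ N (λ y → ∑ N (λ l → χ (y ℕ.≟ c l % N) * g y))
          ≈⟨ ∑-cong N (λ y y<N → trans (sym (∑-*ʳ N (g y) _))
          (trans (*-congʳ (trans (∑-cong N (λ l _ → sym (ι-χℤ (y ℕ.≟ c l % N))))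
          (trans (sym (ι-∑ℤ N (hit y))) (trans (reflexive (≡.cong ι (count≡1 y y<N))) ι-1)))) (*-identityˡ _))) ⟩
        ∑ N g                                            ∎

    -- In the application `suc W` is v², so `W` is v² - 1, the factor in the condition on the
    -- surviving exponents.
    module Averaging {S : ℕ → ℤ} (per : Periodic S) (ind : Indicator S) (W J : ℕ) (p∤V : ¬ (p ∣ℕ suc W)) (q∤V : ¬ (q ∣ℕ suc W))
      (geometric-divisible : ∀ d → N ∣ℕ geometric (suc W) d → N ∣ℕ d)
      (relation : F N S (ζ ^ suc W) ≈ ζ ^ J * F N S ζ) where

      V : ℕ
      V = suc W

      c : ℕ → ℕ
      c = geometric V

      V^⊥N : ∀ l → Coprime (V ℕ.^ l) N
      V^⊥N l = coprime-N (V ℕ.^ l) (go pp p∤V l) (go pq q∤V l)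
        where
        go : ∀ {r} → Prime r → ¬ (r ∣ℕ V) → ∀ l → ¬ (r ∣ℕ V ℕ.^ l)
        go pr r∤V zero h = prime∤1 pr h
        go pr r∤V (suc l) h with euclidsLemma V (V ℕ.^ l) pr h
        ... | inj₁ r∣V = r∤V r∣V
        ... | inj₂ h′ = go pr r∤V l h′

      -- The relation is conjugated by ζ ↦ ζ^(V^l), which multiplies the exponent J by V^l; these
      -- multiples of J add up to J times a geometric sum.
      iterate : ∀ l → F N S (ζ ^ (V ℕ.^ l)) ≈ ζ ^ (J ℕ.* c l) * F N S ζ
      iterate zero = trans (F-cong S (*-identityʳ ζ)) (sym (trans (*-congʳ (^-congʳ ζ (ℕ.*-zeroʳ J))) (*-identityˡ _)))
      iterate (suc l) = begin
        F N S (ζ ^ (V ℕ.* V ℕ.^ l))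
          ≈⟨ F-cong S (trans (^-congʳ ζ (ℕ.*-comm V (V ℕ.^ l))) (sym (^-assocʳ ζ (V ℕ.^ l) V))) ⟩
        F N S (w ^ V)                                        ≈⟨ lhs w ⟨
        ev w (poly S [ power X V ])
          ≈⟨ galois-cong (poly S [ power X V ]) (power X J ⊗ poly S) (V ℕ.^ l) (V^⊥N l) ζ^N≈1
          (trans (lhs ζ) (trans relation (sym (rhs ζ)))) ⟩
        ev w (power X J ⊗ poly S)                            ≈⟨ rhs w ⟩
        w ^ J * F N S w
          ≈⟨ *-cong (trans (^-assocʳ ζ (V ℕ.^ l) J) (^-congʳ ζ (ℕ.*-comm (V ℕ.^ l) J))) (iterate l) ⟩
        ζ ^ (J ℕ.* V ℕ.^ l) * (ζ ^ (J ℕ.* c l) * F N S ζ)    ≈⟨ *-assoc _ _ _ ⟨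
        (ζ ^ (J ℕ.* V ℕ.^ l) * ζ ^ (J ℕ.* c l)) * F N S ζ
          ≈⟨ *-congʳ (trans (sym (^-homo-* ζ (J ℕ.* V ℕ.^ l) (J ℕ.* c l)))
          (^-congʳ ζ (≡.sym (ℕ.*-distribˡ-+ J (V ℕ.^ l) (c l))))) ⟩
        ζ ^ (J ℕ.* c (suc l)) * F N S ζ                      ∎
        where
        w = ζ ^ (V ℕ.^ l)
        lhs : ∀ w → ev w (poly S [ power X V ]) ≈ F N S (w ^ V)
        lhs w = trans (ev-[] w (poly S) (power X V))
          (trans (ev-cong (poly S) (ev-power w X V)) (ev-fromCoeffs (w ^ V) N S))
        rhs : ∀ w → ev w (power X J ⊗ poly S) ≈ w ^ J * F N S w
        rhs w = *-cong (ev-power w X J) (ev-fromCoeffs w N S)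

      -- W x - J modulo N, with N - 1 in the place of -1.
      D : ℕ → ℕ
      D x = W ℕ.* x ℕ.+ (N ℕ.∸ 1) ℕ.* J

      c-injective-< : ∀ {l l′} → l ℕ.< l′ → l′ ℕ.< N → ¬ (c l % N ≡ c l′ % N)
      c-injective-< {l} {l′} l<l′ l′<N eq = >⇒∤ {{ℕ.>-nonZero (ℕ.m<n⇒0<n∸m l<l′)}} (ℕ.≤-<-trans (ℕ.m∸n≤m l′ l) l′<N)
        (geometric-divisible (l′ ℕ.∸ l) (coprime-divisor (Coprimality.sym (V^⊥N l)) N∣))
        where
        c-l′ : c l′ ≡ c l ℕ.+ V ℕ.^ l ℕ.* c (l′ ℕ.∸ l)
        c-l′ = ≡.trans (≡.cong c (≡.sym (ℕ.m+[n∸m]≡n (ℕ.<⇒≤ l<l′)))) (geometric-+ V l (l′ ℕ.∸ l))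
        N∣ : N ∣ℕ V ℕ.^ l ℕ.* c (l′ ℕ.∸ l)
        N∣ = ≡.subst (N ∣ℕ_) (≡.trans (≡.cong (ℕ._∸ c l) c-l′) (ℕ.m+n∸m≡n (c l) _))
          (%≡⇒∣∸ (c l′) (c l) N (≡.subst (c l ℕ.≤_) (≡.sym c-l′) (ℕ.m≤m+n (c l) _)) (≡.sym eq))

      c-injective : ∀ {l l′} → l ℕ.< N → l′ ℕ.< N → c l % N ≡ c l′ % N → l ≡ l′
      c-injective {l} {l′} l<N l′<N eq with ℕ.<-cmp l l′
      ... | tri< l<l′ _ _ = contradiction eq (c-injective-< l<l′ l′<N)
      ... | tri≈ _ l≡l′ _ = l≡l′
      ... | tri> _ _ l′<l = contradiction (≡.sym eq) (c-injective-< l′<l l<N)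

      fixed? : (x : ℕ) → Dec (N ∣ℕ D x)
      fixed? x = N ∣? D x

      -- As l runs through 0, ..., N - 1, the geometric sums c l run through all residues modulo N,
      -- so this is a complete character sum.
      orbit-sum : ∀ x → ∑ N (λ l → (ζ ^ D x) ^ c l) ≈ ι (+ N) * ι (χℤ (fixed? x))
      orbit-sum x = trans (Reindexing.reindex c c-injective ((ζ ^ D x) ^_) (λ i → ^-% (root^ (D x)) i))
        (full (fixed? x))
        where
        full : (d : Dec (N ∣ℕ D x)) → ∑ N ((ζ ^ D x) ^_) ≈ ι (+ N) * ι (χℤ d)
        full (yes N∣D) = trans (∑-cong N (λ k _ → trans (^-congˡ k (ζ^-multiple N∣D)) (1^ k)))
          (trans (∑-const N 1#) (*-congˡ (sym ι-1)))
        full (no N∤D) = trans (∑-root (root^ (D x)) (λ h → N∤D (order (D x) h))) (sym (zeroʳ _))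

      S₀ : ℕ → ℤ
      S₀ x = S x ℤ.* χℤ (fixed? x)

      exponent : ∀ x l → x ℕ.* V ℕ.^ l ℕ.+ (N ℕ.∸ 1) ℕ.* (J ℕ.* c l) ≡ x ℕ.+ D x ℕ.* c l
      exponent x l = ≡.trans (≡.cong (λ v → x ℕ.* v ℕ.+ (N ℕ.∸ 1) ℕ.* (J ℕ.* c l)) (^-geometric W l))
        (exponent-identity x W (c l) (N ℕ.∸ 1) J)

      -- The identities S(ζ) = ζ^(-J c l) S(ζ^(V^l)) are added over l < N. The term of x has
      -- exponent x V^l - J c l = x + (W x - J) c l, and the sum over l erases it unless N divides D
      -- x.
      N-fold : ι (+ N) * F N S ζ ≈ ι (+ N) * F N S₀ ζ
      N-fold = begin
        ι (+ N) * F N S ζ                                              ≈⟨ ∑-const N (F N S ζ) ⟨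
        ∑ N (λ _ → F N S ζ)                                            ≈⟨ ∑-cong N (λ l _ → untwist l) ⟩
        ∑ N (λ l → ∑ N (λ x → ι (S x) * ζ ^ x * (ζ ^ D x) ^ c l))      ≈⟨ ∑-swap N N _ ⟩
        ∑ N (λ x → ∑ N (λ l → ι (S x) * ζ ^ x * (ζ ^ D x) ^ c l))
          ≈⟨ ∑-cong N (λ x _ → trans (sym (∑-*ˡ N _ _)) (*-congˡ (orbit-sum x))) ⟩
        ∑ N (λ x → ι (S x) * ζ ^ x * (ι (+ N) * ι (χℤ (fixed? x))))
          ≈⟨ ∑-cong N (λ x _ → trans (solve 4 (λ s z n d → s :* z :* (n :* d) := n :* ((s :* d) :* z)) ≡.refl (ι (S x))
          (ζ ^ x) (ι (+ N)) (ι (χℤ (fixed? x)))) (*-congˡ (*-congʳ (sym (ι-* (S x) (χℤ (fixed? x))))))) ⟩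
        ∑ N (λ x → ι (+ N) * (ι (S₀ x) * ζ ^ x))                       ≈⟨ ∑-*ˡ N _ _ ⟨
        ι (+ N) * F N S₀ ζ                                             ∎
        where
        untwist : ∀ l → F N S ζ ≈ ∑ N (λ x → ι (S x) * ζ ^ x * (ζ ^ D x) ^ c l)
        untwist l = begin
          F N S ζ                                               ≈⟨ *-identityˡ _ ⟨
          1# * F N S ζ                                          ≈⟨ *-congʳ (conj-inverse ζ^N≈1 (J ℕ.* c l)) ⟨
          (conj ζ ^ (J ℕ.* c l) * ζ ^ (J ℕ.* c l)) * F N S ζ    ≈⟨ trans (*-assoc _ _ _) (*-congˡ (sym (iterate l))) ⟩
          conj ζ ^ (J ℕ.* c l) * F N S (ζ ^ (V ℕ.^ l))          ≈⟨ ∑-*ˡ N _ _ ⟩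
          ∑ N (λ x → conj ζ ^ (J ℕ.* c l) * (ι (S x) * (ζ ^ (V ℕ.^ l)) ^ x)) ≈⟨ ∑-cong N (λ x _ → term x) ⟩
          ∑ N (λ x → ι (S x) * ζ ^ x * (ζ ^ D x) ^ c l)         ∎
          where
          term : ∀ x → conj ζ ^ (J ℕ.* c l) * (ι (S x) * (ζ ^ (V ℕ.^ l)) ^ x) ≈ ι (S x) * ζ ^ x * (ζ ^ D x) ^ c l
          term x = begin
            conj ζ ^ (J ℕ.* c l) * (ι (S x) * (ζ ^ (V ℕ.^ l)) ^ x)
              ≈⟨ solve 3 (λ a s b → a :* (s :* b) := s :* (b :* a)) ≡.refl (conj ζ ^ (J ℕ.* c l)) (ι (S x))
              ((ζ ^ (V ℕ.^ l)) ^ x) ⟩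
            ι (S x) * ((ζ ^ (V ℕ.^ l)) ^ x * conj ζ ^ (J ℕ.* c l))
              ≈⟨ *-congˡ (*-cong (trans (^-assocʳ ζ (V ℕ.^ l) x) (^-congʳ ζ (ℕ.*-comm (V ℕ.^ l) x)))
              (^-assocʳ ζ (N ℕ.∸ 1) (J ℕ.* c l))) ⟩
            ι (S x) * (ζ ^ (x ℕ.* V ℕ.^ l) * ζ ^ ((N ℕ.∸ 1) ℕ.* (J ℕ.* c l)))
              ≈⟨ *-congˡ (trans (sym (^-homo-* ζ (x ℕ.* V ℕ.^ l) _))
              (trans (^-congʳ ζ (exponent x l))
              (trans (^-homo-* ζ x (D x ℕ.* c l)) (*-congˡ (sym (^-assocʳ ζ (D x) (c l))))))) ⟩
            ι (S x) * (ζ ^ x * (ζ ^ D x) ^ c l)                        ≈⟨ *-assoc _ _ _ ⟨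
            ι (S x) * ζ ^ x * (ζ ^ D x) ^ c l                          ∎

      S≈S₀ : F N S ζ ≈ F N S₀ ζ
      S≈S₀ = -≈0⇒≈ (N*≈0 _ (trans (solve 3 (λ n x y → n :* (x :- y) := n :* x :- n :* y) ≡.refl (ι (+ N)) (F N S ζ)
        (F N S₀ ζ)) (≈⇒-≈0 N-fold)))

      D-shift : ∀ x → D (N ℕ.+ x) ≡ W ℕ.* N ℕ.+ D x
      D-shift x = ≡.trans (≡.cong (ℕ._+ (N ℕ.∸ 1) ℕ.* J) (ℕ.*-distribˡ-+ W N x)) (ℕ.+-assoc (W ℕ.* N) (W ℕ.* x) _)

      S₀-periodic : Periodic S₀
      S₀-periodic x = ≡.cong₂ ℤ._*_ (per x) (same (fixed? x))
        where
        same : (d : Dec (N ∣ℕ D x)) → χℤ (fixed? (N ℕ.+ x)) ≡ χℤ d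
        same (yes h) = χℤ-yes (fixed? (N ℕ.+ x)) (≡.subst (N ∣ℕ_) (≡.sym (D-shift x)) (∣m∣n⇒∣m+n (n∣m*n W) h))
        same (no ¬h) = χℤ-no (fixed? (N ℕ.+ x)) (λ h → ¬h (∣m+n∣m⇒∣n (≡.subst (N ∣ℕ_) (D-shift x) h) (n∣m*n W)))

      S₀-cases : ∀ x (d : Dec (N ∣ℕ D x)) → S x ≡ 0ℤ ⊎ S x ≡ 1ℤ → S x ℤ.* χℤ d ≡ 0ℤ ⊎ S x ℤ.* χℤ d ≡ 1ℤ
      S₀-cases x (yes _) (inj₁ eq) = inj₁ (≡.cong (ℤ._* 1ℤ) eq)
      S₀-cases x (yes _) (inj₂ eq) = inj₂ (≡.cong (ℤ._* 1ℤ) eq)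
      S₀-cases x (no _) _ = inj₁ (ℤ.*-zeroʳ (S x))

      S₀-indicator : Indicator S₀
      S₀-indicator x = S₀-cases x (fixed? x) (ind x)

      module Size (G : ℕ) .{{_ : NonZero G}} (fixed : ∀ y → N ∣ℕ W ℕ.* y → N ∣ℕ G ℕ.* y) where

        h : ℕ → ℤ
        h x = χℤ (fixed? x)

        -- Consecutive solutions of N ∣ D x are at least N / G apart.
        spacing : ∀ n → ℤSums.∑ n h ≡ 0ℤ ⊎
          (∃[ l ] ∃[ k ] (l ℕ.< n ∧ N ∣ℕ D l ∧ ℤSums.∑ n h ≡ + suc k ∧ k ℕ.* N ℕ.≤ G ℕ.* l))
        spacing zero = inj₁ ≡.refl
        spacing (suc n) = step (fixed? n) (spacing n)
          where
          step : (d : Dec (N ∣ℕ D n)) → ℤSums.∑ n h ≡ 0ℤ ⊎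
            (∃[ l ] ∃[ k ] (l ℕ.< n ∧ N ∣ℕ D l ∧ ℤSums.∑ n h ≡ + suc k ∧ k ℕ.* N ℕ.≤ G ℕ.* l)) →
                 ℤSums.∑ n h ℤ.+ χℤ d ≡ 0ℤ ⊎ (∃[ l ] ∃[ k ] (l ℕ.< suc n ∧ N ∣ℕ D l ∧ ℤSums.∑ n h ℤ.+ χℤ d ≡ + suc k ∧
                   k ℕ.* N ℕ.≤ G ℕ.* l))
          step (no _) (inj₁ eq) = inj₁ (≡.trans (ℤ.+-identityʳ _) eq)
          step (no _) (inj₂ (l , k , l<n , N∣D , eq , le)) =
            inj₂ (l , k , ℕ.m<n⇒m<1+n l<n , N∣D , ≡.trans (ℤ.+-identityʳ _) eq , le)
          step (yes N∣Dn) (inj₁ eq) = inj₂ (n , 0 , ℕ.≤-refl , N∣Dn , ≡.cong (ℤ._+ 1ℤ) eq , z≤n)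
          step (yes N∣Dn) (inj₂ (l , k , l<n , N∣Dl , eq , le)) =
            inj₂ (n , suc k , ℕ.≤-refl , N∣Dn , ≡.trans (≡.cong (ℤ._+ 1ℤ) eq) (≡.cong +_ (ℕ.+-comm (suc k) 1)) , bound)
            where
            gap : N ∣ℕ W ℕ.* (n ℕ.∸ l)
            gap = ∣m+n∣m⇒∣n (≡.subst (N ∣ℕ_) split N∣Dn) N∣Dl
              where
              split : D n ≡ D l ℕ.+ W ℕ.* (n ℕ.∸ l)
              split = ≡.trans (≡.cong D (≡.sym (ℕ.m+[n∸m]≡n (ℕ.<⇒≤ l<n)))) (D-identity W l (n ℕ.∸ l) ((N ℕ.∸ 1) ℕ.* J))
            N≤ : N ℕ.≤ G ℕ.* (n ℕ.∸ l)
            N≤ = ∣⇒≤ {{ℕ.m*n≢0 G (n ℕ.∸ l) {{it}} {{ℕ.>-nonZero (ℕ.m<n⇒0<n∸m l<n)}}}} (fixed (n ℕ.∸ l) gap)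
            bound : suc k ℕ.* N ℕ.≤ G ℕ.* n
            bound = ≡.subst (suc k ℕ.* N ℕ.≤_)
              (≡.trans (≡.sym (ℕ.*-distribˡ-+ G (n ℕ.∸ l) l)) (≡.cong (G ℕ.*_) (ℕ.m∸n+n≡m (ℕ.<⇒≤ l<n))))
              (ℕ.+-mono-≤ N≤ le)

        size≤G : NormBound.size S₀-periodic S₀-indicator ℤ.≤ + G
        size≤G = ℤ.≤-trans (∑-mono N {S₀} {h} (λ x _ → S₀≤h x)) (final (spacing N))
          where
          S₀≤h : ∀ x → S₀ x ℤ.≤ h x
          S₀≤h x = le (fixed? x) (ind x)
            where
            le : (d : Dec (N ∣ℕ D x)) → S x ≡ 0ℤ ⊎ S x ≡ 1ℤ → S x ℤ.* χℤ d ℤ.≤ χℤ d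
            le (yes _) (inj₁ eq) = ≡.subst (λ s → s ℤ.* 1ℤ ℤ.≤ 1ℤ) (≡.sym eq) (ℤ.+≤+ z≤n)
            le (yes _) (inj₂ eq) = ≡.subst (λ s → s ℤ.* 1ℤ ℤ.≤ 1ℤ) (≡.sym eq) ℤ.≤-refl
            le (no _) _ = ℤ.≤-reflexive (ℤ.*-zeroʳ (S x))
          final : ℤSums.∑ N h ≡ 0ℤ ⊎ (∃[ l ] ∃[ k ] (l ℕ.< N ∧ N ∣ℕ D l ∧ ℤSums.∑ N h ≡ + suc k ∧ k ℕ.* N ℕ.≤ G ℕ.* l))
            → ℤSums.∑ N h ℤ.≤ + G
          final (inj₁ eq) = ≡.subst (ℤ._≤ + G) (≡.sym eq) (ℤ.+≤+ z≤n)
          -- The last solution l is below N, so k N ≤ G l < G N, and the number k + 1 of solutions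
          -- is at most G.
          final (inj₂ (l , k , l<N , _ , eq , le)) = ≡.subst (ℤ._≤ + G) (≡.sym eq)
            (ℤ.+≤+ (ℕ.*-cancelʳ-< N k G (ℕ.≤-<-trans le (ℕ.*-monoʳ-< G l<N))))

        -- S and `S₀` have equal values at ζ and, by conjugation, at ζ^(-1), so `S₀` has norm A too.
        -- The bound by twice the size is then applied to this smaller set.
        norm≤2G : ∀ A → F N S (conj ζ) * F N S ζ ≈ ι (+ A) → A ℕ.≤ G ℕ.+ G
        norm≤2G A norm = ℤ.drop‿+≤+ (ℤ.≤-trans (ℤ.≤-reflexive (≡.sym A≡))
          (ℤ.≤-trans (NormBound.Δν≤2size S₀-periodic S₀-indicator) (ℤ.+-mono-≤ size≤G size≤G)))
          where
          A≡ : Δ (ν S₀) 0 ≡ + A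
          A≡ = ≡.trans (≡.sym (ℤ.*-identityˡ (Δ (ν S₀) 0)))
            (norm-integral S₀-periodic 1ℤ (+ A) (trans (trans (*-congʳ ι-1) (*-identityˡ _))
            (trans (sym (*-cong (F-galois S S₀ (N ℕ.∸ 1) pred-coprime S≈S₀) S≈S₀)) norm)))

-- Bounding the larger of the two sets

module SizeBound where

  open import Data.Integer.Base using (+_; -[1+_])
  open IntegerPolynomials
  open Cyclotomic using (Root)
  open NormDescent
  open Arithmetic

  module NormBounds {N : ℕ} {{_ : NonZero N}} (M : Root N)
    {p q : ℕ} (pp : Prime p) (pq : Prime q) (p≢q : p ≢ q) (m n : ℕ) (N≡ : N ≡ p ℕ.^ suc m ℕ.* q ℕ.^ suc n) where

    open Core M pp pq p≢q m n N≡
    open import Algebra.Properties.Semiring.Exp semiring using (_^_)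
    open import Algebra.Properties.Semiring.Mult semiring using (×1-homo-*)
    open import Data.Nat.Divisibility using (_∣_; m∣m*n; n∣m*n; ∣-trans; ∣n⇒∣m*n; ∣m⇒∣m*n)
    open import Data.Nat.Primality using (euclidsLemma)
    module T = Twisting pp pq p≢q

    bound-nonZero : NonZero T.bound
    bound-nonZero = ℕ.m*n≢0 T.Cq T.Cp {{positive pq}} {{positive pp}}
      where
      positive : ∀ {r} → Prime r → NonZero (r ℕ.^ T.d₀ ℕ.* r ℕ.^ T.d₀ ℕ.∸ 1)
      positive {r} pr = ℕ.>-nonZero (ℕ.m<n⇒0<n∸m
        (ℕ.<-≤-trans 1<r^d (ℕ.m≤m*n (r ℕ.^ T.d₀) (r ℕ.^ T.d₀) {{ℕ.>-nonZero (ℕ.<⇒≤ 1<r^d)}})))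
        where
        1<r : 1 ℕ.< r
        1<r = ℕ.nonTrivial⇒n>1 r {{prime⇒nonTrivial pr}}
        1<r^d : 1 ℕ.< r ℕ.^ T.d₀
        1<r^d = ℕ.<-≤-trans (s≤s (s≤s z≤n)) (n<b^n r T.d₀ 1<r)

    norm-bound : ∀ {S} → Periodic S → Indicator S → ∀ a b → F N S (conj ζ) * F N S ζ ≈ ι (+ (p ℕ.^ a ℕ.* q ℕ.^ b)) →
      p ℕ.^ a ℕ.* q ℕ.^ b ℕ.≤ T.bound ℕ.+ T.bound
    norm-bound {S} per ind a b norm = Averaging.Size.norm≤2G per ind V′ (proj₁ tw²) (∤square pp p∤v) (∤square pq q∤v)
      divisible
        (≡.subst (λ k → F N S (ζ ^ k) ≈ ζ ^ proj₁ tw² * F N S ζ) v²≡ (proj₂ tw²)) T.bound {{bound-nonZero}} fixed-N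
          (p ℕ.^ a ℕ.* q ℕ.^ b) norm
      where
      open T.Twist (T.twist m n)
      tw² = Descent.twisted² per v d₁ k₁ d₂ k₂ v≡₁ v≡₂ (coprime-N v p∤v q∤v) a b norm
      ∤square : ∀ {r} → Prime r → ¬ (r ∣ v) → ¬ (r ∣ suc V′)
      ∤square {r} pr r∤v h = [ r∤v , r∤v ]′ (euclidsLemma v v pr (≡.subst (r ∣_) (≡.sym v²≡) h))
      divisible : ∀ d → N ∣ geometric (suc V′) d → N ∣ d
      divisible d h = ≡.subst (_∣ d) (≡.sym N≡) (coprime-∣* (coprime-prime-powers pp pq p≢q (suc m) (suc n))
        (geometric-∣ pp (suc m) (suc V′) d (κ₁ , V≡₁) (∣-trans (m∣m*n (q ℕ.^ suc n)) h′))
        (geometric-∣ pq (suc n) (suc V′) d (κ₂ , V≡₂) (∣-trans (n∣m*n (p ℕ.^ suc m)) h′)))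
        where
        h′ : p ℕ.^ suc m ℕ.* q ℕ.^ suc n ∣ geometric (suc V′) d
        h′ = ≡.subst (_∣ geometric (suc V′) d) N≡ h
      fixed-N : ∀ y → N ∣ V′ ℕ.* y → N ∣ T.bound ℕ.* y
      fixed-N y h = ≡.subst (_∣ T.bound ℕ.* y) (≡.sym N≡) (fixed y (≡.subst (_∣ V′ ℕ.* y) N≡ h))

    -- The norm A satisfies b A = a² ν and A < 2 a, so b ≤ a forces ν = 1; then A divides a² and
    -- hence has no prime factors besides p and q.
    size-bound : ∀ {S} (per : Periodic S) (ind : Indicator S) a b c → NormBound.size per ind ≡ + a → a ℕ.* b ≡ N →
      b ℕ.≤ a → 1 ℕ.≤ c →
      ι (+ b) * (F N S (conj ζ) * F N S ζ) ≈ ι (+ (a ℕ.* a ℕ.* c)) → a ℕ.≤ T.bound ℕ.+ T.bound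
    size-bound {S} per ind a b c size≡a ab≡N b≤a 1≤c eq = ℕ.≤-trans a≤A
      (≡.subst (ℕ._≤ T.bound ℕ.+ T.bound) (≡.sym A≡) (norm-bound per ind x y norm≈))
      where
      a≢0 : a ≢ 0
      a≢0 a≡0 = ℕ.≢-nonZero⁻¹ N (≡.trans (≡.sym ab≡N) (≡.cong (ℕ._* b) a≡0))
      b≢0 : b ≢ 0
      b≢0 b≡0 = ℕ.≢-nonZero⁻¹ N (≡.trans (≡.sym ab≡N) (≡.trans (≡.cong (a ℕ.*_) b≡0) (ℕ.*-zeroʳ a)))
      instance
        nz-a : NonZero a
        nz-a = ℕ.≢-nonZero a≢0
        nz-b : NonZero b
        nz-b = ℕ.≢-nonZero b≢0
        nz-c : NonZero c
        nz-c = ℕ.>-nonZero 1≤c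
      α : ℤ
      α = Δ (ν S) 0
      bα≡ : + b ℤ.* α ≡ + (a ℕ.* a ℕ.* c)
      bα≡ = norm-integral per (+ b) (+ (a ℕ.* a ℕ.* c)) eq
      F≉0 : ¬ (F N S ζ ≈ 0#)
      F≉0 h = ℕ.≢-nonZero⁻¹ (a ℕ.* a ℕ.* c) {{ℕ.m*n≢0 (a ℕ.* a) c {{ℕ.m*n≢0 a a}}}}
        (ℤ.+-injective (char0 _ (trans (sym eq) (trans (*-congˡ (trans (*-congˡ h) (zeroʳ _))) (zeroʳ _)))))
      α<2a : α ℤ.< + (a ℕ.+ a)
      α<2a = ≡.subst (α ℤ.<_) (≡.cong₂ ℤ._+_ size≡a size≡a) (NormBound.Δν<2size per ind F≉0)
      -- As an alternating sum α might be negative; b α = a² c rules this out.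
      natural-α : ∃[ A ] α ≡ + A
      natural-α = go α bα≡
        where
        go : ∀ z → + b ℤ.* z ≡ + (a ℕ.* a ℕ.* c) → ∃[ A ] z ≡ + A
        go (+ A) _ = A , ≡.refl
        go -[1+ k ] h = contradiction (≡.subst (ℤ.0ℤ ℤ.≤_) (≡.sym h) (ℤ.+≤+ z≤n)) (negative b)
          where
          negative : ∀ b .{{_ : NonZero b}} → ¬ (0ℤ ℤ.≤ + b ℤ.* -[1+ k ])
          negative (suc b) ()
      A = proj₁ natural-α
      bA≡ : b ℕ.* A ≡ a ℕ.* a ℕ.* c
      bA≡ = ℤ.+-injective (≡.trans (ℤ.pos-* b A) (≡.trans (≡.cong (λ z → + b ℤ.* z) (≡.sym (proj₂ natural-α))) bα≡))
      A<2a : A ℕ.< a ℕ.+ a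
      A<2a = ℤ.drop‿+<+ (≡.subst (ℤ._< + (a ℕ.+ a)) (proj₂ natural-α) α<2a)
      c<2 : c ℕ.< 2
      c<2 = ℕ.*-cancelˡ-< (a ℕ.* a) c 2 (begin-strict
        a ℕ.* a ℕ.* c           ≡⟨ bA≡ ⟨
        b ℕ.* A                 <⟨ ℕ.*-monoʳ-< b A<2a ⟩
        b ℕ.* (a ℕ.+ a)         ≤⟨ ℕ.*-monoˡ-≤ (a ℕ.+ a) b≤a ⟩
        a ℕ.* (a ℕ.+ a)         ≡⟨ double a ⟩
        a ℕ.* a ℕ.* 2           ∎)
        where open ℕ.≤-Reasoning
      c≡1 : c ≡ 1
      c≡1 = ℕ.≤-antisym (ℕ.≤-pred c<2) 1≤c
      bA≡a² : b ℕ.* A ≡ a ℕ.* a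
      bA≡a² = ≡.trans bA≡ (≡.trans (≡.cong (a ℕ.* a ℕ.*_) c≡1) (ℕ.*-identityʳ _))
      A≢0 : A ≢ 0
      A≢0 h = ℕ.≢-nonZero⁻¹ (a ℕ.* a) {{ℕ.m*n≢0 a a}}
        (≡.trans (≡.sym bA≡a²) (≡.trans (≡.cong (b ℕ.*_) h) (ℕ.*-zeroʳ b)))
      a≤A : a ℕ.≤ A
      a≤A = ℕ.*-cancelˡ-≤ b (≡.subst (b ℕ.* a ℕ.≤_) (≡.sym bA≡a²) (ℕ.*-monoˡ-≤ a b≤a))
      A-primes : ∀ {r} → Prime r → r ∣ A → r ≡ p ⊎ r ≡ q
      A-primes {r} pr r∣A = [ divides-a , divides-a ]′ (euclidsLemma a a pr (≡.subst (r ∣_) bA≡a² (∣n⇒∣m*n b r∣A)))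
        where
        divides-a : r ∣ a → r ≡ p ⊎ r ≡ q
        divides-a r∣a = N-primes pr (≡.subst (r ∣_) ab≡N (∣m⇒∣m*n b r∣a))
      sm = smooth pp pq A A≢0 A-primes
      x = proj₁ sm
      y = proj₁ (proj₂ sm)
      A≡ : A ≡ p ℕ.^ x ℕ.* q ℕ.^ y
      A≡ = proj₂ (proj₂ sm)
      norm≈A : F N S (conj ζ) * F N S ζ ≈ ι (+ A)
      norm≈A = cases (domain (ι (+ b)) _
        (trans (solve 3 (λ b x y → b :* (x :- y) := b :* x :- b :* y) ≡.refl (ι (+ b)) (F N S (conj ζ) * F N S ζ)
        (ι (+ A))) (≈⇒-≈0 (trans eq (trans (reflexive (≡.cong (λ k → ι (+ k)) (≡.sym bA≡))) (×1-homo-* b A))))))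
        where
        cases : ι (+ b) ≈ 0# ⊎ (F N S (conj ζ) * F N S ζ) - ι (+ A) ≈ 0# → F N S (conj ζ) * F N S ζ ≈ ι (+ A)
        cases (inj₁ h) = contradiction (ℤ.+-injective (char0 _ h)) b≢0
        cases (inj₂ h) = -≈0⇒≈ h
      norm≈ : F N S (conj ζ) * F N S ζ ≈ ι (+ (p ℕ.^ x ℕ.* q ℕ.^ y))
      norm≈ = trans norm≈A (reflexive (≡.cong (λ k → ι (+ k)) A≡))

-- From subsets to periodic functions

module SubsetFunctions where

  open import Data.Bool.Base using (Bool; true; false)
  open import Data.Nat.Divisibility using (_∣_; ∣⇒≤; ∣n∣m%n⇒∣m; _∣?_; ∣m∣n⇒∣m+n; ∣m+n∣m⇒∣n; %-presˡ-∣; _∣0; n∣m⇒m%n≡0; m%n≡0⇒n∣m)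
  open import Data.Nat.DivMod using (_%_; _mod_; m%n<n; m<n⇒m%n≡m; %-distribˡ-+; m%n%n≡m%n; [m+n]%n≡m%n)
  open import Data.Integer.Base using (+_)
  open import Data.Fin.Base as Fin using (Fin; toℕ)
  open import Data.Fin.Properties using (toℕ<n; toℕ-fromℕ<; toℕ-injective; ¬∀⟶∃¬)
  open import Data.Fin.Subset using (Subset; ∣_∣; _∈_; _∉_)
  open import Data.Fin.Subset.Properties using (_∈?_)
  open import Data.Vec.Base using (Vec; []; _∷_; lookup; tabulate)
  open import Data.Vec.Properties using (lookup∘tabulate; lookup⇒[]=; []=⇒lookup)
  open import Data.List.Base as List using (foldr)
  open import Data.Product.Base using (_×_)
  open import Relation.Nullary using (does)
  open import Relation.Nullary.Decidable using (_→-dec_; dec-true; dec-false)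
  open IntegerPolynomials
  open import Defs
  open Arithmetic

  bit : Bool → ℤ
  bit true = 1ℤ
  bit false = 0ℤ

  module _ (R : CommutativeRing 0ℓ 0ℓ) where
    open CommutativeRing R
    open RingSums R

    foldr-tabulate : ∀ n {A : Set} (h : Fin n → A) (g : A → Carrier) (f : ℕ → Carrier) → (∀ i → g (h i) ≈ f (toℕ i)) →
                     foldr (λ a acc → g a + acc) 0# (List.tabulate h) ≈ ∑ n f
    foldr-tabulate zero h g f eq = refl
    foldr-tabulate (suc n) h g f eq =
      trans (+-cong (eq Fin.zero) (foldr-tabulate n (h ∘ Fin.suc) g (f ∘ suc) (eq ∘ Fin.suc))) (sym (∑-head n f))

  foldr-ℕ : ∀ n {A : Set} (h : Fin n → A) (g : A → ℕ) (f : ℕ → ℤ) → (∀ i → + g (h i) ≡ f (toℕ i)) →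
            + foldr (λ a acc → g a ℕ.+ acc) 0 (List.tabulate h) ≡ ℤSums.∑ n f
  foldr-ℕ zero h g f eq = ≡.refl
  foldr-ℕ (suc n) h g f eq = ≡.trans (≡.cong₂ ℤ._+_ (eq Fin.zero) (foldr-ℕ n (h ∘ Fin.suc) g (f ∘ suc) (eq ∘ Fin.suc)))
    (≡.sym (ℤSums.∑-head n f))

  ∣∣≡∑ : ∀ n (S : Vec Bool n) (f : ℕ → ℤ) → (∀ i → f (toℕ i) ≡ bit (lookup S i)) → ℤSums.∑ n f ≡ + ∣ S ∣
  ∣∣≡∑ zero [] f eq = ≡.refl
  ∣∣≡∑ (suc n) (true ∷ S) f eq = ≡.trans (ℤSums.∑-head n f)
    (≡.cong₂ ℤ._+_ (eq Fin.zero) (∣∣≡∑ n S (f ∘ suc) (eq ∘ Fin.suc)))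
  ∣∣≡∑ (suc n) (false ∷ S) f eq = ≡.trans (ℤSums.∑-head n f)
    (≡.trans (≡.cong₂ ℤ._+_ (eq Fin.zero) (∣∣≡∑ n S (f ∘ suc) (eq ∘ Fin.suc))) (ℤ.+-identityˡ _))

  module SubsetFunction (N : ℕ) {{_ : NonZero N}} where
    open ZN N

    -- The indicator function, extended periodically to ℕ so that translates can be written with
    -- ordinary addition.
    fun : Subset N → ℕ → ℤ
    fun S x = bit (lookup S (x mod N))

    toℕ-mod : ∀ x → toℕ (x mod N) ≡ x % N
    toℕ-mod x = toℕ-fromℕ< (m%n<n x N)

    mod-toℕ : ∀ (i : Fin N) → toℕ i mod N ≡ i
    mod-toℕ i = toℕ-injective (≡.trans (toℕ-mod (toℕ i)) (m<n⇒m%n≡m (toℕ<n i)))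

    fun-toℕ : ∀ S i → fun S (toℕ i) ≡ bit (lookup S i)
    fun-toℕ S i = ≡.cong (λ j → bit (lookup S j)) (mod-toℕ i)

    fun-% : ∀ S x → fun S (x % N) ≡ fun S x
    fun-% S x = ≡.cong (λ j → bit (lookup S j))
      (toℕ-injective (≡.trans (toℕ-mod (x % N)) (≡.trans (m%n%n≡m%n x N) (≡.sym (toℕ-mod x)))))

    fun-periodic : ∀ S x → fun S (N ℕ.+ x) ≡ fun S x
    fun-periodic S x = ≡.trans (≡.sym (fun-% S (N ℕ.+ x)))
      (≡.trans (≡.cong (fun S) (≡.trans (≡.cong (_% N) (ℕ.+-comm N x)) ([m+n]%n≡m%n x N))) (fun-% S x))

    fun-indicator : ∀ S x → fun S x ≡ 0ℤ ⊎ fun S x ≡ 1ℤ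
    fun-indicator S x with lookup S (x mod N)
    ... | true = inj₂ ≡.refl
    ... | false = inj₁ ≡.refl

    fun-∈ : ∀ {S i} → i ∈ S → fun S (toℕ i) ≡ 1ℤ
    fun-∈ {S} {i} i∈S = ≡.trans (fun-toℕ S i) (≡.cong bit ([]=⇒lookup i∈S))

    size-fun : ∀ S → ℤSums.∑ N (fun S) ≡ + ∣ S ∣
    size-fun S = ∣∣≡∑ N S (fun S) (fun-toℕ S)

    indicator≡fun : ∀ S i → + indicator S i ≡ fun S (toℕ i)
    indicator≡fun S i = ≡.trans (go (lookup S i) ≡.refl) (≡.sym (fun-toℕ S i))
      where
      go : ∀ b → lookup S i ≡ b → + indicator S i ≡ bit (lookup S i)
      go _ _ with lookup S i
      ... | true = ≡.refl
      ... | false = ≡.refl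

    eqInd≡χ : ∀ a b → + eqInd a b ≡ χℤ (toℕ a ℕ.≟ toℕ b)
    eqInd≡χ a b with toℕ a ℕ.≡ᵇ toℕ b in eq | toℕ a ℕ.≟ toℕ b
    ... | true | yes _ = ≡.refl
    ... | false | no _ = ≡.refl
    ... | true | no a≢b = contradiction (ℕ.≡ᵇ⇒≡ (toℕ a) (toℕ b) (≡.subst T (≡.sym eq) _)) a≢b
      where open import Data.Bool.Base using (T)
    ... | false | yes a≡b = contradiction (≡.subst T eq (ℕ.≡⇒≡ᵇ (toℕ a) (toℕ b) a≡b)) id
      where open import Data.Bool.Base using (T)

    %-+-congˡ : ∀ a {b c} → b % N ≡ c % N → (a ℕ.+ b) % N ≡ (a ℕ.+ c) % N
    %-+-congˡ a {b} {c} eq = ≡.trans (%-distribˡ-+ a b N)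
      (≡.trans (≡.cong (λ r → (a % N ℕ.+ r) % N) eq) (≡.sym (%-distribˡ-+ a c N)))

    %-+-congʳ : ∀ a {b c} → b % N ≡ c % N → (b ℕ.+ a) % N ≡ (c ℕ.+ a) % N
    %-+-congʳ a {b} {c} eq = ≡.trans (≡.cong (_% N) (ℕ.+-comm b a))
      (≡.trans (%-+-congˡ a eq) (≡.cong (_% N) (ℕ.+-comm a c)))

    toℕ-−ᶻ : ∀ t t′ → toℕ (t -ᶻ t′) ≡ (toℕ t ℕ.+ (N ℕ.∸ toℕ t′)) % N
    toℕ-−ᶻ t t′ = ≡.trans (toℕ-mod _)
      (≡.trans (≡.cong (λ r → (toℕ t ℕ.+ r) % N) (toℕ-mod (N ℕ.∸ toℕ t′)))
      (%-+-congˡ (toℕ t) (m%n%n≡m%n (N ℕ.∸ toℕ t′) N)))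

    −-+ : ∀ {t t′} → t ℕ.< N → t′ ℕ.< N → ((t ℕ.+ (N ℕ.∸ t′)) % N ℕ.+ t′) % N ≡ t
    −-+ {t} {t′} t<N t′<N = ≡.trans (%-+-congʳ t′ (m%n%n≡m%n (t ℕ.+ (N ℕ.∸ t′)) N))
      (≡.trans (≡.cong (_% N) (≡.trans (ℕ.+-assoc t (N ℕ.∸ t′) t′) (≡.cong (t ℕ.+_) (ℕ.m∸n+n≡m (ℕ.<⇒≤ t′<N)))))
        (≡.trans ([m+n]%n≡m%n t N) (m<n⇒m%n≡m t<N)))

    +-− : ∀ {y t′} → y ℕ.< N → t′ ℕ.< N → ((y ℕ.+ t′) % N ℕ.+ (N ℕ.∸ t′)) % N ≡ y
    +-− {y} {t′} y<N t′<N = ≡.trans (%-+-congʳ (N ℕ.∸ t′) (m%n%n≡m%n (y ℕ.+ t′) N))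
      (≡.trans (≡.cong (_% N) (≡.trans (ℕ.+-assoc y t′ (N ℕ.∸ t′)) (≡.cong (y ℕ.+_) (ℕ.m+[n∸m]≡n (ℕ.<⇒≤ t′<N)))))
        (≡.trans ([m+n]%n≡m%n y N) (m<n⇒m%n≡m y<N)))

    -- For fixed t′ the only t with t - t′ = y is y + t′ modulo N, so the double count collapses to
    -- a single sum.
    ν≡ : ∀ T (y : Fin N) → + ZN.ν N T y ≡ ℤSums.∑ N (λ x → fun T x ℤ.* fun T (toℕ y ℕ.+ x))
    ν≡ T y = ≡.trans (foldr-ℕ N id (λ t → sumℕ (λ t′ → indicator T t ℕ.* indicator T t′ ℕ.* eqInd (t -ᶻ t′) y))
      (λ t → ℤSums.∑ N (λ t′ → term t t′)) outer)
      (≡.trans (ℤSums.∑-swap N N term)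
        (ℤSums.∑-cong N {λ t′ → ℤSums.∑ N (λ t → term t t′)} {λ x → fun T x ℤ.* fun T (toℕ y ℕ.+ x)} collapse))
      where
      e : ∀ t t′ → Dec ((t ℕ.+ (N ℕ.∸ t′)) % N ≡ toℕ y)
      e t t′ = (t ℕ.+ (N ℕ.∸ t′)) % N ℕ.≟ toℕ y
      term : ℕ → ℕ → ℤ
      term t t′ = fun T t ℤ.* fun T t′ ℤ.* χℤ (e t t′)
      inner : ∀ t t′ → + (indicator T t ℕ.* indicator T t′ ℕ.* eqInd (t -ᶻ t′) y) ≡ term (toℕ t) (toℕ t′)
      inner t t′ = ≡.trans (ℤ.pos-* (indicator T t ℕ.* indicator T t′) (eqInd (t -ᶻ t′) y)) (≡.cong₂ ℤ._*_
        (≡.trans (ℤ.pos-* (indicator T t) (indicator T t′)) (≡.cong₂ ℤ._*_ (indicator≡fun T t) (indicator≡fun T t′)))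
        (≡.trans (eqInd≡χ (t -ᶻ t′) y) (≡.cong (λ r → χℤ (r ℕ.≟ toℕ y)) (toℕ-−ᶻ t t′))))
      outer : ∀ t → + sumℕ (λ t′ → indicator T t ℕ.* indicator T t′ ℕ.* eqInd (t -ᶻ t′) y) ≡ ℤSums.∑ N (term (toℕ t))
      outer t = foldr-ℕ N id (λ t′ → indicator T t ℕ.* indicator T t′ ℕ.* eqInd (t -ᶻ t′) y) (term (toℕ t)) (inner t)
      χℤ-yes : ∀ {P : Set} (d : Dec P) → P → χℤ d ≡ 1ℤ
      χℤ-yes (yes _) _ = ≡.refl
      χℤ-yes (no ¬p) p = contradiction p ¬p
      χℤ-no : ∀ {P : Set} (d : Dec P) → ¬ P → χℤ d ≡ 0ℤ
      χℤ-no (yes p) ¬p = contradiction p ¬p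
      χℤ-no (no _) _ = ≡.refl
      collapse : ∀ t′ → t′ ℕ.< N → ℤSums.∑ N (λ t → term t t′) ≡ fun T t′ ℤ.* fun T (toℕ y ℕ.+ t′)
      collapse t′ t′<N = ≡.trans (ℤSums.∑-single N k (λ t → term t t′) (m%n<n (toℕ y ℕ.+ t′) N) off)
        (≡.trans (≡.cong (λ d → fun T k ℤ.* fun T t′ ℤ.* d) (χℤ-yes (e k t′) (+-− (toℕ<n y) t′<N)))
          (≡.trans (ℤ.*-identityʳ _) (≡.trans (ℤ.*-comm (fun T k) (fun T t′))
            (≡.cong (fun T t′ ℤ.*_) (fun-% T (toℕ y ℕ.+ t′))))))
        where
        k = (toℕ y ℕ.+ t′) % N
        off : ∀ t → t ℕ.< N → t ≢ k → term t t′ ≡ 0ℤ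
        off t t<N t≢k = ≡.trans (≡.cong (fun T t ℤ.* fun T t′ ℤ.*_)
          (χℤ-no (e t t′) (λ eq → t≢k (≡.trans (≡.sym (−-+ t<N t′<N)) (≡.cong (λ r → (r ℕ.+ t′) % N) eq)))))
          (ℤ.*-zeroʳ (fun T t ℤ.* fun T t′))

    multiples : ℕ → Subset N
    multiples r = tabulate (λ i → does (r ∣? toℕ i))

    ∈-multiples⁺ : ∀ {r i} → r ∣ toℕ i → i ∈ multiples r
    ∈-multiples⁺ {r} {i} h = lookup⇒[]= i (multiples r)
      (≡.trans (lookup∘tabulate (λ i → does (r ∣? toℕ i)) i) (dec-true (r ∣? toℕ i) h))

    ∈-multiples⁻ : ∀ {r i} → i ∈ multiples r → r ∣ toℕ i
    ∈-multiples⁻ {r} {i} h with r ∣? toℕ i in eq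
    ... | yes r∣i = r∣i
    ... | no r∤i = contradiction (≡.trans (≡.sym ([]=⇒lookup h))
      (≡.trans (lookup∘tabulate (λ i → does (r ∣? toℕ i)) i) (dec-false (r ∣? toℕ i) r∤i))) λ ()

    multiples-subgroup : ∀ {r} → r ∣ N → IsSubgroup (multiples r)
    multiples-subgroup {r} r∣N = record
      { has-0 = ∈-multiples⁺ (≡.subst (r ∣_) (≡.sym (toℕ-mod 0)) (%-presˡ-∣ (r ∣0) r∣N))
      ; +-clos = λ a b ha hb → ∈-multiples⁺
        (≡.subst (r ∣_) (≡.sym (toℕ-mod (toℕ a ℕ.+ toℕ b)))
        (%-presˡ-∣ (∣m∣n⇒∣m+n (∈-multiples⁻ ha) (∈-multiples⁻ hb)) r∣N))
      ; neg-clos = λ a ha → ∈-multiples⁺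
        (≡.subst (r ∣_) (≡.sym (toℕ-mod (N ℕ.∸ toℕ a)))
        (%-presˡ-∣ (∣m+n∣m⇒∣n (≡.subst (r ∣_) (≡.sym (ℕ.m+[n∸m]≡n (ℕ.<⇒≤ (toℕ<n a)))) r∣N) (∈-multiples⁻ ha)) r∣N))
      }

    −-congruent : ∀ {r} .{{_ : NonZero r}} → r ∣ N → ∀ t t₀ → toℕ t % r ≡ toℕ t₀ % r → r ∣ toℕ (t -ᶻ t₀)
    −-congruent {r} r∣N t t₀ eq = ≡.subst (r ∣_) (≡.sym (toℕ-−ᶻ t t₀)) (%-presˡ-∣ (m%n≡0⇒n∣m _ r (begin
      (toℕ t ℕ.+ (N ℕ.∸ toℕ t₀)) % r              ≡⟨ %-distribˡ-+ (toℕ t) (N ℕ.∸ toℕ t₀) r ⟩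
      (toℕ t % r ℕ.+ (N ℕ.∸ toℕ t₀) % r) % r      ≡⟨ ≡.cong (λ x → (x ℕ.+ (N ℕ.∸ toℕ t₀) % r) % r) eq ⟩
      (toℕ t₀ % r ℕ.+ (N ℕ.∸ toℕ t₀) % r) % r     ≡⟨ %-distribˡ-+ (toℕ t₀) (N ℕ.∸ toℕ t₀) r ⟨
      (toℕ t₀ ℕ.+ (N ℕ.∸ toℕ t₀)) % r             ≡⟨ ≡.cong (_% r) (ℕ.m+[n∸m]≡n (ℕ.<⇒≤ (toℕ<n t₀))) ⟩
      N % r                                       ≡⟨ n∣m⇒m%n≡0 N r r∣N ⟩
      0                                           ∎)) r∣N)
      where open ≡.≡-Reasoning

    -- Otherwise T would lie in the coset of t₀ modulo the multiples of r, a proper subgroup because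
    -- r > 1 divides N and so does not divide 1 modulo N. Primitivity enters through this lemma, for
    -- r = p and r = q.
    incongruent-element : ∀ {r} .{{_ : NonZero r}} → 1 ℕ.< r → r ∣ N → ∀ {T} → Primitive T → ∀ t₀ →
      ∃[ t ] (t ∈ T × toℕ t % r ≢ toℕ t₀ % r)
    incongruent-element {r} 1<r r∣N {T} prim t₀ with ¬∀⟶∃¬ N (λ t → t ∈ T → toℕ t % r ≡ toℕ t₀ % r)
      (λ t → (t ∈? T) →-dec (toℕ t % r ℕ.≟ toℕ t₀ % r)) (λ all →
      prim (multiples r , multiples-subgroup r∣N , (1 mod N , 1∉) , t₀ , λ t t∈T →
      t -ᶻ t₀ , ∈-multiples⁺ (−-congruent r∣N t t₀ (all t t∈T)) , recover t))
      where
      1∉ : 1 mod N ∉ multiples r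
      1∉ h = ℕ.<⇒≱ 1<r (∣⇒≤ (∣n∣m%n⇒∣m r∣N (≡.subst (r ∣_) (toℕ-mod 1) (∈-multiples⁻ h))))
      recover : ∀ t → t ≡ t₀ +ᶻ (t -ᶻ t₀)
      recover t = toℕ-injective (≡.sym
        (≡.trans (toℕ-mod _) (≡.trans (≡.cong (λ x → (toℕ t₀ ℕ.+ x) % N) (toℕ-−ᶻ t t₀))
        (≡.trans (≡.cong (_% N) (ℕ.+-comm (toℕ t₀) _)) (−-+ (toℕ<n t) (toℕ<n t₀))))))
    ... | t , ¬h with t ∈? T
    ...   | yes t∈T = t , t∈T , λ eq → ¬h (λ _ → eq)
    ...   | no t∉T = contradiction (λ t∈T → contradiction t∈T t∉T) ¬h

open import Data.Bool.Base using (true; false)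
open import Data.Nat.Divisibility using (_∣_; _∣?_; ∣⇒≤; m∣m*n; n∣m*n; m%n≡0⇒n∣m; ∣m+n∣m⇒∣n)
open import Data.Nat.DivMod using (_%_; m%n<n; %-remove-+ˡ; m∣n⇒o%n%m≡o%m)
open import Data.Nat.Primality using (prime?; euclidsLemma)
open import Data.Nat.Primality.Factorisation using (factorisationHasAllPrimeFactors)
open import Data.Nat.Coprimality using (coprime-divisor)
import Data.Nat.Coprimality as Coprimality
open import Data.Nat.ListAction.Properties using (∈⇒∣product)
open import Data.List.Base using (filter; upTo)
open import Data.List.Relation.Unary.All as All using (All)
open import Data.List.Relation.Unary.All.Properties using (all-filter)
open import Data.List.Membership.Propositional.Properties using (∈-filter⁺; ∈-filter⁻; ∈-upTo⁺)
open import Data.Integer.Base using (+_; -[1+_])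
open import Data.Fin.Base using (Fin; toℕ; fromℕ<)
open import Data.Fin.Properties using (toℕ<n; toℕ-fromℕ<)
open import Data.Fin.Subset using (Subset; ∣_∣; _∈_; Nonempty)
open import Data.Vec.Base using (lookup)
open import Data.Product.Base using (_×_)
open import Relation.Nullary.Decidable using (_×-dec_)
import Algebra.Properties.Semiring.Exp
open IntegerPolynomials
open import Defs
open Arithmetic
open Cyclotomic using (Root)
open NormDescent using (module Core)
open SizeBound
open SubsetFunctions

-- The shape of N

module Radical {N p q : ℕ} {{_ : NonZero N}} (pp : Prime p) (pq : Prime q) (p≢q : p ≢ q) (rad≡ : rad N ≡ p ℕ.* q) where

  private
    divisor? = λ r → prime? r ×-dec (r ∣? N)
    divisors = filter divisor? (upTo (suc N))

  rad-∣ : ∀ {r} → Prime r → r ∣ p ℕ.* q → r ∣ N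
  rad-∣ pr r∣pq = proj₂ (proj₂ (∈-filter⁻ divisor? {xs = upTo (suc N)}
    (factorisationHasAllPrimeFactors pr (≡.subst (_ ∣_) (≡.sym rad≡) r∣pq)
    (All.map proj₁ (all-filter divisor? (upTo (suc N)))))))

  N-primes : ∀ {r} → Prime r → r ∣ N → r ≡ p ⊎ r ≡ q
  N-primes {r} pr r∣N = [ (λ r∣p → inj₁ (prime≡ pp r∣p)) , (λ r∣q → inj₂ (prime≡ pq r∣q)) ]′
    (euclidsLemma p q pr (≡.subst (r ∣_) rad≡ (∈⇒∣product (∈-filter⁺ divisor? (∈-upTo⁺ (s≤s (∣⇒≤ r∣N))) (pr , r∣N)))))
    where
    prime≡ : ∀ {s} → Prime s → r ∣ s → r ≡ s
    prime≡ {s} ps r∣s = NormDescent.prime∣^⇒≡ ps pr 1 (≡.subst (r ∣_) (≡.sym (ℕ.^-identityʳ s)) r∣s)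

  -- No primes besides p and q divide N, and both exponents are positive because p and q divide the
  -- radical.
  factorization : ∃[ m ] ∃[ n ] N ≡ p ℕ.^ suc m ℕ.* q ℕ.^ suc n
  factorization = positive (smooth pp pq N (ℕ.≢-nonZero⁻¹ N) N-primes)
    where
    positive : ∃[ a ] ∃[ b ] N ≡ p ℕ.^ a ℕ.* q ℕ.^ b → ∃[ m ] ∃[ n ] N ≡ p ℕ.^ suc m ℕ.* q ℕ.^ suc n
    positive (zero , b , eq) = contradiction (≡.subst (p ∣_) (≡.trans eq (ℕ.*-identityˡ _)) (rad-∣ pp (m∣m*n q)))
      (prime-∤-^ pp pq p≢q b)
    positive (suc a , zero , eq) = contradiction (≡.subst (q ∣_) (≡.trans eq (ℕ.*-identityʳ _)) (rad-∣ pq (n∣m*n p)))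
      (prime-∤-^ pq pp (p≢q ∘ ≡.sym) (suc a))
    positive (suc a , suc b , eq) = a , b , eq

-- Primitive roots in the given model

module Model {N : ℕ} {{_ : NonZero N}} (M : CyclotomicModel N) where
  open CyclotomicModel M renaming (_*ᴿ_ to _*_; _+ᴿ_ to _+_)
  open RingSums R using (ι; ×≈ι*)
  open Evaluation R using (^-%; ^-*N)
  open import Algebra.Properties.Group +-group using (⁻¹-involutive; ε⁻¹≈ε)
  open Algebra.Properties.Semiring.Exp semiring using (^-assocʳ)

  char0ℤ : ∀ c → ι c ≈ 0# → c ≡ 0ℤ
  char0ℤ (+ n) h = ≡.cong +_ (char0 n h)
  char0ℤ -[1+ n ] h with char0 (suc n) (trans (sym (⁻¹-involutive _)) (trans (-‿cong h) ε⁻¹≈ε))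
  ... | ()

  ζ-order : ∀ k → ζ ^ k ≈ 1# → N ∣ k
  ζ-order k h with k % N ℕ.≟ 0
  ... | yes eq = m%n≡0⇒n∣m k N eq
  ... | no neq = contradiction (trans (^-% ζ^N≈1 k) h) (ζ-primitive (k % N) (ℕ.n≢0⇒n>0 neq) (m%n<n k N))

  root : Root N
  root = record { R = R ; domain = domain ; char0 = char0ℤ ; ζ = ζ ; ζ^N≈1 = ζ^N≈1 ; order = ζ-order }

  -- The duality identity at y concerns ζ^y. For y prime to N this is again a primitive root, and
  -- choosing it as the root turns the identity into one about the norm of S.
  conjugate-root : ∀ u → Coprime N u → Root N
  conjugate-root u N⊥u = record
    { R = R ; domain = domain ; char0 = char0ℤ ; ζ = ζ ^ u
    ; ζ^N≈1 = trans (^-assocʳ ζ u N) (^-*N ζ^N≈1 u)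
    ; order = λ k h → coprime-divisor N⊥u (ζ-order (u ℕ.* k) (trans (sym (^-assocʳ ζ u k)) h)) }

-- Formal duality

module Duality {N : ℕ} {{_ : NonZero N}} (M : CyclotomicModel N) {p q : ℕ} (pp : Prime p) (pq : Prime q) (p≢q : p ≢ q)
  (m n : ℕ) (N≡ : N ≡ p ℕ.^ suc m ℕ.* q ℕ.^ suc n) (S T : Subset N) (dual : Dual.FormallyDual M S T) where

  open CyclotomicModel M using (ζ⁻¹; _·1_)
  open Model M
  open Core root pp pq p≢q m n N≡
  open SubsetFunction N
  open import Algebra.Properties.Semiring.Exp semiring using (_^_; ^-congˡ; ^-congʳ; ^-homo-*; ^-assocʳ)
  open import Algebra.Properties.Semiring.Mult semiring using (×1-homo-*)
  open import Relation.Binary.Reasoning.Setoid setoid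

  s t : ℕ
  s = ∣ S ∣
  t = ∣ T ∣

  restrict≈ : ∀ U f i → Dual.restrict M U f i ≈ ι (fun U (toℕ i)) * f i
  restrict≈ U f i = trans go (*-congʳ (reflexive (≡.cong ι (≡.sym (fun-toℕ U i)))))
    where
    go : Dual.restrict M U f i ≈ ι (bit (lookup U i)) * f i
    go with lookup U i
    ... | true = sym (trans (*-congʳ ι-1) (*-identityˡ _))
    ... | false = sym (zeroˡ _)

  Ŝ≈F : ∀ U y → Dual.Ŝ M U y ≈ F N (fun U) (ζ ^ toℕ y)
  Ŝ≈F U y = foldr-tabulate R N id _ (λ x → ι (fun U x) * (ζ ^ toℕ y) ^ x)
    (λ i → trans (restrict≈ U (λ x → ζ ^ (toℕ x ℕ.* toℕ y)) i)
    (*-congˡ (trans (^-congʳ ζ (ℕ.*-comm (toℕ i) (toℕ y))) (sym (^-assocʳ ζ (toℕ y) (toℕ i))))))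

  Ŝ̄≈F : ∀ U y → Dual.Ŝ̄ M U y ≈ F N (fun U) (conj (ζ ^ toℕ y))
  Ŝ̄≈F U y = foldr-tabulate R N id _ (λ x → ι (fun U x) * conj (ζ ^ toℕ y) ^ x)
    (λ i → trans (restrict≈ U (λ x → ζ⁻¹ ^ (toℕ x ℕ.* toℕ y)) i)
    (*-congˡ (trans (^-congʳ ζ⁻¹ (ℕ.*-comm (toℕ i) (toℕ y)))
      (trans (sym (^-assocʳ ζ⁻¹ (toℕ y) (toℕ i))) (^-congˡ (toℕ i)
      (trans (^-assocʳ ζ (N ℕ.∸ 1) (toℕ y))
        (trans (^-congʳ ζ (ℕ.*-comm (N ℕ.∸ 1) (toℕ y))) (sym (^-assocʳ ζ (toℕ y) (N ℕ.∸ 1))))))))))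

  norm : Subset N → Carrier → Carrier
  norm U w = F N (fun U) (conj w) * F N (fun U) w

  primal : ∀ y → ι (+ t) * norm S (ζ ^ toℕ y) ≈ ι (+ (s ℕ.* s ℕ.* ZN.ν N T y))
  primal y = trans (trans (*-congˡ (trans (*-comm _ _) (sym (*-cong (Ŝ≈F S y) (Ŝ̄≈F S y))))) (sym (×≈ι* t _)))
    (proj₂ (proj₂ dual) y)

  νᵀ νˢ : ℕ → ℤ
  νᵀ = ν (fun T)
  νˢ = ν (fun S)

  primal-ℕ : ∀ y → y ℕ.< N → ι (+ (s ℕ.* s)) * ι (νᵀ y) ≈ ι (+ t) * norm S (ζ ^ y)
  primal-ℕ y y<N = ≡.subst (λ z → ι (+ (s ℕ.* s)) * ι (νᵀ z) ≈ ι (+ t) * norm S (ζ ^ z)) (toℕ-fromℕ< y<N)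
    (trans (*-congˡ (reflexive (≡.cong ι (≡.sym (ν≡ T (fromℕ< y<N))))))
      (trans (sym (×1-homo-* (s ℕ.* s) (ZN.ν N T (fromℕ< y<N)))) (sym (primal (fromℕ< y<N)))))

  -- Fourier inversion applied to the defining identity.
  inverted : ∀ k → k ℕ.< N → ι (+ (s ℕ.* s)) * norm T (ζ ^ (N ℕ.∸ k)) ≈ ι (+ t) * (ι (νˢ k) * ι (+ N))
  inverted k k<N = begin
    ι (+ (s ℕ.* s)) * norm T w
      ≈⟨ *-congˡ (F-ν {fun T} (fun-periodic T) (root^ e)) ⟨
    ι (+ (s ℕ.* s)) * F N νᵀ w                                        ≈⟨ ∑-*ˡ N _ _ ⟩
    ∑ N (λ y → ι (+ (s ℕ.* s)) * (ι (νᵀ y) * w ^ y))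
      ≈⟨ ∑-cong N (λ y y<N → trans (sym (*-assoc _ _ _)) (trans (*-congʳ (primal-ℕ y y<N)) (*-assoc _ _ _))) ⟩
    ∑ N (λ y → ι (+ t) * (norm S (ζ ^ y) * w ^ y))                    ≈⟨ ∑-*ˡ N _ _ ⟨
    ι (+ t) * ∑ N (λ y → norm S (ζ ^ y) * w ^ y)
      ≈⟨ *-congˡ (∑-cong N (λ y _ → trans (*-congʳ (sym (F-ν {fun S} (fun-periodic S) (root^ y))))
      (trans (∑-*ʳ N _ _) (∑-cong N (λ x _ → term x y))))) ⟩
    ι (+ t) * ∑ N (λ y → ∑ N (λ x → ι (νˢ x) * (ζ ^ (x ℕ.+ e)) ^ y))
      ≈⟨ *-congˡ (trans (∑-swap N N _) (∑-cong N (λ x _ → sym (∑-*ˡ N _ _)))) ⟩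
    ι (+ t) * ∑ N (λ x → ι (νˢ x) * ∑ N ((ζ ^ (x ℕ.+ e)) ^_))
      ≈⟨ *-congˡ (∑-single N k (λ x → ι (νˢ x) * ∑ N ((ζ ^ (x ℕ.+ e)) ^_)) k<N
      (λ x x<N x≢k → trans (*-congˡ (character-sum-offdiagonal k<N x<N x≢k)) (zeroʳ _))) ⟩
    ι (+ t) * (ι (νˢ k) * ∑ N ((ζ ^ (k ℕ.+ e)) ^_))
      ≈⟨ *-congˡ (*-congˡ (character-sum-diagonal k<N)) ⟩
    ι (+ t) * (ι (νˢ k) * ι (+ N))                                    ∎
    where
    e = N ℕ.∸ k
    w = ζ ^ e
    term : ∀ x y → ι (νˢ x) * (ζ ^ y) ^ x * w ^ y ≈ ι (νˢ x) * (ζ ^ (x ℕ.+ e)) ^ y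
    term x y = trans (*-assoc _ _ _)
      (*-congˡ (trans (*-cong (trans (^-assocʳ ζ y x) (trans (^-congʳ ζ (ℕ.*-comm y x)) (sym (^-assocʳ ζ x y)))) refl)
      (trans (sym (*-^ (ζ ^ x) w y)) (^-congˡ y (sym (^-homo-* ζ x e))))))

  nonempty-size : ∀ U → Nonempty U → ∣ U ∣ ≢ 0
  nonempty-size U (i , i∈U) eq = contradiction
    (≡.trans (≡.sym (fun-∈ i∈U)) (∑-nonneg-zero N {fun U} nonneg (ℤ.≤-reflexive (≡.trans (size-fun U) (≡.cong +_ eq)))
    (toℕ i) (toℕ<n i))) λ ()
    where
    nonneg : ∀ x → x ℕ.< N → 0ℤ ℤ.≤ fun U x
    nonneg x _ = [ (λ eq → ℤ.≤-reflexive (≡.sym eq)) , (λ eq → ≡.subst (0ℤ ℤ.≤_) (≡.sym eq) (ℤ.+≤+ z≤n)) ]′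
      (fun-indicator U x)

  private
    instance
      nz-s : NonZero s
      nz-s = ℕ.≢-nonZero (nonempty-size S (proj₁ dual))
      nz-t : NonZero t
      nz-t = ℕ.≢-nonZero (nonempty-size T (proj₁ (proj₂ dual)))

  ι-injective : ∀ {a b} → ι (+ a) ≈ ι (+ b) → a ≡ b
  ι-injective {a} {b} h = ℤ.+-injective
    (ℤ.i-j≡0⇒i≡j (+ a) (+ b) (char0 (+ a ℤ.- + b)
    (trans (ι-+ (+ a) (ℤ.- + b)) (trans (+-congˡ (ι-neg (+ b))) (≈⇒-≈0 h)))))

  cancel-ι : ∀ a .{{_ : NonZero a}} {x y} → ι (+ a) * x ≈ ι (+ a) * y → x ≈ y
  cancel-ι a {x} {y} h = [ (λ a≈0 → contradiction (ℤ.+-injective (char0 (+ a) a≈0)) (ℕ.≢-nonZero⁻¹ a)) , -≈0⇒≈ ]′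
    (domain (ι (+ a)) (x - y) (trans (solve 3 (λ a x y → a :* (x :- y) := a :* x :- a :* y) ≡.refl (ι (+ a)) x y)
      (≈⇒-≈0 h)))

  norm-at-1 : ∀ U {w} → w ≈ 1# → norm U w ≈ ι (+ ∣ U ∣) * ι (+ ∣ U ∣)
  norm-at-1 U h = *-cong (at-1 (trans (^-congˡ (N ℕ.∸ 1) h) (1^ (N ℕ.∸ 1)))) (at-1 h)
    where
    at-1 : ∀ {w} → w ≈ 1# → F N (fun U) w ≈ ι (+ ∣ U ∣)
    at-1 h = trans (∑-cong N (λ i _ → trans (*-congˡ (trans (^-congˡ i h) (1^ i))) (*-identityʳ _)))
      (trans (sym (ι-∑ℤ N (fun U))) (reflexive (≡.cong ι (size-fun U))))

  νˢ-0 : νˢ 0 ≡ + s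
  νˢ-0 = ≡.trans (NormBound.ν-0 (fun-periodic S) (fun-indicator S)) (size-fun S)

  -- The inverted identity at k = 0 reads s² t² = t s N.
  st≡N : s ℕ.* t ≡ N
  st≡N = ℕ.*-cancelˡ-≡ (s ℕ.* t) N (t ℕ.* s) {{ℕ.m*n≢0 t s}} (ι-injective (begin
    ι (+ (t ℕ.* s ℕ.* (s ℕ.* t)))                  ≡⟨ ≡.cong (λ k → ι (+ k)) (square-product s t) ⟩
    ι (+ (s ℕ.* s ℕ.* (t ℕ.* t)))                  ≈⟨ trans (×1-homo-* (s ℕ.* s) (t ℕ.* t)) (*-congˡ (×1-homo-* t t)) ⟩
    ι (+ (s ℕ.* s)) * (ι (+ t) * ι (+ t))          ≈⟨ *-congˡ (norm-at-1 T ζ^N≈1) ⟨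
    ι (+ (s ℕ.* s)) * norm T (ζ ^ N)               ≈⟨ inverted 0 (ℕ.>-nonZero⁻¹ N) ⟩
    ι (+ t) * (ι (νˢ 0) * ι (+ N))                 ≈⟨ *-congˡ (*-congʳ (reflexive (≡.cong ι νˢ-0))) ⟩
    ι (+ t) * (ι (+ s) * ι (+ N))                  ≈⟨ *-assoc _ _ _ ⟨
    (ι (+ t) * ι (+ s)) * ι (+ N)                  ≈⟨ trans (×1-homo-* (t ℕ.* s) N) (*-congʳ (×1-homo-* t s)) ⟨
    ι (+ (t ℕ.* s ℕ.* N))                          ∎))

  -- Fourier inversion together with s t = N exchanges the roles of S and T, at ζ^(-k) instead of
  -- ζ^k. So the larger of the two sets can be bounded whichever it is.
  converse : ∀ (k : Fin N) → ι (+ s) * norm T (ζ ^ (N ℕ.∸ toℕ k)) ≈ ι (+ (t ℕ.* t ℕ.* ZN.ν N S k))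
  converse k = cancel-ι s (begin
    ι (+ s) * (ι (+ s) * norm T w)              ≈⟨ trans (sym (*-assoc _ _ _)) (*-congʳ (sym (×1-homo-* s s))) ⟩
    ι (+ (s ℕ.* s)) * norm T w                  ≈⟨ inverted (toℕ k) (toℕ<n k) ⟩
    ι (+ t) * (ι (νˢ (toℕ k)) * ι (+ N))
      ≈⟨ *-congˡ (*-cong (reflexive (≡.cong ι (≡.sym (ν≡ S k))))
      (trans (reflexive (≡.cong (λ a → ι (+ a)) (≡.sym st≡N))) (×1-homo-* s t))) ⟩
    ι (+ t) * (ι (+ c) * (ι (+ s) * ι (+ t)))
      ≈⟨ solve 3 (λ t c s → t :* (c :* (s :* t)) := s :* ((t :* t) :* c)) ≡.refl (ι (+ t)) (ι (+ c)) (ι (+ s)) ⟩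
    ι (+ s) * ((ι (+ t) * ι (+ t)) * ι (+ c))   ≈⟨ *-congˡ (trans (×1-homo-* (t ℕ.* t) c) (*-congʳ (×1-homo-* t t))) ⟨
    ι (+ s) * ι (+ (t ℕ.* t ℕ.* c))             ∎)
    where
    w = ζ ^ (N ℕ.∸ toℕ k)
    c = ZN.ν N S k

  -- Primitivity gives one element that differs from t₀ modulo p and one that differs from it modulo
  -- q. Either may already differ from t₀ modulo both primes; if neither does, they differ from each
  -- other modulo both.
  unit-difference : ∀ U → Nonempty U → ZN.Primitive N U → ∃[ y ] (Coprime N (toℕ y) × 1 ℕ.≤ ZN.ν N U y)
  unit-difference U (t₀ , t₀∈U) prim = choose (incongruent-element 1<p p∣N prim t₀)
    (incongruent-element 1<q q∣N prim t₀)
    where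
    instance
      nz-p : NonZero p
      nz-p = prime⇒nonZero pp
      nz-q : NonZero q
      nz-q = prime⇒nonZero pq
    1<p = ℕ.nonTrivial⇒n>1 p {{prime⇒nonTrivial pp}}
    1<q = ℕ.nonTrivial⇒n>1 q {{prime⇒nonTrivial pq}}
    difference : ∀ t₁ t₂ → t₁ ∈ U → t₂ ∈ U → toℕ t₁ % p ≢ toℕ t₂ % p → toℕ t₁ % q ≢ toℕ t₂ % q →
      ∃[ y ] (Coprime N (toℕ y) × 1 ℕ.≤ ZN.ν N U y)
    difference t₁ t₂ t₁∈U t₂∈U ≢p ≢q = y , Coprimality.sym (coprime-N (toℕ y) (∤y p∣N ≢p) (∤y q∣N ≢q)) , ℕ.n≢0⇒n>0 ν≢0
      where
      y = ZN._-ᶻ_ N t₁ t₂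
      y+t₂ : (toℕ y ℕ.+ toℕ t₂) % N ≡ toℕ t₁
      y+t₂ = ≡.trans (≡.cong (λ r → (r ℕ.+ toℕ t₂) % N) (toℕ-−ᶻ t₁ t₂)) (−-+ (toℕ<n t₁) (toℕ<n t₂))
      ∤y : ∀ {r} .{{_ : NonZero r}} → r ∣ N → toℕ t₁ % r ≢ toℕ t₂ % r → ¬ (r ∣ toℕ y)
      ∤y {r} r∣N ≢r r∣y = ≢r (≡.trans (≡.cong (_% r) (≡.sym y+t₂))
        (≡.trans (m∣n⇒o%n%m≡o%m r N (toℕ y ℕ.+ toℕ t₂) r∣N) (%-remove-+ˡ (toℕ t₂) r∣y)))
      summand : ℕ → ℤ
      summand x = fun U x ℤ.* fun U (toℕ y ℕ.+ x)
      nonneg : ∀ x → x ℕ.< N → 0ℤ ℤ.≤ summand x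
      nonneg x _ = go (fun-indicator U x) (fun-indicator U (toℕ y ℕ.+ x))
        where
        go : ∀ {a b} → a ≡ 0ℤ ⊎ a ≡ 1ℤ → b ≡ 0ℤ ⊎ b ≡ 1ℤ → 0ℤ ℤ.≤ a ℤ.* b
        go (inj₁ ≡.refl) _ = ℤ.≤-refl
        go (inj₂ ≡.refl) (inj₁ ≡.refl) = ℤ.≤-refl
        go (inj₂ ≡.refl) (inj₂ ≡.refl) = ℤ.+≤+ z≤n
      summand≡1 : summand (toℕ t₂) ≡ 1ℤ
      summand≡1 = ≡.cong₂ ℤ._*_ (fun-∈ t₂∈U)
        (≡.trans (≡.sym (fun-% U (toℕ y ℕ.+ toℕ t₂))) (≡.trans (≡.cong (fun U) y+t₂) (fun-∈ t₁∈U)))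
      ν≢0 : ZN.ν N U y ≢ 0
      ν≢0 eq = contradiction (≡.trans (≡.sym summand≡1)
        (∑-nonneg-zero N {summand} nonneg (ℤ.≤-reflexive (≡.trans (≡.sym (ν≡ U y)) (≡.cong +_ eq))) (toℕ t₂)
        (toℕ<n t₂))) λ ()
    choose : _ → _ → ∃[ y ] (Coprime N (toℕ y) × 1 ℕ.≤ ZN.ν N U y)
    choose (t₁ , t₁∈U , t₁≢p) (t₂ , t₂∈U , t₂≢q) with toℕ t₁ % q ℕ.≟ toℕ t₀ % q | toℕ t₂ % p ℕ.≟ toℕ t₀ % p
    ... | no t₁≢q | _ = difference t₁ t₀ t₁∈U t₀∈U t₁≢p t₁≢q
    ... | yes _ | no t₂≢p = difference t₂ t₀ t₂∈U t₀∈U t₂≢p t₂≢q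
    ... | yes t₁≡q | yes t₂≡p = difference t₁ t₂ t₁∈U t₂∈U (λ eq → t₁≢p (≡.trans eq t₂≡p))
      (λ eq → t₂≢q (≡.trans (≡.sym eq) t₁≡q))

  G : ℕ
  G = Twisting.bound pp pq p≢q ℕ.+ Twisting.bound pp pq p≢q

  s-bound : ZN.Primitive N T → t ℕ.≤ s → s ℕ.≤ G
  s-bound prim t≤s = NormBounds.size-bound (conjugate-root (toℕ y) (proj₁ (proj₂ ud))) pp pq p≢q m n N≡ (fun-periodic S)
    (fun-indicator S)
      s t (ZN.ν N T y) (size-fun S) st≡N t≤s (proj₂ (proj₂ ud)) (primal y)
    where
    ud = unit-difference T (proj₁ (proj₂ dual)) prim
    y = proj₁ ud

  -- The root is ζ^(N-k) because `converse` evaluates T at the inverse of ζ^k.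
  t-bound : ZN.Primitive N S → s ℕ.≤ t → t ℕ.≤ G
  t-bound prim s≤t = NormBounds.size-bound (conjugate-root (N ℕ.∸ toℕ k) N⊥) pp pq p≢q m n N≡ (fun-periodic T)
    (fun-indicator T)
      t s (ZN.ν N S k) (size-fun T) (≡.trans (ℕ.*-comm t s) st≡N) s≤t (proj₂ (proj₂ ud)) (converse k)
    where
    ud = unit-difference S (proj₁ dual) prim
    k = proj₁ ud
    N⊥ : Coprime N (N ℕ.∸ toℕ k)
    N⊥ {d} (d∣N , d∣N-k) = proj₁ (proj₂ ud)
      (d∣N , ∣m+n∣m⇒∣n (≡.subst (d ∣_) (≡.sym (ℕ.m∸n+n≡m (ℕ.<⇒≤ (toℕ<n k)))) d∣N) d∣N-k)

  N≤G² : ZN.Primitive N S → ZN.Primitive N T → N ℕ.≤ G ℕ.* G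
  N≤G² prim-S prim-T with ℕ.≤-total t s
  ... | inj₁ t≤s = ≡.subst (ℕ._≤ G ℕ.* G) st≡N (ℕ.*-mono-≤ (s-bound prim-T t≤s) (ℕ.≤-trans t≤s (s-bound prim-T t≤s)))
  ... | inj₂ s≤t = ≡.subst (ℕ._≤ G ℕ.* G) st≡N (ℕ.*-mono-≤ (ℕ.≤-trans s≤t (t-bound prim-S s≤t)) (t-bound prim-S s≤t))

open import Data.Nat.Base using (_*_; _≤_)

theorem7p4 : (p q : ℕ) → Prime p → Prime q → p ≢ q →
    ∃[ B ] (∀ (N : ℕ) .{{_ : NonZero N}} → rad N ≡ p * q →
    (M : CyclotomicModel N) →
    (∃[ S ] ∃[ T ] (ZN.Primitive N S × ZN.Primitive N T × Dual.FormallyDual M S T)) →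
    N ≤ B)
theorem7p4 p q pp pq p≢q = G ℕ.* G , bounded
  where
  G = Twisting.bound pp pq p≢q ℕ.+ Twisting.bound pp pq p≢q
  bounded : ∀ (N : ℕ) .{{_ : NonZero N}} → rad N ≡ p ℕ.* q → (M : CyclotomicModel N) →
    (∃[ S ] ∃[ T ] (ZN.Primitive N S × ZN.Primitive N T × Dual.FormallyDual M S T)) → N ℕ.≤ G ℕ.* G
  bounded N rad≡ M (S , T , prim-S , prim-T , dual) = Duality.N≤G² {N} {{nz}} M pp pq p≢q (proj₁ fac)
    (proj₁ (proj₂ fac)) (proj₂ (proj₂ fac)) S T dual prim-S prim-T
    where
    -- The instance in the statement is irrelevant, whereas the modules above take a relevant one,
    -- so it is rebuilt from 0 < N.
    nz : NonZero N
    nz = ℕ.>-nonZero (ℕ.>-nonZero⁻¹ N)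
    fac = Radical.factorization {N} {{nz}} pp pq p≢q rad≡
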